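{- Let $r\ge 8$ be a natural number. Then (a) $F_v(2_r;r-5)\ge r+14$, and $F_v(2_r;r-5)=r+14$ if and only if $r\ge 13$; (b) $F_v(2_r;r-6)\ge r+16$ if $r\ge 9$, and $F_v(2_r;r-6)=r+16$ if $r\ge 15$; (c) $F_v(2_r;r-7)\ge r+17$ for $r\ge 10$, and $F_v(2_r;r-7)=r+17$ if and only if $r\ge 16$; (d) $F_v(2_r;r-8)\ge r+18$ for $r\ge 11$, and $F_v(2_r;r-8)=r+18$ if and only if $r\ge 17$; (e) $F_v(2_r;r-9)\ge r+20$ for $r\ge 12$, and $F_v(2_r;r-9)=r+20$ if $r\ge 19$.
   Context: All graphs are finite, simple and undirected; $\omega(G)$ denotes the clique number of $G$. For positive integers $a_1,\dots,a_r$, the notation $G\overset{v}{\to}(a_1,\dots,a_r)$ means that for every partition $V(G)=V_1\cup\dots\cup V_r$ into pairwise disjoint (possibly empty) sets there is some $i$ such that $V_i$ contains an $a_i$-clique. $(2_r)$ denotes the sequence of $r$ twos. $H_v(a_1,\dots,a_r;q)$ is the set of graphs $G$ with $G\overset{v}{\to}(a_1,\dots,a_r)$ and $\omega(G)<q$, and $F_v(a_1,\dots,a_r;q)=\min\{|V(G)|:G\in H_v(a_1,\dots,a_r;q)\}$ (it exists iff $q>\max\{a_1,\dots,a_r\}$). Equivalently, $F_v(2_r;q)$ is the minimum number of vertices of a graph with chromatic number at least $r+1$ and clique number less than $q$. -}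

module Defs where

open import Data.Nat using (ℕ; _≤_)
open import Data.Fin using (Fin)
open import Data.Bool using (Bool; true; false)
open import Data.Product using (Σ; ∃; _×_)
open import Relation.Binary.PropositionalEquality using (_≡_; _≢_)
open import Relation.Nullary using (¬_)

record Graph (n : ℕ) : Set where
  field
    adj    : Fin n → Fin n → Bool
    sym    : ∀ u v → adj u v ≡ adj v u
    irrefl : ∀ v → adj v v ≡ false

open Graph public

record CliqueIn {n : ℕ} (G : Graph n) (S : Fin n → Set) (k : ℕ) : Set where
  field
    vert     : Fin k → Fin n
    injective : ∀ i j → vert i ≡ vert j → i ≡ j
    adjacent : ∀ i j → i ≢ j → adj G (vert i) (vert j) ≡ true
    inside   : ∀ i → S (vert i)

HasClique : {n : ℕ} → Graph n → ℕ → Set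
HasClique G k = CliqueIn G (λ _ → ⊤') k
  where
  open import Data.Unit using () renaming (⊤ to ⊤')

CliqueNumberBelow : {n : ℕ} → Graph n → ℕ → Set
CliqueNumberBelow G q = ¬ HasClique G q

-- G →v (a_1,...,a_r): a partition V(G) = V_1 ∪ ... ∪ V_r into pairwise disjoint
-- (possibly empty) sets is the same as a map c : V(G) → Fin r (V_i = c⁻¹(i)).
VertexArrows : {n : ℕ} → Graph n → (r : ℕ) → (Fin r → ℕ) → Set
VertexArrows {n} G r a =
  (c : Fin n → Fin r) → ∃ λ (i : Fin r) → CliqueIn G (λ v → c v ≡ i) (a i)

InHv : {n : ℕ} → Graph n → (r : ℕ) → (Fin r → ℕ) → ℕ → Set
InHv G r a q = VertexArrows G r a × CliqueNumberBelow G q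

twos : (r : ℕ) → Fin r → ℕ
twos r _ = 2

FvGe : (r : ℕ) → (Fin r → ℕ) → ℕ → ℕ → Set
FvGe r a q m = ∀ (n : ℕ) (G : Graph n) → InHv G r a q → m ≤ n

FvEq : (r : ℕ) → (Fin r → ℕ) → ℕ → ℕ → Set
FvEq r a q m = FvGe r a q m × Σ (Graph m) (λ G → InHv G r a q)

-- A graph with n vertices, no r-colouring and no q-clique leaves a large gap χ − ω, and the theorem follows
-- from the least value gap(s) of n − χ among the graphs with χ − ω ≥ s.  Removing an independent triple costs
-- three vertices and one colour, and gap(s + 1) ≤ gap(s) + 2, so one may assume that there is none; then the
-- complement H is triangle-free, χ = n − ν(H) and ω = α(H).  A vertex covered by all maximum matchings of H can
-- be deleted.  Otherwise "no maximum matching exposes both vertices" is an equivalence relation (Gallai), so H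
-- splits into two parts without edges between them, or n ≤ 2ν + 1.  In the last case everything comes down to
-- the Ramsey bounds R(3,k) ≤ 3, 6, 9, 14, 19, 23, 29, 37 for k = 2, …, 9.
--
-- Those come from lower bounds for the number of edges of triangle-free graphs with n vertices and α ≤ k:
-- deleting a vertex v with its neighbours gives such a graph for k − 1, and summed over v the numbers of edges
-- left are n e − Σ d(v)².  Where this averaging is not sharp it still yields a vertex v whose nonneighbours span
-- a graph with few edges.  There are few such graphs, and H is recovered from one of them by attaching the
-- neighbours of v to independent sets, an exhaustive search which is carried out by evaluation.
--
-- The equalities come from triangle-free graphs on 27, 31, 33, 35 and 39 vertices without independent sets of
-- size 8, 9, 9, 9 and 10: their complements, to which dominating vertices may be added, are not r-colourable as
-- colour classes have at most two elements.

module Submission where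

open import Defs hiding (sym)
open import Agda.Builtin.Nat using (div-helper; mod-helper)
open import Data.Bool using (Bool; true; false; not; if_then_else_; _∧_; _∨_; T)
import Data.Bool.Properties as Bool
open import Data.Bool.Properties using (T-≡)
open import Data.Empty using (⊥; ⊥-elim)
import Data.Fin as Fin
open import Data.Fin using (Fin; toℕ)
import Data.Fin.Properties as Fin
open import Data.List
  using (List; []; _∷_; _++_; map; length; replicate; take; drop; concat; concatMap; lookup; allFin; tabulate)
import Data.List.Membership.DecPropositional as DecMembership
open import Data.List.Membership.Propositional using (_∈_; find; lose)
open import Data.List.Membership.Propositional.Properties
  using (∈-∃++; ∈-++⁺ˡ; ∈-++⁺ʳ; ∈-++⁻; ∈-map⁺; ∈-map⁻; ∈-concatMap⁺; ∈-concat⁻′; ∈-lookup; ∈-allFin)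
open import Data.List.Properties
  using (length-++; length-map; length-take; length-tabulate; take++drop≡id; ++-assoc; ++-identityʳ; map-++;
         map-tabulate; tabulate-lookup; concat-++)
open import Data.List.Relation.Binary.Permutation.Propositional
  using (_↭_; ↭-sym; ↭-trans; ↭-reflexive; prep; swap)
  renaming (refl to perm-refl; trans to perm-trans)
open import Data.List.Relation.Binary.Permutation.Propositional.Properties
  using (↭-length; ↭-empty-inv; shift; drop-∷; map⁺; ++⁺ˡ; ++⁺ʳ; ++⁺; ++-comm; ∈-resp-↭; All-resp-↭)
open import Data.List.Relation.Unary.All using (All; []; _∷_)
import Data.List.Relation.Unary.All as All
import Data.List.Relation.Unary.All.Properties as All
open import Data.List.Relation.Unary.AllPairs using (AllPairs; []; _∷_)
import Data.List.Relation.Unary.AllPairs.Properties as AllPairs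
open import Data.List.Relation.Unary.Any using (here; there)
import Data.List.Relation.Unary.Any as Any
import Data.List.Relation.Unary.Any.Properties as Any
open import Data.List.Relation.Unary.Unique.Propositional using (Unique)
open import Data.List.Relation.Unary.Unique.Propositional.Properties using (allFin⁺)
open import Data.Nat
open import Data.Nat.Divisibility
open import Data.Nat.Properties
open import Data.Nat.Tactic.RingSolver using (solve-∀)
open import Data.Product using (∃; ∃₂; _×_; _,_; proj₁; proj₂)
open import Data.Sum using (_⊎_; inj₁; inj₂)
open import Function using (_∘_; case_of_; Equivalence)
open import Relation.Binary.Definitions using (DecidableEquality)
open import Relation.Binary.PropositionalEquality
open import Relation.Nullary using (¬_; Dec; yes; no; does)
open import Relation.Nullary.Decidable using (_×-dec_; ¬?; dec-true; dec-false)

-- The lower bounds are inequalities between numbers, hence stable under double negation: maximum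
-- matchings and Gallai classes are obtained only up to `¬¬`, and classical case distinctions are
-- available. Vertex sets are lists up to permutation, so that deleting a vertex, splitting a set
-- and relabelling a graph are all handled by `_↭_`.
--
-- The values 2s of `gap` for s ≤ 6 are attained by joins of s 5-cycles, with 5s vertices, χ = 3s
-- and ω = 2s. From s = 7 on, complements of triangle-free graphs on 2ν + 1 vertices do better: they
-- need ν + 1 colours, and 13, 15, 16, 17, 19 are the values of ν for 27, 31, 33, 35, 39 vertices.
--
-- The "only if" parts use one more observation. For small r the graph has so many vertices that, by
-- Ramsey, it must contain an independent triple. Deleting it gives n ≥ r + 3 + gap(k + 1) for q = r
-- - k, instead of r + 1 + gap(k + 2). This gains a vertex where `gap` grows by one, for k = 5, 7,
-- 8; for k = 6 and 9 it grows by two, and nothing is gained.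

-- Sums over lists and filtered lists, up to permutation

keep : ∀ {A : Set} → (A → Bool) → List A → List A
keep p [] = []
keep p (x ∷ xs) = if p x then x ∷ keep p xs else keep p xs

module _ {A : Set} where

  ∑ : (A → ℕ) → List A → ℕ
  ∑ f [] = 0
  ∑ f (x ∷ xs) = f x + ∑ f xs

  ∑-↭ : ∀ (f : A → ℕ) {xs ys} → xs ↭ ys → ∑ f xs ≡ ∑ f ys
  ∑-↭ f perm-refl = refl
  ∑-↭ f (prep x p) = cong (f x +_) (∑-↭ f p)
  ∑-↭ f (swap x y p) rewrite ∑-↭ f p = exchange (f x) (f y) _
    where
    exchange : ∀ a b c → a + (b + c) ≡ b + (a + c)
    exchange = solve-∀
  ∑-↭ f (perm-trans p q) = trans (∑-↭ f p) (∑-↭ f q)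

  ∑-++ : ∀ (f : A → ℕ) xs ys → ∑ f (xs ++ ys) ≡ ∑ f xs + ∑ f ys
  ∑-++ f [] ys = refl
  ∑-++ f (x ∷ xs) ys = trans (cong (f x +_) (∑-++ f xs ys)) (sym (+-assoc (f x) _ _))

  ∑-+ : ∀ (f g : A → ℕ) xs → ∑ (λ x → f x + g x) xs ≡ ∑ f xs + ∑ g xs
  ∑-+ f g [] = refl
  ∑-+ f g (x ∷ xs) rewrite ∑-+ f g xs = interchange (f x) (g x) _ _
    where
    interchange : ∀ a b c d → a + b + (c + d) ≡ a + c + (b + d)
    interchange = solve-∀

  ∑-* : ∀ c (f : A → ℕ) xs → ∑ (λ x → c * f x) xs ≡ c * ∑ f xs
  ∑-* c f [] = sym (*-zeroʳ c)
  ∑-* c f (x ∷ xs) rewrite ∑-* c f xs = sym (*-distribˡ-+ c (f x) _)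

  ∑-const : ∀ c (xs : List A) → ∑ (λ _ → c) xs ≡ length xs * c
  ∑-const c [] = refl
  ∑-const c (x ∷ xs) = cong (c +_) (∑-const c xs)

  ∑-cong : ∀ {f g : A → ℕ} xs → (∀ {x} → x ∈ xs → f x ≡ g x) → ∑ f xs ≡ ∑ g xs
  ∑-cong [] h = refl
  ∑-cong (x ∷ xs) h = cong₂ _+_ (h (here refl)) (∑-cong xs (h ∘ there))

  ∑-mono : ∀ {f g : A → ℕ} xs → (∀ {x} → x ∈ xs → f x ≤ g x) → ∑ f xs ≤ ∑ g xs
  ∑-mono [] h = z≤n
  ∑-mono (x ∷ xs) h = +-mono-≤ (h (here refl)) (∑-mono xs (h ∘ there))

  keep-⊆ : ∀ p {x} (xs : List A) → x ∈ keep p xs → x ∈ xs × p x ≡ true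
  keep-⊆ p (y ∷ xs) i with p y in eq
  keep-⊆ p (y ∷ xs) (here refl) | true = here refl , eq
  keep-⊆ p (y ∷ xs) (there i) | true with j , e ← keep-⊆ p xs i = there j , e
  ... | false with j , e ← keep-⊆ p xs i = there j , e

  keep-∈ : ∀ p {x} {xs : List A} → x ∈ xs → p x ≡ true → x ∈ keep p xs
  keep-∈ p {xs = y ∷ xs} (here refl) e rewrite e = here refl
  keep-∈ p {xs = y ∷ xs} (there i) e with p y
  ... | true = there (keep-∈ p i e)
  ... | false = keep-∈ p i e

  keep-All : ∀ p (xs : List A) → All (λ x → p x ≡ true) (keep p xs)
  keep-All p xs = All.tabulate (λ i → proj₂ (keep-⊆ p xs i))

  keep-↭ : ∀ p {xs ys : List A} → xs ↭ ys → keep p xs ↭ keep p ys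
  keep-↭ p perm-refl = perm-refl
  keep-↭ p (prep x q) with p x
  ... | true = prep x (keep-↭ p q)
  ... | false = keep-↭ p q
  keep-↭ p (swap x y q) with p x | p y
  ... | true | true = swap x y (keep-↭ p q)
  ... | true | false = prep x (keep-↭ p q)
  ... | false | true = prep y (keep-↭ p q)
  ... | false | false = keep-↭ p q
  keep-↭ p (perm-trans q r) = perm-trans (keep-↭ p q) (keep-↭ p r)

  keep-split : ∀ p (xs : List A) → xs ↭ keep p xs ++ keep (not ∘ p) xs
  keep-split p [] = perm-refl
  keep-split p (x ∷ xs) with p x
  ... | true = prep x (keep-split p xs)
  ... | false = ↭-trans (prep x (keep-split p xs)) (↭-sym (shift x (keep p xs) _))

  keep-AllPairs : ∀ {R : A → A → Set} p {xs} → AllPairs R xs → AllPairs R (keep p xs)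
  keep-AllPairs p [] = []
  keep-AllPairs {R} p {x ∷ xs} (r ∷ rs) with p x
  ... | true = All.tabulate (λ i → All.lookup r (proj₁ (keep-⊆ p xs i))) ∷ keep-AllPairs p rs
  ... | false = keep-AllPairs p rs

  ∈-front : ∀ {x} {xs : List A} → x ∈ xs → ∃ λ rest → xs ↭ x ∷ rest
  ∈-front i with as , bs , refl ← ∈-∃++ i = as ++ bs , shift _ as bs

  AllPairs-↭ : ∀ {R : A → A → Set} → (∀ {x y} → R x y → R y x) →
               ∀ {xs ys : List A} → xs ↭ ys → AllPairs R xs → AllPairs R ys
  AllPairs-↭ s perm-refl r = r
  AllPairs-↭ s (prep x p) (a ∷ r) = All-resp-↭ p a ∷ AllPairs-↭ s p r
  AllPairs-↭ s (swap x y p) ((xy ∷ ax) ∷ ay ∷ r) =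
    (s xy ∷ All-resp-↭ p ay) ∷ All-resp-↭ p ax ∷ AllPairs-↭ s p r
  AllPairs-↭ s (perm-trans p q) r = AllPairs-↭ s q (AllPairs-↭ s p r)

∑-swap : ∀ {A B : Set} (f : A → B → ℕ) xs ys →
         ∑ (λ x → ∑ (f x) ys) xs ≡ ∑ (λ y → ∑ (λ x → f x y) xs) ys
∑-swap f [] ys = sym (trans (∑-const 0 ys) (*-zeroʳ (length ys)))
∑-swap f (x ∷ xs) ys rewrite ∑-swap f xs ys = sym (∑-+ (f x) _ ys)

⟦_⟧ : Bool → ℕ
⟦ true ⟧ = 1
⟦ false ⟧ = 0

∑-keep : ∀ {A : Set} p (f : A → ℕ) xs → ∑ (λ x → ⟦ p x ⟧ * f x) xs ≡ ∑ f (keep p xs)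
∑-keep p f [] = refl
∑-keep p f (x ∷ xs) with p x
... | true = cong₂ _+_ (*-identityˡ (f x)) (∑-keep p f xs)
... | false = ∑-keep p f xs

∑-length-keep : ∀ {A : Set} p (xs : List A) → ∑ (λ x → ⟦ p x ⟧) xs ≡ length (keep p xs)
∑-length-keep p [] = refl
∑-length-keep p (x ∷ xs) with p x
... | true = cong suc (∑-length-keep p xs)
... | false = ∑-length-keep p xs

∑-split : ∀ {A : Set} p (f : A → ℕ) xs → ∑ f xs ≡ ∑ f (keep p xs) + ∑ f (keep (not ∘ p) xs)
∑-split p f xs = trans (∑-↭ f (keep-split p xs)) (∑-++ f (keep p xs) _)

-- Edges of triangle-free graphs

module TriangleFree {V : Set} (_~_ : V → V → Bool)
  (~-sym : ∀ x y → (x ~ y) ≡ (y ~ x))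
  (~-irrefl : ∀ x → (x ~ x) ≡ false)
  (~-triangle : ∀ x y z → (x ~ y) ≡ true → (y ~ z) ≡ true → (x ~ z) ≡ true → ⊥) where

  Apart : V → V → Set
  Apart x y = (x ~ y) ≡ false

  Indep : List V → Set
  Indep = AllPairs Apart

  apart-sym : ∀ {x y} → Apart x y → Apart y x
  apart-sym {x} {y} e = trans (~-sym y x) e

  apart-common : ∀ {v x y} → (v ~ x) ≡ true → (v ~ y) ≡ true → Apart x y
  apart-common {v} {x} {y} p q with x ~ y in eq
  ... | false = refl
  ... | true = ⊥-elim (~-triangle v x y p eq q)

  degree : List V → V → ℕ
  degree xs v = ∑ (λ u → ⟦ v ~ u ⟧) xs

  near far : List V → V → List V
  near xs v = keep (v ~_) xs
  far xs v = keep (not ∘ (v ~_)) xs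

  edges : List V → ℕ
  edges [] = 0
  edges (x ∷ xs) = degree xs x + edges xs

  degree-near : ∀ xs v → degree xs v ≡ length (near xs v)
  degree-near xs v = ∑-length-keep (v ~_) xs

  handshake : ∀ xs → ∑ (degree xs) xs ≡ 2 * edges xs
  handshake [] = refl
  handshake (x ∷ xs) rewrite ~-irrefl x
    | ∑-+ (λ v → ⟦ v ~ x ⟧) (degree xs) xs
    | ∑-cong {f = λ v → ⟦ v ~ x ⟧} {g = λ v → ⟦ x ~ v ⟧} xs (λ {v} _ → cong ⟦_⟧ (~-sym v x))
    | handshake xs = double (degree xs x) (edges xs)
    where
    double : ∀ d e → d + (d + 2 * e) ≡ 2 * (d + e)
    double = solve-∀

  -- `edges` follows the order of the list, but its double is a sum of degrees, in which the order
  -- does not matter.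
  edges-↭ : ∀ {xs ys} → xs ↭ ys → edges xs ≡ edges ys
  edges-↭ {xs} {ys} p = *-cancelˡ-≡ (edges xs) (edges ys) 2 (begin
    2 * edges xs          ≡⟨ handshake xs ⟨
    ∑ (degree xs) xs      ≡⟨ ∑-cong xs (λ {v} _ → ∑-↭ (λ u → ⟦ v ~ u ⟧) p) ⟩
    ∑ (degree ys) xs      ≡⟨ ∑-↭ (degree ys) p ⟩
    ∑ (degree ys) ys      ≡⟨ handshake ys ⟩
    2 * edges ys          ∎)
    where open ≡-Reasoning

  near-indep : ∀ xs v → Indep (near xs v)
  near-indep [] v = []
  near-indep (x ∷ xs) v with v ~ x in eq
  ... | true = All.map (apart-common eq) (keep-All (v ~_) xs) ∷ near-indep xs v
  ... | false = near-indep xs v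

  degree-indep : ∀ {xs v} → All (Apart v) xs → degree xs v ≡ 0
  degree-indep [] = refl
  degree-indep (a ∷ as) rewrite a = degree-indep as

  -- There is no triangle, so the neighbours of `v` are pairwise nonadjacent: an edge that is not
  -- inside `far xs v` has exactly one end in `near xs v` and is counted once by the degrees there.
  edges-split : ∀ xs v → edges xs ≡ edges (far xs v) + ∑ (degree xs) (near xs v)
  edges-split xs v = *-cancelˡ-≡ (edges xs) _ 2 (begin
    2 * edges xs                                     ≡⟨ handshake xs ⟨
    ∑ (degree xs) xs                                 ≡⟨ ∑-split (v ~_) (degree xs) xs ⟩
    Z + ∑ (degree xs) F                              ≡⟨ cong (Z +_) farSum ⟩
    Z + (∑ (degree N) F + 2 * edges F)               ≡⟨ cong (λ z → Z + (z + 2 * edges F)) (sym nearSum) ⟩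
    Z + (Z + 2 * edges F)                            ≡⟨ regroup Z (edges F) ⟩
    2 * (edges F + Z)                                ∎)
    where
    open ≡-Reasoning
    N F : List V
    N = near xs v
    F = far xs v
    Z : ℕ
    Z = ∑ (degree xs) N
    regroup : ∀ z e → z + (z + 2 * e) ≡ 2 * (e + z)
    regroup = solve-∀
    splitDegree : ∀ u → degree xs u ≡ degree N u + degree F u
    splitDegree u = ∑-split (v ~_) (λ w → ⟦ u ~ w ⟧) xs
    farSum : ∑ (degree xs) F ≡ ∑ (degree N) F + 2 * edges F
    farSum = trans (∑-cong F (λ {u} _ → splitDegree u))
      (trans (∑-+ (degree N) (degree F) F) (cong (∑ (degree N) F +_) (handshake F)))
    nearSum : Z ≡ ∑ (degree N) F
    nearSum = begin
      ∑ (degree xs) N                       ≡⟨ ∑-cong N (λ {u} i → trans (splitDegree u)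
                                                 (cong (_+ degree F u) (degree-indep (All.map (apart-common
                                                     (All.lookup (keep-All (v ~_) xs) i)) (keep-All (v ~_) xs))))) ⟩
      ∑ (degree F) N                        ≡⟨ ∑-swap (λ u w → ⟦ u ~ w ⟧) N F ⟩
      ∑ (λ w → ∑ (λ u → ⟦ u ~ w ⟧) N) F     ≡⟨ ∑-cong F (λ {w} _ → ∑-cong N (λ {u} _ → cong ⟦_⟧ (~-sym u w))) ⟩
      ∑ (degree N) F                        ∎

  -- When `edges-split` is summed over `v`, the degree of `u` appears once for every neighbour of
  -- `u`, which makes its square.
  averaging : ∀ xs → ∑ (λ v → edges (far xs v)) xs + ∑ (λ v → degree xs v * degree xs v) xs
                     ≡ length xs * edges xs
  averaging xs = begin
    ∑ (λ v → edges (far xs v)) xs + ∑ (λ v → degree xs v * degree xs v) xs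
      ≡⟨ cong (∑ (λ v → edges (far xs v)) xs +_) squares ⟨
    ∑ (λ v → edges (far xs v)) xs + ∑ (λ v → ∑ (degree xs) (near xs v)) xs
      ≡⟨ ∑-+ (λ v → edges (far xs v)) _ xs ⟨
    ∑ (λ v → edges (far xs v) + ∑ (degree xs) (near xs v)) xs
      ≡⟨ ∑-cong xs (λ {v} _ → edges-split xs v) ⟨
    ∑ (λ v → edges xs) xs
      ≡⟨ ∑-const (edges xs) xs ⟩
    length xs * edges xs ∎
    where
    open ≡-Reasoning
    squares : ∑ (λ v → ∑ (degree xs) (near xs v)) xs ≡ ∑ (λ v → degree xs v * degree xs v) xs
    squares = begin
      ∑ (λ v → ∑ (degree xs) (near xs v)) xs
        ≡⟨ ∑-cong xs (λ {v} _ → ∑-keep (v ~_) (degree xs) xs) ⟨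
      ∑ (λ v → ∑ (λ u → ⟦ v ~ u ⟧ * degree xs u) xs) xs
        ≡⟨ ∑-swap (λ v u → ⟦ v ~ u ⟧ * degree xs u) xs xs ⟩
      ∑ (λ u → ∑ (λ v → ⟦ v ~ u ⟧ * degree xs u) xs) xs
        ≡⟨ ∑-cong xs (λ {u} _ → trans
             (∑-cong xs (λ {v} _ → trans (*-comm ⟦ v ~ u ⟧ (degree xs u)) (cong (λ b → degree xs u * ⟦ b ⟧) (~-sym v u))))
             (∑-* (degree xs u) (λ v → ⟦ u ~ v ⟧) xs)) ⟩
      ∑ (λ u → degree xs u * degree xs u) xs ∎

  -- Vertex sets are lists; xs ↭ ys ++ zs says that ys is a subset of xs with complement zs.
  IndepBound : List V → ℕ → Set
  IndepBound xs k = ∀ ys zs → xs ↭ ys ++ zs → Indep ys → length ys ≤ k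

  indepBound-part : ∀ {xs k} ys {zs} → xs ↭ ys ++ zs → IndepBound xs k → IndepBound ys k
  indepBound-part ys {zs} p a us ws q i =
    a us (ws ++ zs) (↭-trans p (↭-trans (++⁺ʳ zs q) (↭-reflexive (++-assoc us ws zs)))) i

  degree-≤ : ∀ {xs k} v → IndepBound xs k → degree xs v ≤ k
  degree-≤ {xs} v a = subst (_≤ _) (sym (degree-near xs v))
    (a (near xs v) (far xs v) (keep-split (v ~_) xs) (near-indep xs v))

  -- An independent set of nonneighbours of `v` can be enlarged by `v`.
  indepBound-far : ∀ {xs k v rest} → xs ↭ v ∷ rest → IndepBound xs (suc k) → IndepBound (far rest v) k
  indepBound-far {xs} {k} {v} {rest} p a ys zs q i =
    s≤s⁻¹ (a (v ∷ ys) (zs ++ near rest v) (↭-trans p (prep v reorder)) (apart ∷ i))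
    where
    reorder : rest ↭ ys ++ zs ++ near rest v
    reorder = ↭-trans (keep-split (v ~_) rest) (↭-trans (++-comm (near rest v) (far rest v))
      (↭-trans (++⁺ʳ (near rest v) q) (↭-reflexive (++-assoc ys zs _))))
    unnot : ∀ b → not b ≡ true → b ≡ false
    unnot false _ = refl
    apart : All (Apart v) ys
    apart = All.++⁻ˡ ys (All-resp-↭ q (All.map (λ {x} e → unnot (v ~ x) e) (keep-All (not ∘ (v ~_)) rest)))

  -- `far xs v` contains `v` itself. This suits `averaging`, as `v` is isolated there and adds no
  -- edges, whereas the independence bound and the vertex count require `far rest v`.
  far-self : ∀ {xs v rest} → xs ↭ v ∷ rest → far xs v ↭ v ∷ far rest v
  far-self {xs} {v} {rest} p = ↭-trans (keep-↭ (not ∘ (v ~_)) p) (↭-reflexive lemma)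
    where
    lemma : far (v ∷ rest) v ≡ v ∷ far rest v
    lemma rewrite ~-irrefl v = refl

  near-self : ∀ {xs v rest} → xs ↭ v ∷ rest → near xs v ↭ near rest v
  near-self {xs} {v} {rest} p = ↭-trans (keep-↭ (v ~_) p) (↭-reflexive lemma)
    where
    lemma : near (v ∷ rest) v ≡ near rest v
    lemma rewrite ~-irrefl v = refl

  edges-far : ∀ {xs v rest} → xs ↭ v ∷ rest → edges (far xs v) ≡ edges (far rest v)
  edges-far {xs} {v} {rest} p = trans (edges-↭ (far-self p))
    (cong (_+ edges (far rest v)) (degree-indep (All.map (λ {x} e → unnot (v ~ x) e) (keep-All (not ∘ (v ~_)) rest))))
    where
    unnot : ∀ b → not b ≡ true → b ≡ false
    unnot false _ = refl

  length-far : ∀ {xs v rest n} → xs ↭ v ∷ rest → length xs ≡ n → length (far rest v) ≡ n ∸ suc (degree xs v)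
  length-far {xs} {v} {rest} p refl = begin
    length (far rest v)                                       ≡⟨ m+n∸m≡n (length (near rest v)) _ ⟨
    length (near rest v) + length (far rest v) ∸ length (near rest v)
      ≡⟨ cong (_∸ length (near rest v)) (trans (↭-length (keep-split (v ~_) rest)) (length-++ (near rest v))) ⟨
    length rest ∸ length (near rest v)                        ≡⟨ cong₂ (λ a b → a ∸ suc b) (↭-length p) (trans
        (degree-near xs v) (↭-length (near-self p))) ⟨
    length xs ∸ suc (degree xs v) ∎
    where open ≡-Reasoning

-- Edge bounds by averaging, and their numerical certificates

≤ᵇ-sound : ∀ {m n} → (m ≤ᵇ n) ≡ true → m ≤ n
≤ᵇ-sound {m} {n} e = ≤ᵇ⇒≤ m n (Equivalence.from T-≡ e)

<ᵇ-sound : ∀ {m n} → (m <ᵇ n) ≡ true → m < n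
<ᵇ-sound {m} {n} e = <ᵇ⇒< m n (Equivalence.from T-≡ e)

∧-sound : ∀ {a b} → a ∧ b ≡ true → a ≡ true × b ≡ true
∧-sound {true} {true} refl = refl , refl

∨-sound : ∀ {a b} → a ∨ b ≡ true → a ≡ true ⊎ b ≡ true
∨-sound {true} refl = inj₁ refl
∨-sound {false} e = inj₂ e

allBelow : (ℕ → Bool) → ℕ → Bool
allBelow p zero = true
allBelow p (suc n) = p n ∧ allBelow p n

allBelow-sound : ∀ p n → allBelow p n ≡ true → ∀ {i} → i < n → p i ≡ true
allBelow-sound p (suc n) h {i} i<1+n with ∧-sound h | m<1+n⇒m<n∨m≡n i<1+n
... | _ , r | inj₁ i<n = allBelow-sound p n r i<n
... | q , _ | inj₂ refl = q

-- Certifies that degrees d(v) with Σ d(v) = 2E and Σ (d(v)² + ψ(d(v))) ≤ nE do not exist: the values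
-- d² + ψ(d) lie above the line through the points with abscissae d₁ and d₁ + w.  Both sides are moved
-- so that no subtraction occurs.
lineCheck : (ℕ → ℕ) → (k n E d₁ w : ℕ) → Bool
lineCheck ψ k n E d₁ w =
  allBelow (λ d → a * (d₁ + w) + b * d ≤ᵇ w * (d * d + ψ d) + a * d + b * d₁) (suc k)
  ∧ (w * (n * E) + a * (2 * E) + n * (b * d₁) <ᵇ n * (a * (d₁ + w)) + b * (2 * E))
  where
  a b : ℕ
  a = d₁ * d₁ + ψ d₁
  b = (d₁ + w) * (d₁ + w) + ψ (d₁ + w)

-- The first entries are the values for n = 0, 1, …; from r on, where no graph exists, the values grow
-- linearly, which keeps d² + ψ(d) convex enough for lineCheck.
table : ℕ → List ℕ → ℕ → ℕ
table r xs n = if n <ᵇ r then nth xs n else 400 * (suc n ∸ r)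
  where
  nth : List ℕ → ℕ → ℕ
  nth [] _ = 0
  nth (x ∷ xs) zero = x
  nth (x ∷ xs) (suc n) = nth xs n

-- Either 2E exceeds the sum of degrees allowed by the maximal degree `k`, or the chord over the two
-- consecutive integers around the average degree 2E/n refutes E. `div-helper` computes the quotient
-- of 2E by n without the proof that n is nonzero.
refuted : (ℕ → ℕ) → (k n E : ℕ) → Bool
refuted t k n E = (n * k <ᵇ 2 * E) ∨ lineCheck (λ d → t (n ∸ suc d)) k n E (div-helper 0 (n ∸ 1) (2 * E) (n ∸ 1)) 1

-- Below `r` the edge numbers smaller than the table value are excluded. On `r` vertices all edge
-- numbers up to `r * k` are, so that no graph is left.
tableCheck : (t : ℕ → ℕ) (k r : ℕ) (t′ : ℕ → ℕ) (exempt : ℕ → ℕ → Bool) → Bool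
tableCheck t k r t′ exempt =
  allBelow (λ n → allBelow (λ E → exempt n E ∨ refuted t k n E) (t′ n)) r
  ∧ allBelow (λ E → exempt r E ∨ refuted t k r E) (suc (r * k))

module Bounds {V : Set} (_~_ : V → V → Bool)
  (~-sym : ∀ x y → (x ~ y) ≡ (y ~ x))
  (~-irrefl : ∀ x → (x ~ x) ≡ false)
  (~-triangle : ∀ x y z → (x ~ y) ≡ true → (y ~ z) ≡ true → (x ~ z) ≡ true → ⊥) where
  open TriangleFree _~_ ~-sym ~-irrefl ~-triangle

  -- If every vertex left at least ψ(d(v)) edges, `averaging` would give Σ (d(v)² + ψ(d(v))) ≤ nE;
  -- adding up the chord inequality over all vertices, with Σ d(v) = 2E, gives the contrary. With ψ
  -- a valid minimum this excludes the graph. With ψ raised above the minimum it supplies a vertex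
  -- whose nonneighbours span few edges.
  low-vertex : ∀ ψ k n E d₁ w → lineCheck ψ k n E d₁ w ≡ true →
    ∀ {xs} → length xs ≡ n → IndepBound xs k → edges xs ≡ E →
    ∃ λ v → v ∈ xs × edges (far xs v) < ψ (degree xs v)
  low-vertex ψ k n E d₁ w check {xs} refl α refl
    with Any.any? (λ v → edges (far xs v) <? ψ (degree xs v)) xs | ∧-sound check
  ... | yes p | _ = find p
  ... | no ¬p | convex , contra = ⊥-elim (<⇒≱ (<ᵇ-sound contra) total)
    where
    open ≤-Reasoning
    a b : ℕ
    a = d₁ * d₁ + ψ d₁
    b = (d₁ + w) * (d₁ + w) + ψ (d₁ + w)
    d : V → ℕ
    d = degree xs
    pointwise : ∀ {v} → v ∈ xs →
      a * (d₁ + w) + b * d v ≤ w * (edges (far xs v) + d v * d v) + (a * d v + b * d₁)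
    pointwise {v} i = begin
      a * (d₁ + w) + b * d v                             ≤⟨ ≤ᵇ-sound (allBelow-sound _ _ convex (s≤s (degree-≤ v α))) ⟩
      w * (d v * d v + ψ (d v)) + a * d v + b * d₁       ≡⟨ +-assoc (w * _) (a * d v) _ ⟩
      w * (d v * d v + ψ (d v)) + (a * d v + b * d₁)     ≤⟨ +-monoˡ-≤ _ (*-monoʳ-≤ w (+-monoʳ-≤ (d v * d v) ψ≤)) ⟩
      w * (d v * d v + edges (far xs v)) + (a * d v + b * d₁) ≡⟨ cong (λ z → w * z + (a * d v + b * d₁)) (+-comm
          (d v * d v) _) ⟩
      w * (edges (far xs v) + d v * d v) + (a * d v + b * d₁) ∎
      where
      ψ≤ : ψ (d v) ≤ edges (far xs v)
      ψ≤ = ≮⇒≥ (λ lt → ¬p (Any.map (λ { refl → lt }) i))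
    total : length xs * (a * (d₁ + w)) + b * (2 * edges xs)
            ≤ w * (length xs * edges xs) + a * (2 * edges xs) + length xs * (b * d₁)
    total = begin
      length xs * (a * (d₁ + w)) + b * (2 * edges xs)
        ≡⟨ cong₂ _+_ (∑-const _ xs) (trans (∑-* b d xs) (cong (b *_) (handshake xs))) ⟨
      ∑ (λ _ → a * (d₁ + w)) xs + ∑ (λ v → b * d v) xs
        ≡⟨ ∑-+ _ _ xs ⟨
      ∑ (λ v → a * (d₁ + w) + b * d v) xs
        ≤⟨ ∑-mono xs pointwise ⟩
      ∑ (λ v → w * (edges (far xs v) + d v * d v) + (a * d v + b * d₁)) xs
        ≡⟨ ∑-+ _ _ xs ⟩
      ∑ (λ v → w * (edges (far xs v) + d v * d v)) xs + ∑ (λ v → a * d v + b * d₁) xs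
        ≡⟨ cong₂ _+_ (trans (∑-* w _ xs) (cong (w *_) (trans (∑-+ _ _ xs) (averaging xs)))) (∑-+ _ _ xs) ⟩
      w * (length xs * edges xs) + (∑ (λ v → a * d v) xs + ∑ (λ _ → b * d₁) xs)
        ≡⟨ cong (w * (length xs * edges xs) +_) (cong₂ _+_ (trans (∑-* a d xs) (cong (a *_) (handshake xs)))
            (∑-const _ xs)) ⟩
      w * (length xs * edges xs) + (a * (2 * edges xs) + length xs * (b * d₁))
        ≡⟨ +-assoc (w * (length xs * edges xs)) _ _ ⟨
      w * (length xs * edges xs) + a * (2 * edges xs) + length xs * (b * d₁) ∎

  MinEdges : ℕ → (ℕ → ℕ) → Set
  MinEdges k t = ∀ {xs} → IndepBound xs k → t (length xs) ≤ edges xs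

  NoGraph : ℕ → ℕ → ℕ → Set
  NoGraph k n E = ∀ {xs} → length xs ≡ n → IndepBound xs k → edges xs ≡ E → ⊥

  edges-far-min : ∀ {k t xs v} → MinEdges k t → IndepBound xs (suc k) → v ∈ xs →
                  t (length xs ∸ suc (degree xs v)) ≤ edges (far xs v)
  edges-far-min {k} {t} {xs} {v} T α i with rest , p ← ∈-front i =
    subst₂ _≤_ (cong t (length-far p refl)) (sym (edges-far p)) (T (indepBound-far p α))

  edges-≤ : ∀ {k xs} → IndepBound xs k → 2 * edges xs ≤ length xs * k
  edges-≤ {k} {xs} α = begin
    2 * edges xs        ≡⟨ handshake xs ⟨
    ∑ (degree xs) xs    ≤⟨ ∑-mono xs (λ {v} _ → degree-≤ v α) ⟩
    ∑ (λ _ → k) xs      ≡⟨ ∑-const k xs ⟩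
    length xs * k       ∎
    where open ≤-Reasoning

  refuted-sound : ∀ {k} t → MinEdges k t → ∀ n E → refuted t (suc k) n E ≡ true → NoGraph (suc k) n E
  refuted-sound {k} t T n E h {xs} refl α refl with ∨-sound {n * suc k <ᵇ 2 * E} h
  ... | inj₁ big = <⇒≱ (<ᵇ-sound big) (edges-≤ α)
  ... | inj₂ line with v , i , lt ← low-vertex (λ d → t (n ∸ suc d)) (suc k) n E
                                      (div-helper 0 (n ∸ 1) (2 * E) (n ∸ 1)) 1 line refl α refl =
    <⇒≱ lt (edges-far-min {k} {t} T α i)

  minEdges-step : ∀ {k} t r ys exempt → MinEdges k t →
    (∀ n E → exempt n E ≡ true → NoGraph (suc k) n E) →
    tableCheck t (suc k) r (table r ys) exempt ≡ true → MinEdges (suc k) (table r ys)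
  minEdges-step {k} t r ys exempt T ex check {xs} α
    with ∧-sound {allBelow (λ n → allBelow (λ E → exempt n E ∨ refuted t (suc k) n E) (table r ys n)) r} check
  ... | small , none = ≮⇒≥ (below (length xs <? r))
    where
    excluded : ∀ n E → exempt n E ∨ refuted t (suc k) n E ≡ true → NoGraph (suc k) n E
    excluded n E h with ∨-sound {exempt n E} h
    ... | inj₁ e = ex n E e
    ... | inj₂ e = refuted-sound t T n E e
    below : Relation.Nullary.Dec (length xs < r) → ¬ (edges xs < table r ys (length xs))
    below (yes n<r) E<t =
      excluded _ _ (allBelow-sound _ _ (allBelow-sound _ _ small n<r) E<t) {xs} refl α refl
    -- From `r` on the table values are fictitious, and what is shown is that no graph exists: any
    -- `r` of its vertices would span one excluded by the second half of the check.
    below (no n≮r) _ = excluded r _ (allBelow-sound _ _ none (s≤s E≤)) {take r xs} len α′ refl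
      where
      len : length (take r xs) ≡ r
      len = trans (length-take r xs) (m≤n⇒m⊓n≡m (≮⇒≥ n≮r))
      α′ : IndepBound (take r xs) (suc k)
      α′ = indepBound-part (take r xs) {drop r xs} (↭-reflexive (sym (take++drop≡id r xs))) α
      E≤ : edges (take r xs) ≤ r * suc k
      E≤ = ≤-trans (m≤m+n _ _) (subst (λ n → 2 * edges (take r xs) ≤ n * suc k) len (edges-≤ α′))

  -- At `r` the table has the value 400, the first of its linear continuation, but maximal degree
  -- `k` allows only `r * k / 2` edges, which is less.
  noGraph-beyond : ∀ {k t r ys} → MinEdges k t → (∀ n → t n ≡ table r ys n) → r * k < 800 →
    ∀ {xs} → r ≤ length xs → IndepBound xs k → ⊥
  noGraph-beyond {k} {t} {r} {ys} T eq lt {xs} le α = <⇒≱ lt (begin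
    800                                 ≤⟨ *-monoʳ-≤ 2 t-r ⟩
    2 * edges (take r xs)               ≤⟨ edges-≤ α′ ⟩
    length (take r xs) * k              ≡⟨ cong (_* k) len ⟩
    r * k                               ∎)
    where
    open ≤-Reasoning
    len : length (take r xs) ≡ r
    len = trans (length-take r xs) (m≤n⇒m⊓n≡m le)
    α′ : IndepBound (take r xs) k
    α′ = indepBound-part (take r xs) {drop r xs} (↭-reflexive (sym (take++drop≡id r xs))) α
    t-r : 400 ≤ edges (take r xs)
    t-r = begin
      400                       ≡⟨ table-r ⟨
      table r ys r              ≡⟨ eq r ⟨
      t r                       ≡⟨ cong t len ⟨
      t (length (take r xs))    ≤⟨ T α′ ⟩
      edges (take r xs)         ∎
      where
      table-r : table r ys r ≡ 400
      table-r with r <ᵇ r in lt′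
      ... | true = ⊥-elim (<-irrefl refl (<ᵇ-sound {r} {r} lt′))
      ... | false rewrite m+n∸n≡m 1 r = refl

-- Attaching the neighbours of a vertex

-- A mask is a subset of a list of vertices; the rows of a code are the neighbourhoods of the vertices of a
-- list among the later ones.
Mask Code : Set
Mask = List Bool
Code = List Mask

disjoint : Mask → Mask → Bool
disjoint [] _ = true
disjoint (_ ∷ _) [] = true
disjoint (false ∷ xs) (_ ∷ ys) = disjoint xs ys
disjoint (true ∷ xs) (false ∷ ys) = disjoint xs ys
disjoint (true ∷ xs) (true ∷ ys) = false

size : Mask → ℕ
size [] = 0
size (true ∷ m) = suc (size m)
size (false ∷ m) = size m

extendMasks : Mask → List Mask → List Mask
extendMasks r Is = map (true ∷_) (keep (disjoint r) Is) ++ map (false ∷_) Is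

indMasks : Code → List Mask
indMasks [] = [] ∷ []
indMasks (r ∷ C) = extendMasks r (indMasks C)

scale : ℕ → Mask → List ℕ → List ℕ
scale p [] ws = ws
scale p (true ∷ I) [] = p ∷ scale p I []
scale p (false ∷ I) [] = 1 ∷ scale p I []
scale p (true ∷ I) (w ∷ ws) = p * w ∷ scale p I ws
scale p (false ∷ I) (w ∷ ws) = w ∷ scale p I ws

weights : List ℕ → List Mask → List ℕ
weights (p ∷ ps) (I ∷ Is) = scale p I (weights ps Is)
weights _ _ = []

modulus : List ℕ → List Mask → ℕ
modulus (p ∷ ps) (I ∷ Is) = p * modulus ps Is
modulus _ _ = 1

weigh : List ℕ → Mask → ℕ
weigh (w ∷ ws) (true ∷ m) = w * weigh ws m
weigh (w ∷ ws) (false ∷ m) = weigh ws m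
weigh _ _ = 1

-- Answering `true` too often merely enlarges the search, so this is the answer for divisor zero.
-- `mod-helper` is the remainder without a proof that the divisor is nonzero.
dividesᵇ : ℕ → ℕ → Bool
dividesᵇ zero a = true
dividesᵇ (suc n) a = mod-helper 0 n a n ≡ᵇ 0

dividesᵇ-complete : ∀ P {a} → P ∣ a → dividesᵇ P a ≡ true
dividesᵇ-complete zero d = refl
dividesᵇ-complete (suc n) {a} d rewrite n∣m⇒m%n≡0 a (suc n) d = refl

common : Mask → Mask → ℕ
common (true ∷ xs) (true ∷ ys) = suc (common xs ys)
common (true ∷ xs) (false ∷ ys) = common xs ys
common (false ∷ xs) (_ ∷ ys) = common xs ys
common _ _ = 0

common-positive : ∀ I m → disjoint I m ≡ false → 0 < common I m
common-positive (true ∷ I) (true ∷ m) e = z<s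
common-positive (true ∷ I) (false ∷ m) e = common-positive I m e
common-positive (false ∷ I) (true ∷ m) e = common-positive I m e
common-positive (false ∷ I) (false ∷ m) e = common-positive I m e

weigh-scale : ∀ p I ws m → weigh (scale p I ws) m ≡ p ^ common I m * weigh ws m
weigh-scale p [] ws m = sym (*-identityˡ (weigh ws m))
weigh-scale p (true ∷ I) [] [] = refl
weigh-scale p (true ∷ I) [] (true ∷ m) rewrite weigh-scale p I [] m = sym (*-assoc p _ _)
weigh-scale p (true ∷ I) [] (false ∷ m) = weigh-scale p I [] m
weigh-scale p (false ∷ I) [] [] = refl
weigh-scale p (false ∷ I) [] (true ∷ m) = trans (*-identityˡ _) (weigh-scale p I [] m)
weigh-scale p (false ∷ I) [] (false ∷ m) = weigh-scale p I [] m
weigh-scale p (true ∷ I) (w ∷ ws) [] = refl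
weigh-scale p (true ∷ I) (w ∷ ws) (true ∷ m) rewrite weigh-scale p I ws m =
  regroup p w (p ^ common I m) (weigh ws m)
  where
  regroup : ∀ p w q v → p * w * (q * v) ≡ p * q * (w * v)
  regroup = solve-∀
weigh-scale p (true ∷ I) (w ∷ ws) (false ∷ m) = weigh-scale p I ws m
weigh-scale p (false ∷ I) (w ∷ ws) [] = refl
weigh-scale p (false ∷ I) (w ∷ ws) (true ∷ m) rewrite weigh-scale p I ws m =
  regroup w (p ^ common I m) (weigh ws m)
  where
  regroup : ∀ w q v → w * (q * v) ≡ q * (w * v)
  regroup = solve-∀
weigh-scale p (false ∷ I) (w ∷ ws) (false ∷ m) = weigh-scale p I ws m

Hits : Mask → Mask → Mask → Set
Hits m₁ m₂ I = disjoint I m₁ ≡ false ⊎ disjoint I m₂ ≡ false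

-- Give each set I of the family its own number p (a prime, for the test to be sharp) and let the weight
-- of a vertex be the product of the p's of the sets containing it.  A set of vertices hits every member
-- of the family only if the product of its weights is divisible by the product of all p's.
modulus-divides : ∀ ps Is m₁ m₂ → All (Hits m₁ m₂) Is →
  modulus ps Is ∣ weigh (weights ps Is) m₁ * weigh (weights ps Is) m₂
modulus-divides [] Is m₁ m₂ h = 1∣ _
modulus-divides (p ∷ ps) [] m₁ m₂ h = 1∣ _
modulus-divides (p ∷ ps) (I ∷ Is) m₁ m₂ (h ∷ hs)
  rewrite weigh-scale p I (weights ps Is) m₁ | weigh-scale p I (weights ps Is) m₂ =
  subst (p * modulus ps Is ∣_) (regroup (p ^ common I m₁) (p ^ common I m₂) _ _)
    (*-pres-∣ (divides-power h) (modulus-divides ps Is m₁ m₂ hs))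
  where
  regroup : ∀ a b c d → a * b * (c * d) ≡ a * c * (b * d)
  regroup = solve-∀
  p∣p^ : ∀ {n} → 0 < n → p ∣ p ^ n
  p∣p^ {suc n} _ = m∣m*n (p ^ n)
  divides-power : Hits m₁ m₂ I → p ∣ p ^ common I m₁ * p ^ common I m₂
  divides-power (inj₁ e) = ∣m⇒∣m*n _ (p∣p^ (common-positive I m₁ e))
  divides-power (inj₂ e) = ∣n⇒∣m*n (p ^ common I m₁) (p∣p^ (common-positive I m₂ e))

record Cone : Set where
  constructor cone
  field
    mask : Mask
    deficit weight : ℕ
open Cone public

admissible : ℕ → ℕ → Cone → Cone → Bool
admissible P budget c x = (deficit x ≤ᵇ budget) ∧ dividesᵇ P (weight c * weight x)

-- A cone is the set of the neighbours which a neighbour of v has far from v; the budget is the number of edges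
-- by which the cones still to be chosen fall short of the maximal size.  As the list is sorted by deficit, the
-- budget cannot be used up any more once the first deficit is too small.
search : (P r budget : ℕ) → List Cone → List Cone → List (List Cone)
search P zero budget cs chosen = if budget ≡ᵇ 0 then chosen ∷ [] else []
search P (suc r) budget [] chosen = []
search P (suc r) budget (c ∷ cs) chosen =
  if suc r * deficit c <ᵇ budget then [] else
  ((if deficit c ≤ᵇ budget
    then search P r (budget ∸ deficit c) (keep (admissible P (budget ∸ deficit c) c) (c ∷ cs)) (c ∷ chosen)
    else [])
   ++ search P (suc r) budget cs chosen)

Descending : List Cone → Set
Descending = AllPairs (λ x y → deficit y ≤ deficit x)

module _ {V : Set} (P : ℕ) (f : V → Cone) where

  Compatible : List V → Set
  Compatible ys = ∀ {y z zs} → ys ↭ y ∷ z ∷ zs → dividesᵇ P (weight (f y) * weight (f z)) ≡ true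

  -- This decides between the branches of `search`: the first cone is skipped if no remaining vertex
  -- has it, and otherwise a vertex having it is chosen. As `c` stays among the candidates after
  -- being chosen, several vertices may share a cone.
  extract : ∀ {c cs} ys → All (λ y → f y ∈ c ∷ cs) ys →
    All (λ y → f y ∈ cs) ys ⊎ (∃₂ λ y ys′ → ys ↭ y ∷ ys′ × f y ≡ c)
  extract [] [] = inj₁ []
  extract (y ∷ ys) (here e ∷ as) = inj₂ (y , ys , perm-refl , e)
  extract (y ∷ ys) (there i ∷ as) with extract ys as
  ... | inj₁ bs = inj₁ (i ∷ bs)
  ... | inj₂ (z , zs , p , e) = inj₂ (z , y ∷ zs , perm-trans (prep y p) (swap y z perm-refl) , e)

  -- The search sees only cones; the witness `out` is a reordering of the vertices themselves, from
  -- which the code of the whole graph can be compared with the output.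
  Complete : (r budget : ℕ) → List Cone → Set
  Complete r budget cs = ∀ chosen ys → length ys ≡ r → ∑ (deficit ∘ f) ys ≡ budget →
    All (λ y → f y ∈ cs) ys → Compatible ys →
    ∃ λ out → chosen ++ ys ↭ out × map f out ∈ search P r budget cs (map f chosen)

  choose : ∀ {r budget y ys ys′ cs} chosen → ys ↭ y ∷ ys′ → length ys ≡ suc r → ∑ (deficit ∘ f) ys ≡ budget →
    All (λ y → f y ∈ cs) ys → Compatible ys →
    Complete r (budget ∸ deficit (f y)) (keep (admissible P (budget ∸ deficit (f y)) (f y)) cs) →
    ∃ λ out → chosen ++ ys ↭ out × map f out ∈
      search P r (budget ∸ deficit (f y)) (keep (admissible P (budget ∸ deficit (f y)) (f y)) cs) (f y ∷ map f chosen)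
  choose {r} {budget} {y} {ys} {ys′} {cs} chosen p len bud mem comp IH =
    proj₁ found , perm-trans (++⁺ˡ chosen p) (perm-trans (shift y chosen ys′) (proj₁ (proj₂ found))) ,
    proj₂ (proj₂ found)
    where
    rest : ∑ (deficit ∘ f) ys′ ≡ budget ∸ deficit (f y)
    rest = trans (sym (m+n∸m≡n (deficit (f y)) _))
      (cong (_∸ deficit (f y)) (trans (sym (∑-↭ (deficit ∘ f) p)) bud))
    mem′ : All (λ z → f z ∈ cs) ys′
    mem′ = All.tail (All-resp-↭ p mem)
    compatible′ : Compatible ys′
    compatible′ {z} {w} {zs} s = comp {z} {w} {y ∷ zs}
      (perm-trans p (perm-trans (prep y s) (perm-trans (swap y z perm-refl) (prep z (swap y w perm-refl)))))
    kept : ∀ {z} → z ∈ ys′ → f z ∈ keep (admissible P (budget ∸ deficit (f y)) (f y)) cs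
    kept {z} i with zs , s ← ∈-front i = keep-∈ _ (All.lookup mem′ i)
      (cong₂ _∧_ (Equivalence.to T-≡ (≤⇒≤ᵇ small)) (comp (perm-trans p (prep y s))))
      where
      small : deficit (f z) ≤ budget ∸ deficit (f y)
      small = subst (deficit (f z) ≤_) (trans (sym (∑-↭ (deficit ∘ f) s)) rest) (m≤m+n _ _)
    found = IH (y ∷ chosen) ys′ (suc-injective (trans (sym (↭-length p)) len)) rest
              (All.tabulate kept) compatible′

  branch : ∀ {r budget c cs} → Descending (c ∷ cs) → Complete (suc r) budget cs →
    Complete r (budget ∸ deficit c) (keep (admissible P (budget ∸ deficit c) c) (c ∷ cs)) →
    Complete (suc r) budget (c ∷ cs)
  branch {r} {budget} {c} {cs} (c≥ ∷ _) skip take chosen ys len bud mem comp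
    with suc r * deficit c <ᵇ budget in tooLate
  ... | true = ⊥-elim (<⇒≱ (<ᵇ-sound tooLate) (begin
      budget                          ≡⟨ bud ⟨
      ∑ (deficit ∘ f) ys              ≤⟨ ∑-mono ys (λ i → below (All.lookup mem i)) ⟩
      ∑ (λ _ → deficit c) ys          ≡⟨ ∑-const (deficit c) ys ⟩
      length ys * deficit c           ≡⟨ cong (_* deficit c) len ⟩
      suc r * deficit c               ∎))
    where
    open ≤-Reasoning
    below : ∀ {x} → x ∈ c ∷ cs → deficit x ≤ deficit c
    below (here refl) = ≤-refl
    below (there i) = All.lookup c≥ i
  ... | false with extract ys mem
  ...   | inj₁ mem′ with out , p , i ← skip chosen ys len bud mem′ comp = out , p , ∈-++⁺ʳ _ i
  ...   | inj₂ (y , ys′ , p , refl) with choose chosen p len bud mem comp take | deficit (f y) ≤ᵇ budget in fits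
  ...     | out , q , i | true = out , q , ∈-++⁺ˡ i
  ...     | _ | false = ⊥-elim (subst T fits (≤⇒≤ᵇ
                (subst (deficit (f y) ≤_) (trans (sym (∑-↭ (deficit ∘ f) p)) bud) (m≤m+n _ _))))

  search-complete : ∀ r budget cs → Descending cs → Complete r budget cs
  search-complete zero .0 cs desc chosen [] len refl mem comp =
    chosen , ↭-reflexive (++-identityʳ chosen) , here refl
  search-complete (suc r) budget [] desc chosen (y ∷ ys) len bud (() ∷ mem) comp
  search-complete (suc r) budget (c ∷ cs) desc@(_ ∷ desc′) =
    branch desc (search-complete (suc r) budget cs desc′)
      (search-complete r (budget ∸ deficit c) (keep (admissible P (budget ∸ deficit c) c) (c ∷ cs))
        (keep-AllPairs _ desc))

every : ∀ {A : Set} → (A → Bool) → List A → Bool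
every p [] = true
every p (x ∷ xs) = p x ∧ every p xs

every-complete : ∀ {A : Set} p {xs : List A} → (∀ {x} → x ∈ xs → p x ≡ true) → every p xs ≡ true
every-complete p {[]} h = refl
every-complete p {x ∷ xs} h rewrite h (here refl) = every-complete p (h ∘ there)

coneOf : ℕ → List ℕ → Mask → Cone
coneOf k ws m = cone m (k ∸ size m) (weigh ws m)

layer : ℕ → List ℕ → List Mask → ℕ → List Cone
layer k ws Is b = map (coneOf k ws) (keep (λ m → size m + b ≡ᵇ k) Is)

-- Collecting the cones deficit by deficit yields the descending order on which `search` relies. No
-- cone can have a deficit above the whole budget.
layers : ℕ → List ℕ → List Mask → ℕ → List Cone
layers k ws Is zero = layer k ws Is 0
layers k ws Is (suc b) = layer k ws Is (suc b) ++ layers k ws Is b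

layer-deficit : ∀ k ws Is b → All (λ c → deficit c ≡ b) (layer k ws Is b)
layer-deficit k ws Is b = All.map⁺ (All.map (λ {m} → deficit≡ m) (keep-All (λ m → size m + b ≡ᵇ k) Is))
  where
  deficit≡ : ∀ m → (size m + b ≡ᵇ k) ≡ true → k ∸ size m ≡ b
  deficit≡ m e = trans (cong (_∸ size m) (sym (≡ᵇ⇒≡ _ k (Equivalence.from T-≡ e)))) (m+n∸m≡n (size m) b)

layers-deficit : ∀ k ws Is b → All (λ c → deficit c ≤ b) (layers k ws Is b)
layers-deficit k ws Is zero = All.map ≤-reflexive (layer-deficit k ws Is 0)
layers-deficit k ws Is (suc b) = All.++⁺ (All.map ≤-reflexive (layer-deficit k ws Is (suc b)))
  (All.map m≤n⇒m≤1+n (layers-deficit k ws Is b))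

layer-descending : ∀ {b cs} → All (λ c → deficit c ≡ b) cs → Descending cs
layer-descending [] = []
layer-descending (refl ∷ es) = All.map ≤-reflexive es ∷ layer-descending es

layers-descending : ∀ k ws Is b → Descending (layers k ws Is b)
layers-descending k ws Is zero = layer-descending (layer-deficit k ws Is 0)
layers-descending k ws Is (suc b) = AllPairs.++⁺ (layer-descending (layer-deficit k ws Is (suc b)))
  (layers-descending k ws Is b)
  (All.map (λ { refl → All.map m≤n⇒m≤1+n (layers-deficit k ws Is b) }) (layer-deficit k ws Is (suc b)))

layers-∈ : ∀ k ws {Is m} b → m ∈ Is → size m ≤ k → k ∸ size m ≤ b → coneOf k ws m ∈ layers k ws Is b
layers-∈ k ws {Is} {m} b i sz le = go b le
  where
  inLayer : ∀ b → k ∸ size m ≡ b → coneOf k ws m ∈ layer k ws Is b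
  inLayer b e = ∈-map⁺ (coneOf k ws) (keep-∈ _ i (Equivalence.to T-≡
    (≡⇒≡ᵇ _ k (trans (cong (size m +_) (sym e)) (m+[n∸m]≡n sz)))))
  go : ∀ b → k ∸ size m ≤ b → coneOf k ws m ∈ layers k ws Is b
  go zero le = inLayer 0 (n≤0⇒n≡0 le)
  go (suc b) le with m≤n⇒m<n∨m≡n le
  ... | inj₁ lt = ∈-++⁺ʳ (layer k ws Is (suc b)) (go b (s≤s⁻¹ lt))
  ... | inj₂ e = ∈-++⁺ˡ (inLayer (suc b) e)

missed : Mask → List Cone → ℕ
missed I [] = 0
missed I (c ∷ cs) = ⟦ disjoint (mask c) I ⟧ + missed I cs

attach : List Mask → Code → Code
attach [] C = C
attach (m ∷ ms) C = (replicate (length ms) false ++ m) ∷ attach ms C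

-- The code of v, followed by its neighbours with the given cones and the vertices far from v.
build : Code → List Cone → Code
build C cs = (replicate (length cs) true ++ replicate (length C) false) ∷ attach (map mask cs) C

-- An independent set I far from `v`, together with all neighbours of `v` whose cones miss I, is
-- independent. While `search` tests only pairs of cones against sets of size `k`, this is the
-- condition for all cones and all I.
fits : ℕ → List Mask → List Cone → Bool
fits k Is cs = every (λ I → size I + missed I cs ≤ᵇ suc k) Is

-- The independent sets, and among them those of the maximal size `k`, are arguments so that
-- evaluation can share them between the candidates.
glueTops : List ℕ → (k d budget : ℕ) → Code → List Mask → List Mask → List Code
glueTops ps k d budget C Is tops =
  map (build C) (keep (fits k Is) (search (modulus ps tops) d budget (layers k (weights ps tops) Is budget) []))

glueMasks : List ℕ → (k d budget : ℕ) → Code → List Mask → List Code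
glueMasks ps k d budget C Is = glueTops ps k d budget C Is (keep (λ I → size I ≡ᵇ k) Is)

glue : List ℕ → (k d total : ℕ) → Code → List Code
glue ps k d total C = if total ≤ᵇ d * k then glueMasks ps k d (d * k ∸ total) C (indMasks C) else []

module Gluing {V : Set} (_~_ : V → V → Bool)
  (~-sym : ∀ x y → (x ~ y) ≡ (y ~ x))
  (~-irrefl : ∀ x → (x ~ x) ≡ false)
  (~-triangle : ∀ x y z → (x ~ y) ≡ true → (y ~ z) ≡ true → (x ~ z) ≡ true → ⊥) where
  open TriangleFree _~_ ~-sym ~-irrefl ~-triangle
  open Bounds _~_ ~-sym ~-irrefl ~-triangle

  row : List V → V → Mask
  row xs v = map (v ~_) xs

  code : List V → Code
  code [] = []
  code (x ∷ xs) = row xs x ∷ code xs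

  code-length : ∀ xs → length (code xs) ≡ length xs
  code-length [] = refl
  code-length (x ∷ xs) = cong suc (code-length xs)

  select reject : Mask → List V → List V
  select (true ∷ m) (x ∷ xs) = x ∷ select m xs
  select (false ∷ m) (x ∷ xs) = select m xs
  select _ _ = []
  reject (true ∷ m) (x ∷ xs) = reject m xs
  reject (false ∷ m) (x ∷ xs) = x ∷ reject m xs
  reject _ xs = xs

  select-↭ : ∀ m xs → xs ↭ select m xs ++ reject m xs
  select-↭ [] xs = perm-refl
  select-↭ (true ∷ m) [] = perm-refl
  select-↭ (false ∷ m) [] = perm-refl
  select-↭ (true ∷ m) (x ∷ xs) = prep x (select-↭ m xs)
  select-↭ (false ∷ m) (x ∷ xs) = perm-trans (prep x (select-↭ m xs)) (↭-sym (shift x (select m xs) _))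

  size-row : ∀ xs v → size (row xs v) ≡ degree xs v
  size-row [] v = refl
  size-row (x ∷ xs) v with v ~ x
  ... | true = cong suc (size-row xs v)
  ... | false = size-row xs v

  select-row : ∀ xs v → select (row xs v) xs ≡ near xs v
  select-row [] v = refl
  select-row (x ∷ xs) v with v ~ x
  ... | true = cong (x ∷_) (select-row xs v)
  ... | false = select-row xs v

  disjoint-row : ∀ xs v m → disjoint (row xs v) m ≡ true → All (Apart v) (select m xs)
  disjoint-row [] v [] e = []
  disjoint-row [] v (true ∷ m) e = []
  disjoint-row [] v (false ∷ m) e = []
  disjoint-row (x ∷ xs) v [] e = []
  disjoint-row (x ∷ xs) v (b ∷ m) e with v ~ x in eq
  disjoint-row (x ∷ xs) v (false ∷ m) e | true = disjoint-row xs v m e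
  disjoint-row (x ∷ xs) v (true ∷ m) e | false = eq ∷ disjoint-row xs v m e
  disjoint-row (x ∷ xs) v (false ∷ m) e | false = disjoint-row xs v m e

  row-disjoint : ∀ xs v m → All (Apart v) (select m xs) → disjoint (row xs v) m ≡ true
  row-disjoint [] v m a = refl
  row-disjoint (x ∷ xs) v [] a with v ~ x
  ... | true = refl
  ... | false = refl
  row-disjoint (x ∷ xs) v (true ∷ m) (e ∷ a) rewrite e = row-disjoint xs v m a
  row-disjoint (x ∷ xs) v (false ∷ m) a with v ~ x
  ... | true = row-disjoint xs v m a
  ... | false = row-disjoint xs v m a

  indMasks-sound : ∀ xs {m} → m ∈ indMasks (code xs) → Indep (select m xs) × size m ≡ length (select m xs)
  indMasks-sound [] (here refl) = [] , refl
  indMasks-sound (x ∷ xs) i with ∈-++⁻ (map (true ∷_) (keep (disjoint (row xs x)) (indMasks (code xs)))) i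
  ... | inj₁ j with m , l , refl ← ∈-map⁻ (true ∷_) j
               with l′ , e ← keep-⊆ _ (indMasks (code xs)) l
               with ind , s ← indMasks-sound xs l′ = disjoint-row xs x m e ∷ ind , cong suc s
  ... | inj₂ j with m , l , refl ← ∈-map⁻ (false ∷_) j = indMasks-sound xs l

  indMasks-complete : ∀ xs m → length m ≡ length xs → Indep (select m xs) → m ∈ indMasks (code xs)
  indMasks-complete [] [] e ind = here refl
  indMasks-complete (x ∷ xs) (true ∷ m) e (a ∷ ind) = ∈-++⁺ˡ (∈-map⁺ (true ∷_)
    (keep-∈ _ (indMasks-complete xs m (suc-injective e) ind) (row-disjoint xs x m a)))
  indMasks-complete (x ∷ xs) (false ∷ m) e ind =
    ∈-++⁺ʳ (map (true ∷_) (keep (disjoint (row xs x)) (indMasks (code xs))))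
      (∈-map⁺ (false ∷_) (indMasks-complete xs m (suc-injective e) ind))

  disjoint-comm : ∀ m m′ → disjoint m m′ ≡ disjoint m′ m
  disjoint-comm [] [] = refl
  disjoint-comm [] (true ∷ m′) = refl
  disjoint-comm [] (false ∷ m′) = refl
  disjoint-comm (true ∷ m) [] = refl
  disjoint-comm (false ∷ m) [] = refl
  disjoint-comm (true ∷ m) (true ∷ m′) = refl
  disjoint-comm (true ∷ m) (false ∷ m′) = disjoint-comm m m′
  disjoint-comm (false ∷ m) (true ∷ m′) = disjoint-comm m m′
  disjoint-comm (false ∷ m) (false ∷ m′) = disjoint-comm m m′

  row-all : ∀ v b ys → All (λ y → (v ~ y) ≡ b) ys → row ys v ≡ replicate (length ys) b
  row-all v b [] [] = refl
  row-all v b (y ∷ ys) (e ∷ es) = cong₂ _∷_ e (row-all v b ys es)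

  code-attach : ∀ ys zs → Indep ys → code (ys ++ zs) ≡ attach (map (row zs) ys) (code zs)
  code-attach [] zs [] = refl
  code-attach (y ∷ ys) zs (a ∷ ind) = cong₂ _∷_
    (trans (map-++ (y ~_) ys zs) (cong (_++ row zs y)
      (trans (row-all y false ys a) (cong (λ n → replicate n false) (sym (length-map (row zs) ys))))))
    (code-attach ys zs ind)

  -- An edge of `xs` lies within `zs`, contains `v`, or joins a neighbour of `v` to `zs`. So `total`
  -- is the sum of the cone sizes. A cone has at most `k` vertices, since its owner is also adjacent
  -- to `v` and has degree at most `k + 1`; hence the deficits sum to `d * k ∸ total`.
  glue-complete : ∀ ps {k xs v rest} zs → xs ↭ v ∷ rest → far rest v ↭ zs → IndepBound xs (suc k) →
    ∃ λ ws → xs ↭ ws × code ws ∈ glue ps k (degree xs v) (edges xs ∸ edges zs ∸ degree xs v) (code zs)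
  glue-complete ps {k} {xs} {v} {rest} zs p q α = result
    where
    C = code zs
    Is = indMasks C
    tops = keep (λ I → size I ≡ᵇ k) Is
    P = modulus ps tops
    W = weights ps tops
    ys = near rest v
    f : V → Cone
    f = coneOf k W ∘ row zs
    total = edges xs ∸ edges zs ∸ degree xs v

    ys-indep : Indep ys
    ys-indep = near-indep rest v
    parts : rest ↭ ys ++ zs
    parts = perm-trans (keep-split (v ~_) rest) (++⁺ˡ ys q)
    v-apart : All (Apart v) zs
    v-apart = All-resp-↭ q (All.map (λ {x} e → unnot (v ~ x) e) (keep-All (not ∘ (v ~_)) rest))
      where
      unnot : ∀ b → not b ≡ true → b ≡ false
      unnot false _ = refl

    bound : ∀ {us ts bs cs} → ys ↭ us ++ ts → zs ↭ bs ++ cs → Indep (us ++ bs) → length us + length bs ≤ suc k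
    bound {us} {ts} {bs} {cs} r s ind = subst (_≤ suc k) (length-++ us)
      (α (us ++ bs) (v ∷ ts ++ cs) (perm-trans p (perm-trans (prep v (perm-trans parts (perm-trans (++⁺ r s) mix)))
        (↭-sym (shift v (us ++ bs) (ts ++ cs))))) ind)
      where
      mix : (us ++ ts) ++ bs ++ cs ↭ (us ++ bs) ++ ts ++ cs
      mix = perm-trans (↭-reflexive (++-assoc us ts _)) (perm-trans
        (++⁺ˡ us (perm-trans (↭-reflexive (sym (++-assoc ts bs cs))) (perm-trans
          (++⁺ʳ cs (++-comm ts bs)) (↭-reflexive (++-assoc bs ts cs)))))
        (↭-reflexive (sym (++-assoc us bs _))))

    degree-ys : ∀ {y} → y ∈ ys → degree xs y ≡ suc (degree zs y)
    degree-ys {y} i = begin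
        degree xs y                           ≡⟨ ∑-↭ _ (perm-trans p (prep v parts)) ⟩
        ⟦ y ~ v ⟧ + degree (ys ++ zs) y       ≡⟨ cong₂ (λ b n → ⟦ b ⟧ + n) (trans (~-sym y v) (proj₂ (keep-⊆
            (v ~_) rest i))) (∑-++ _ ys zs) ⟩
        suc (degree ys y + degree zs y)       ≡⟨ cong (λ n → suc (n + degree zs y)) (degree-indep (All.map
            (apart-common (proj₂ (keep-⊆ (v ~_) rest i))) (keep-All (v ~_) rest))) ⟩
        suc (degree zs y)                     ∎
        where open ≡-Reasoning

    degree≤k : ∀ {y} → y ∈ ys → degree zs y ≤ k
    degree≤k {y} i = s≤s⁻¹ (subst (_≤ suc k) (degree-ys i) (degree-≤ {xs} y α))

    d≡ : degree xs v ≡ length ys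
    d≡ = trans (degree-near xs v) (↭-length (near-self p))

    total≡ : total ≡ ∑ (degree zs) ys
    total≡ = begin
      edges xs ∸ edges zs ∸ degree xs v                       ≡⟨ cong (λ e → e ∸ edges zs ∸ degree xs v)
          (edges-split xs v) ⟩
      edges (far xs v) + ∑ (degree xs) (near xs v) ∸ edges zs ∸ degree xs v
        ≡⟨ cong₂ (λ e z → e + z ∸ edges zs ∸ degree xs v) (trans (edges-far p) (edges-↭ q)) nearSum ⟩
      edges zs + (length ys + ∑ (degree zs) ys) ∸ edges zs ∸ degree xs v
        ≡⟨ cong (_∸ degree xs v) (m+n∸m≡n (edges zs) _) ⟩
      length ys + ∑ (degree zs) ys ∸ degree xs v              ≡⟨ cong (length ys + ∑ (degree zs) ys ∸_) d≡ ⟩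
      length ys + ∑ (degree zs) ys ∸ length ys                ≡⟨ m+n∸m≡n (length ys) _ ⟩
      ∑ (degree zs) ys                                        ∎
      where
      open ≡-Reasoning
      nearSum : ∑ (degree xs) (near xs v) ≡ length ys + ∑ (degree zs) ys
      nearSum = begin
        ∑ (degree xs) (near xs v)               ≡⟨ ∑-↭ (degree xs) (near-self p) ⟩
        ∑ (degree xs) ys                        ≡⟨ ∑-cong ys degree-ys ⟩
        ∑ (λ y → 1 + degree zs y) ys            ≡⟨ ∑-+ (λ _ → 1) (degree zs) ys ⟩
        ∑ (λ _ → 1) ys + ∑ (degree zs) ys       ≡⟨ cong (_+ ∑ (degree zs) ys) (trans (∑-const 1 ys) (*-identityʳ _)) ⟩
        length ys + ∑ (degree zs) ys            ∎

    deficits : ∑ (deficit ∘ f) ys + total ≡ degree xs v * k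
    deficits = begin
      ∑ (deficit ∘ f) ys + total                          ≡⟨ cong (∑ (deficit ∘ f) ys +_) total≡ ⟩
      ∑ (deficit ∘ f) ys + ∑ (degree zs) ys               ≡⟨ ∑-+ _ _ ys ⟨
      ∑ (λ y → k ∸ size (row zs y) + degree zs y) ys      ≡⟨ ∑-cong ys (λ {y} i → trans (cong (λ s
          → k ∸ s + degree zs y) (size-row zs y)) (m∸n+n≡m (degree≤k i))) ⟩
      ∑ (λ _ → k) ys                                      ≡⟨ ∑-const k ys ⟩
      length ys * k                                       ≡⟨ cong (_* k) d≡ ⟨
      degree xs v * k                                     ∎
      where open ≡-Reasoning

    budget = degree xs v * k ∸ total
    budget≡ : ∑ (deficit ∘ f) ys ≡ budget
    budget≡ = trans (sym (m+n∸n≡m _ total)) (cong (_∸ total) deficits)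

    candidates : All (λ y → f y ∈ layers k W Is budget) ys
    candidates = All.tabulate (λ {y} i → layers-∈ k W budget
      (indMasks-complete zs (row zs y) (length-map (y ~_) zs) (subst Indep (sym (select-row zs y)) (near-indep zs y)))
      (subst (_≤ k) (sym (size-row zs y)) (degree≤k i))
      (subst (deficit (f y) ≤_) budget≡ (member-≤ i)))
      where
      member-≤ : ∀ {y} → y ∈ ys → deficit (f y) ≤ ∑ (deficit ∘ f) ys
      member-≤ i with _ , r ← ∈-front i = subst (_ ≤_) (sym (∑-↭ (deficit ∘ f) r)) (m≤m+n _ _)

    compatible : Compatible P f ys
    compatible {y} {z} {ts} r = dividesᵇ-complete P (modulus-divides ps tops (row zs y) (row zs z) (All.tabulate hit))
      where
      -- If the cones of `y` and `z` both missed a set I of size `k`, then `y`, `z` and I would form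
      -- an independent set of size k + 2.
      hit : ∀ {I} → I ∈ tops → Hits (row zs y) (row zs z) I
      hit {I} i with disjoint I (row zs y) in e₁ | disjoint I (row zs z) in e₂
      ... | false | _ = inj₁ refl
      ... | true | false = inj₂ refl
      ... | true | true with j , s ← keep-⊆ _ Is i with ind , sz ← indMasks-sound zs j =
        ⊥-elim (<-irrefl (trans (sym sz) (≡ᵇ⇒≡ (size I) k (Equivalence.from T-≡ s)))
          (s≤s⁻¹ (bound {y ∷ z ∷ []} {ts} r (select-↭ I zs)
            ((yz ∷ disjoint-row zs y I (trans (disjoint-comm _ I) e₁))
              ∷ disjoint-row zs z I (trans (disjoint-comm _ I) e₂) ∷ ind))))
        where
        yz : Apart y z
        yz with AllPairs-↭ apart-sym r ys-indep
        ... | (e ∷ _) ∷ _ = e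

    found : ∃ λ out → ys ↭ out × map f out ∈ search P (degree xs v) budget (layers k W Is budget) []
    found = search-complete P f (degree xs v) budget (layers k W Is budget) (layers-descending k W Is budget)
              [] ys (sym d≡) budget≡ candidates compatible

    out = proj₁ found
    out-indep : Indep out
    out-indep = AllPairs-↭ apart-sym (proj₁ (proj₂ found)) ys-indep

    missed≡ : ∀ I us → missed I (map f us) ≡ length (keep (λ u → disjoint (row zs u) I) us)
    missed≡ I [] = refl
    missed≡ I (u ∷ us) with disjoint (row zs u) I
    ... | true = cong suc (missed≡ I us)
    ... | false = missed≡ I us

    fit : fits k Is (map f out) ≡ true
    fit = every-complete _ (λ {I} i → Equivalence.to T-≡ (≤⇒≤ᵇ (small I (indMasks-sound zs i))))
      where
      small : ∀ I → Indep (select I zs) × size I ≡ length (select I zs) → size I + missed I (map f out) ≤ suc k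
      small I (ind , sz) = subst (_≤ suc k)
        (trans (+-comm _ (length (select I zs))) (cong₂ _+_ (sym sz) (sym (missed≡ I out))))
        (bound {keep (λ u → disjoint (row zs u) I) out} (perm-trans (proj₁ (proj₂ found)) (keep-split _ out))
          (select-↭ I zs) (AllPairs.++⁺ (keep-AllPairs _ out-indep) ind
            (All.map (λ {u} e → disjoint-row zs u I e) (keep-All _ out))))

    code-out : code (v ∷ out ++ zs) ≡ build C (map f out)
    code-out = cong₂ _∷_
      (trans (map-++ (v ~_) out zs) (cong₂ _++_
        (trans (row-all v true out (All-resp-↭ (proj₁ (proj₂ found)) (keep-All (v ~_) rest)))
          (cong (λ n → replicate n true) (sym (length-map f out))))
        (trans (row-all v false zs v-apart) (cong (λ n → replicate n false) (sym (code-length zs))))))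
      (trans (code-attach out zs out-indep) (cong (λ ms → attach ms C) (masks out)))
      where
      masks : ∀ us → map (row zs) us ≡ map mask (map f us)
      masks [] = refl
      masks (u ∷ us) = cong (row zs u ∷_) (masks us)

    result : ∃ λ ws → xs ↭ ws × code ws ∈ glue ps k (degree xs v) total C
    result with total ≤ᵇ degree xs v * k in eq
    ... | false = ⊥-elim (subst T eq (≤⇒≤ᵇ (subst (total ≤_) deficits (m≤n+m total _))))
    ... | true = v ∷ out ++ zs ,
      perm-trans p (prep v (perm-trans parts (++⁺ʳ zs (proj₁ (proj₂ found))))) ,
      subst (_∈ glueMasks ps k (degree xs v) budget C Is) (sym code-out)
        (∈-map⁺ (build C) (keep-∈ _ (proj₂ (proj₂ found)) fit))

-- Classification up to isomorphism

-- A position past the end means the last entry, in agreement with `pull`, so every digit of a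
-- certificate describes a reordering.
bitAt : ℕ → Mask → Bool
bitAt _ [] = false
bitAt _ (b ∷ []) = b
bitAt zero (b ∷ _ ∷ _) = b
bitAt (suc i) (_ ∷ b ∷ m) = bitAt i (b ∷ m)

removeAt : ℕ → Mask → Mask
removeAt _ [] = []
removeAt _ (b ∷ []) = []
removeAt zero (b ∷ m@(_ ∷ _)) = m
removeAt (suc i) (b ∷ b′ ∷ m) = b ∷ removeAt i (b′ ∷ m)

-- The code after moving the vertex at position i (the last one, if i is too large) to the front.
pull : ℕ → Code → Code
pullPast : Mask → ℕ → Code → Code
pull zero C = C
pull (suc i) [] = []
pull (suc i) (r ∷ C) = pullPast r i (pull i C)
pullPast r i [] = r ∷ []
pullPast r i (z ∷ C) = (bitAt i r ∷ z) ∷ removeAt i r ∷ C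

-- The base 16 digits of the certificate say which vertices to pull.
pulls : ℕ → ℕ → Code → Code
pulls zero c C = C
pulls (suc n) c C = pulls n (c / 16) (pull (c % 16) C)

eqMask : Mask → Mask → Bool
eqMask [] [] = true
eqMask (true ∷ m) (true ∷ m′) = eqMask m m′
eqMask (false ∷ m) (false ∷ m′) = eqMask m m′
eqMask _ _ = false

eqCode : Code → Code → Bool
eqCode [] [] = true
eqCode (r ∷ C) (r′ ∷ C′) = eqMask r r′ ∧ eqCode C C′
eqCode _ _ = false

eqMask-sound : ∀ m m′ → eqMask m m′ ≡ true → m ≡ m′
eqMask-sound [] [] e = refl
eqMask-sound (true ∷ m) (true ∷ m′) e = cong (true ∷_) (eqMask-sound m m′ e)
eqMask-sound (false ∷ m) (false ∷ m′) e = cong (false ∷_) (eqMask-sound m m′ e)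

eqCode-sound : ∀ C C′ → eqCode C C′ ≡ true → C ≡ C′
eqCode-sound [] [] e = refl
eqCode-sound (r ∷ C) (r′ ∷ C′) e with ∧-sound {eqMask r r′} e
... | e₁ , e₂ = cong₂ _∷_ (eqMask-sound r r′ e₁) (eqCode-sound C C′ e₂)

member : Code → List Code → Bool
member C [] = false
member C (D ∷ Ds) = eqCode C D ∨ member C Ds

member-sound : ∀ C Ds → member C Ds ≡ true → C ∈ Ds
member-sound C (D ∷ Ds) e with ∨-sound {eqCode C D} e
... | inj₁ e′ = here (eqCode-sound C D e′)
... | inj₂ e′ = there (member-sound C Ds e′)

-- Drops duplicates up to isomorphism; the certificates say which isomorphisms to try.
merge : List Code → List Code → List ℕ → List Code
mergeOne : List Code → Code → List Code → List ℕ → List Code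
merge found [] certs = found
merge found (C ∷ Cs) [] = mergeOne found C Cs []
merge found (C ∷ Cs) (c ∷ certs) = mergeOne found (pulls (length C) c C) Cs certs
mergeOne found D Cs certs = if member D found then merge found Cs certs else merge (D ∷ found) Cs certs

glueAll : List ℕ → (k d E e : ℕ) → List (List Code) → List Code
glueAll ps k d E e [] = []
glueAll ps k d E e (L ∷ Ls) = concatMap (glue ps k d (E ∸ e ∸ d)) L ++ glueAll ps k d E (suc e) Ls

-- For a degree d, lists of the graphs with t(n − 1 − d), t(n − 1 − d) + 1, … edges on n − 1 − d vertices.
Bases : Set
Bases = List (ℕ × List (List Code))

basesAt : Bases → ℕ → List (List Code)
basesAt [] d = []
basesAt ((d′ , Ls) ∷ bs) d = if d ≡ᵇ d′ then Ls else basesAt bs d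

glueBelow : List ℕ → (k n E : ℕ) → (ℕ → ℕ) → Bases → ℕ → List Code
glueBelow ps k n E t bs zero = []
glueBelow ps k n E t bs (suc d) = glueAll ps k d E (t (n ∸ suc d)) (basesAt bs d) ++ glueBelow ps k n E t bs d

-- Opaque, as otherwise comparing types that mention classifications runs the search.
opaque
  classify : List ℕ → (k n E : ℕ) → (ℕ → ℕ) → Bases → List ℕ → List Code
  classify ps k n E t bs certs = merge [] (glueBelow ps k n E t bs (suc (suc k))) certs

module Classification {V : Set} (_~_ : V → V → Bool)
  (~-sym : ∀ x y → (x ~ y) ≡ (y ~ x))
  (~-irrefl : ∀ x → (x ~ x) ≡ false)
  (~-triangle : ∀ x y z → (x ~ y) ≡ true → (y ~ z) ≡ true → (x ~ z) ≡ true → ⊥) where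
  open TriangleFree _~_ ~-sym ~-irrefl ~-triangle
  open Bounds _~_ ~-sym ~-irrefl ~-triangle
  open Gluing _~_ ~-sym ~-irrefl ~-triangle

  pullVertex : ℕ → List V → List V
  past : V → List V → List V
  pullVertex zero xs = xs
  pullVertex (suc i) [] = []
  pullVertex (suc i) (x ∷ xs) = past x (pullVertex i xs)
  past x [] = x ∷ []
  past x (z ∷ zs) = z ∷ x ∷ zs

  past-↭ : ∀ x xs → x ∷ xs ↭ past x xs
  past-↭ x [] = perm-refl
  past-↭ x (z ∷ zs) = swap x z perm-refl

  pullVertex-↭ : ∀ i xs → xs ↭ pullVertex i xs
  pullVertex-↭ zero xs = perm-refl
  pullVertex-↭ (suc i) [] = perm-refl
  pullVertex-↭ (suc i) (x ∷ xs) = perm-trans (prep x (pullVertex-↭ i xs)) (past-↭ x _)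

  row-pull : ∀ i x xs {z zs} → pullVertex i xs ≡ z ∷ zs →
             bitAt i (row xs x) ≡ (x ~ z) × removeAt i (row xs x) ≡ row zs x
  row-pull zero x (y ∷ []) refl = refl , refl
  row-pull zero x (y ∷ y′ ∷ xs) refl = refl , refl
  row-pull (suc zero) x (y ∷ []) refl = refl , refl
  row-pull (2+ i) x (y ∷ []) refl = refl , refl
  row-pull (suc i) x (y ∷ y′ ∷ xs) e with pullVertex i (y′ ∷ xs) in eq
  row-pull (suc i) x (y ∷ y′ ∷ xs) refl | z ∷ zs with b , r ← row-pull i x (y′ ∷ xs) eq =
    b , cong ((x ~ y) ∷_) r
  row-pull (suc i) x (y ∷ y′ ∷ xs) refl | [] with () ← ↭-length (↭-trans (pullVertex-↭ i (y′ ∷ xs)) (↭-reflexive eq))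

  code-pull : ∀ i xs → code (pullVertex i xs) ≡ pull i (code xs)
  code-pull zero xs = refl
  code-pull (suc i) [] = refl
  code-pull (suc i) (x ∷ xs) rewrite sym (code-pull i xs) with pullVertex i xs in eq
  ... | z ∷ zs with b , r ← row-pull i x xs eq = cong₂ (λ c ms → (c ∷ row zs z) ∷ ms ∷ code zs)
                 (trans (~-sym z x) (sym b)) (sym r)
  ... | [] = cong (λ ys → map (x ~_) ys ∷ []) (sym (↭-empty-inv (↭-trans (pullVertex-↭ i xs) (↭-reflexive eq))))

  Iso : List V → List Code → Set
  Iso xs L = ∃ λ zs → xs ↭ zs × code zs ∈ L

  iso-pulls : ∀ n c xs → ∃ λ zs → xs ↭ zs × code zs ≡ pulls n c (code xs)
  iso-pulls zero c xs = xs , perm-refl , refl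
  iso-pulls (suc n) c xs with zs , p , e ← iso-pulls n (c / 16) (pullVertex (c % 16) xs) =
    zs , perm-trans (pullVertex-↭ (c % 16) xs) p , trans e (cong (pulls n (c / 16)) (code-pull (c % 16) xs))

  merge-keeps : ∀ found Cs certs {D} → D ∈ found → D ∈ merge found Cs certs
  mergeOne-keeps : ∀ found D′ Cs certs {D} → D ∈ found → D ∈ mergeOne found D′ Cs certs
  merge-keeps found [] certs i = i
  merge-keeps found (C ∷ Cs) [] i = mergeOne-keeps found C Cs [] i
  merge-keeps found (C ∷ Cs) (c ∷ certs) i = mergeOne-keeps found _ Cs certs i
  mergeOne-keeps found D′ Cs certs i with member D′ found
  ... | true = merge-keeps found Cs certs i
  ... | false = merge-keeps (D′ ∷ found) Cs certs (there i)

  mergeOne-adds : ∀ found D Cs certs → D ∈ mergeOne found D Cs certs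
  mergeOne-adds found D Cs certs with member D found in eq
  ... | true = merge-keeps found Cs certs (member-sound D found eq)
  ... | false = merge-keeps (D ∷ found) Cs certs (here refl)

  -- This holds for arbitrary certificates: pulling only reorders the vertices, and a code is
  -- dropped only if it equals one already found. A bad certificate could only leave isomorphic
  -- duplicates.
  merge-complete : ∀ found Cs certs xs → code xs ∈ Cs → Iso xs (merge found Cs certs)
  mergeOne-complete : ∀ found D Cs certs xs → code xs ∈ Cs → Iso xs (mergeOne found D Cs certs)
  merge-complete found (C ∷ Cs) [] xs (here refl) = xs , perm-refl , mergeOne-adds found (code xs) Cs []
  merge-complete found (C ∷ Cs) [] xs (there i) = mergeOne-complete found C Cs [] xs i
  merge-complete found (C ∷ Cs) (c ∷ certs) xs (here refl) with zs , p , e ← iso-pulls (length C) c xs =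
    zs , p , subst (_∈ mergeOne found _ Cs certs) (sym e) (mergeOne-adds found _ Cs certs)
  merge-complete found (C ∷ Cs) (c ∷ certs) xs (there i) = mergeOne-complete found _ Cs certs xs i
  mergeOne-complete found D Cs certs xs i with member D found
  ... | true = merge-complete found Cs certs xs i
  ... | false = merge-complete (D ∷ found) Cs certs xs i

  Class : (k n E : ℕ) → List Code → Set
  Class k n E L = ∀ {xs} → length xs ≡ n → IndepBound xs k → edges xs ≡ E → Iso xs L

  data Classes (k n : ℕ) : ℕ → List (List Code) → Set where
    [] : ∀ {e} → Classes k n e []
    _∷_ : ∀ {e L Ls} → Class k n e L → Classes k n (suc e) Ls → Classes k n e (L ∷ Ls)

  -- The classification provides `zs`, a reordering of `xs` whose code is listed. What is glued onto
  -- that code depends on the surrounding graph, so the conclusion is uniform in `d`, `E` and the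
  -- result of the gluing.
  glueAll-complete : ∀ {k n e Ls} → Classes k n e Ls → ∀ {xs} → length xs ≡ n → IndepBound xs k →
    e ≤ edges xs → edges xs < e + length Ls →
    ∃ λ zs → xs ↭ zs × (∀ ps d E {C} → C ∈ glue ps k d (E ∸ edges zs ∸ d) (code zs) → C ∈ glueAll ps k d E e Ls)
  glueAll-complete {e = e} [] len α le lt = ⊥-elim (<⇒≱ lt (subst (_≤ _) (sym (+-identityʳ e)) le))
  glueAll-complete {k} {e = e} {L ∷ Ls} (c ∷ cs) {xs} len α le lt with m≤n⇒m<n∨m≡n le
  ... | inj₁ e<E with zs , p , h ← glueAll-complete cs len α e<E (subst (edges xs <_) (+-suc e (length Ls)) lt) =
    zs , p , λ ps d E i → ∈-++⁺ʳ (concatMap (glue ps k d (E ∸ e ∸ d)) L) (h ps d E i)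
  ... | inj₂ refl with zs , p , i ← c len α refl = zs , p , λ ps d E j →
    ∈-++⁺ˡ (∈-concatMap⁺ (glue ps k d (E ∸ e ∸ d))
      (Any.map (λ { refl → subst (λ x → _ ∈ glue ps k d (E ∸ x ∸ d) (code zs)) (sym (edges-↭ p)) j }) i))

  glueBelow-∈ : ∀ ps k n E t bs {d C} m → d < m → C ∈ glueAll ps k d E (t (n ∸ suc d)) (basesAt bs d) →
    C ∈ glueBelow ps k n E t bs m
  glueBelow-∈ ps k n E t bs {d} (suc m) lt i with m<1+n⇒m<n∨m≡n lt
  ... | inj₁ d<m = ∈-++⁺ʳ (glueAll ps k m E (t (n ∸ suc m)) (basesAt bs m)) (glueBelow-∈ ps k n E t bs m d<m i)
  ... | inj₂ refl = ∈-++⁺ˡ i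

  ClassesAt : (k n : ℕ) → (ℕ → ℕ) → ℕ × List (List Code) → Set
  ClassesAt k n t (d , Ls) = Classes k (n ∸ suc d) (t (n ∸ suc d)) Ls

  basesAt-classes : ∀ {k n} t {bs} → All (ClassesAt k n t) bs → ∀ d → ClassesAt k n t (d , basesAt bs d)
  basesAt-classes t [] d = []
  basesAt-classes {k} {n} t {(d′ , Ls) ∷ bs} (c ∷ cs) d with d ≡ᵇ d′ in eq
  ... | true = subst (λ x → ClassesAt k n t (x , Ls)) (sym (≡ᵇ⇒≡ d d′ (Equivalence.from T-≡ eq))) c
  ... | false = basesAt-classes {n = n} t cs d

  opaque
    unfolding classify
    -- Here ψ(d) is the minimum plus the number of edge classes listed for degree d, so `low-vertex`
    -- finds a vertex whose nonneighbours span a listed graph. A degree without a list keeps the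
    -- bare minimum as ψ(d), below which no graph lies. As degrees are at most `k + 1`, trying all
    -- those below `k + 2` is exhaustive.
    classify-complete : ∀ ps k n E t bs certs d₁ w → MinEdges k t → All (ClassesAt k n t) bs →
      lineCheck (λ d → t (n ∸ suc d) + length (basesAt bs d)) (suc k) n E d₁ w ≡ true →
      Class (suc k) n E (classify ps k n E t bs certs)
    classify-complete ps k n E t bs certs d₁ w T cs check {xs} refl α refl
      with v , i , lt ← low-vertex _ (suc k) n E d₁ w check refl α refl
      with rest , p ← ∈-front i
      with zs , q , h ← glueAll-complete (basesAt-classes {n = n} t cs (degree xs v)) (length-far p refl)
          (indepBound-far p α)
                          (subst (t (n ∸ suc (degree xs v)) ≤_) (edges-far p) (edges-far-min {k} {t} T α i))
                          (subst (_< t (n ∸ suc (degree xs v)) + length (basesAt bs (degree xs v))) (edges-far p) lt)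
      with ws , r , j ← glue-complete ps zs p q α
      with us , s , l ← merge-complete [] (glueBelow ps k n E t bs (suc (suc k))) certs ws
                          (glueBelow-∈ ps k n E t bs (suc (suc k)) (s≤s (degree-≤ v α)) (h ps (degree xs v) E j)) =
      us , perm-trans r s , l

-- The tables of edge bounds and the classified graphs

sieve : ℕ → List ℕ → List ℕ
sieve zero _ = []
sieve (suc n) [] = []
sieve (suc n) (p ∷ xs) = p ∷ sieve n (keep (λ x → not (dividesᵇ p x)) xs)

countUp : ℕ → ℕ → List ℕ
countUp zero m = []
countUp (suc n) m = m ∷ countUp n (suc m)

-- The numbers from 2 to 541, the hundredth prime, are sieved. In a family with more than a hundred
-- members the later ones get no prime and do not take part in the divisibility test, which stays
-- valid.
primes : List ℕ
primes = sieve 100 (countUp 540 2)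

-- `minima-k` holds lower bounds for e(3, k + 1, n), the least number of edges of a triangle-free
-- graph on n vertices with independence number at most k. For k = 8 the list is empty: below 37
-- vertices the bound is zero, and only nonexistence from 37 on is established.
minima-0 minima-1 minima-2 minima-3 minima-4 minima-5 minima-6 minima-7 minima-8 : List ℕ
minima-0 = 0 ∷ []
minima-1 = 0 ∷ 0 ∷ 1 ∷ []
minima-2 = 0 ∷ 0 ∷ 0 ∷ 1 ∷ 2 ∷ 5 ∷ []
minima-3 = 0 ∷ 0 ∷ 0 ∷ 0 ∷ 1 ∷ 2 ∷ 3 ∷ 6 ∷ 10 ∷ []
minima-4 = 0 ∷ 0 ∷ 0 ∷ 0 ∷ 0 ∷ 1 ∷ 2 ∷ 3 ∷ 4 ∷ 7 ∷ 10 ∷ 15 ∷ 20 ∷ 26 ∷ []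
minima-5 = 0 ∷ 0 ∷ 0 ∷ 0 ∷ 0 ∷ 0 ∷ 1 ∷ 2 ∷ 3 ∷ 4 ∷ 5 ∷ 8 ∷ 11 ∷ 15 ∷ 19 ∷ 25 ∷ 32 ∷ 39 ∷ 45 ∷ []
minima-6 = 0 ∷ 0 ∷ 0 ∷ 0 ∷ 0 ∷ 0 ∷ 0 ∷ 1 ∷ 2 ∷ 3 ∷ 4 ∷ 5 ∷ 6 ∷ 9 ∷ 12 ∷ 15 ∷ 20 ∷ 24 ∷ 29 ∷ 35 ∷ 42 
           ∷ 50 ∷ 60 ∷ []
minima-7 = 0 ∷ 0 ∷ 0 ∷ 0 ∷ 0 ∷ 0 ∷ 0 ∷ 0 ∷ 1 ∷ 2 ∷ 3 ∷ 4 ∷ 5 ∷ 6 ∷ 7 ∷ 10 ∷ 13 ∷ 16 ∷ 20 ∷ 24 ∷ 29 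
           ∷ 34 ∷ 40 ∷ 45 ∷ 52 ∷ 60 ∷ 68 ∷ 78 ∷ 88 ∷ []
minima-8 = []

t0 t1 t2 t3 t4 t5 t6 t7 t8 : ℕ → ℕ
t0 = table 1 minima-0
t1 = table 3 minima-1
t2 = table 6 minima-2
t3 = table 9 minima-3
t4 = table 14 minima-4
t5 = table 19 minima-5
t6 = table 23 minima-6
t7 = table 29 minima-7
t8 = table 37 minima-8

-- `graphs-n-e` covers, up to isomorphism, the triangle-free graphs with n vertices, e edges and
-- independence number at most 0 (n = 0), 1 (n = 1, 2), 2 (n = 4), 3 (n = 7), 4 (n = 11, 12), 5 (n =
-- 16, 17) and 6 (n = 22, 23). A vertex of degree d leads from n to n - 1 - d.
graphs-0-0 : List Code
graphs-0-0 = [] ∷ []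

graphs-2-1 : List Code
graphs-2-1 = classify primes 0 2 1 t0 ((1 , graphs-0-0 ∷ []) ∷ []) []

graphs-1-0 : List Code
graphs-1-0 = classify primes 0 1 0 t0 ((0 , graphs-0-0 ∷ []) ∷ []) []

graphs-4-2 : List Code
graphs-4-2 = classify primes 1 4 2 t1 ((1 , graphs-2-1 ∷ []) ∷ []) []

graphs-4-3 : List Code
graphs-4-3 = classify primes 1 4 3 t1 ((2 , graphs-1-0 ∷ []) ∷ []) []

certs-7-6 : List ℕ
certs-7-6 =
  0 ∷ 0x6666644 ∷ []

graphs-7-6 : List Code
graphs-7-6 = classify primes 2 7 6 t2 ((2 , graphs-4-2 ∷ []) ∷ []) certs-7-6

certs-7-7 : List ℕ
certs-7-7 =
  0 ∷ 0x6666665 ∷ 0x6666566 ∷ 0x6666565 ∷ 0x6666644 ∷ 0x6666643 ∷ 0x6666544 ∷ 0x6666543 ∷ 0x6555612 ∷ 0x6644656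
  ∷ 0x6644645 ∷ 0 ∷ []

graphs-7-7 : List Code
graphs-7-7 = classify primes 2 7 7 t2 ((2 , graphs-4-2 ∷ graphs-4-3 ∷ []) ∷ []) certs-7-7

certs-11-15 : List ℕ
certs-11-15 =
  0 ∷ 0xaaaaaa899aa ∷ 0xaaaaaa88aaa ∷ 0xaaaaaa877aa ∷ 0xaaaaa9878aa ∷ 0xaaaaaaaaaa9 ∷ 0xaaaaaa899a9 ∷
  0xaaaaaa88aa9 ∷ 0xaaaaaa877a9 ∷ 0xaaaaa9878a9 ∷ 0xaa89666aa87 ∷ 0xaa8a666aa88 ∷ 0xa98a677aa85 ∷ 0xaa88666aa77
  ∷ 0xaa88666aa68 ∷ []

graphs-11-15 : List Code
graphs-11-15 = classify primes 3 11 15 t3 ((3 , graphs-7-6 ∷ []) ∷ []) certs-11-15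

certs-11-16 : List ℕ
certs-11-16 =
  0 ∷ 0xaaaaaa899aa ∷ 0xaaaaaa88aaa ∷ 0xaaaaaa877aa ∷ 0xaaaaa9878aa ∷ 0 ∷ 0xaa9aa9aa7aa ∷ 0xaaaaaa9a9aa ∷
  0xaa9aa9a98aa ∷ 0xaa9aa9986aa ∷ 0xaaaaaaaaaa9 ∷ 0xaa9aa9aa7a9 ∷ 0xaaaaaa9a9a9 ∷ 0xaa9aa9a98a9 ∷ 0xaa9aa9986a9
  ∷ 0 ∷ 0xaaaaaa877aa ∷ 0xaaaaaaaaaa9 ∷ 0xaaaaaa877a9 ∷ 0xaaaaaa9a9aa ∷ 0xaaaaa9878aa ∷ 0xaaaaaa9a9a9 ∷
  0xaaaaa9878a9 ∷ 0xa98a677aa85 ∷ 0xa98a676a985 ∷ 0xaaa9aa88aaa ∷ 0xaaa9aa899aa ∷ 0xa9a7675a976 ∷ 0xaaa7665aa88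
  ∷ 0xa9a7675a985 ∷ 0xaa97665aa87 ∷ 0 ∷ 0xaaa9aa877a9 ∷ 0xaaaaaa9a9aa ∷ 0xaaa9a9878a9 ∷ 0xaaa9aa88aa9 ∷
  0xaaa9aa899a9 ∷ 0xa9a7675aa76 ∷ 0xaaa7665a988 ∷ 0xa9a7675aa85 ∷ 0xaa97665a987 ∷ 0xaaaaaaaaaa9 ∷ 0xaaa9aa877aa
  ∷ 0xaaaaaa9a9a9 ∷ 0xaaa9a9878aa ∷ 0xaaaaa9a98aa ∷ 0xaaaaa9a76aa ∷ 0xaaaaa9a98a9 ∷ 0xaaaaa9a76a9 ∷
  0xaa8a677aa88 ∷ 0xaa8a676a988 ∷ 0xaaa9aa88aa9 ∷ 0xaaaaaa899aa ∷ 0xaaaaa9a98aa ∷ 0xaaa9a9a76a9 ∷ 0xaa87665aa77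
  ∷ 0xa997675a964 ∷ 0xaaa9aa88aaa ∷ 0xaaaaaa899a9 ∷ 0xaaaaa9a98a9 ∷ 0xaaa9a9a76aa ∷ 0xaa87665a977 ∷
  0xa997675aa64 ∷ 0xaaaaa9aa7aa ∷ 0xaaaaa9986aa ∷ 0xaaaaa9aa7a9 ∷ 0xaaaaa9986a9 ∷ 0xaa89677aa87 ∷ 0xaa89676a987
  ∷ 0xaa87665aa68 ∷ 0xa9a7675a954 ∷ 0xaaaaa9aa7aa ∷ 0xaaa9a9986a9 ∷ 0xaa87665a968 ∷ 0xa9a7675aa54 ∷
  0xaaaaa9aa7a9 ∷ 0xaaa9a9986aa ∷ 0xaa88677aa68 ∷ 0xaa88676a968 ∷ 0xa987675a956 ∷ 0xaa87665aa55 ∷ 0xa987675aa56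
  ∷ 0xaa87665a955 ∷ 0xaa88677aa77 ∷ 0xaa88676a977 ∷ 0xa99975785aa ∷ 0 ∷ 0xa9aa75a95aa ∷ 0xaaaaa9986aa ∷
  0xaaa7a943588 ∷ 0xa9aa75a9588 ∷ 0xa9aa75a9588 ∷ 0xa99975a9564 ∷ 0xa997a943564 ∷ 0xaa89885994a ∷ 0xaa89975754a
  ∷ 0xaaa7897792a ∷ 0 ∷ 0xaaa78a75a88 ∷ 0xaa99a9986aa ∷ 0xaaa7666a988 ∷ 0xaaa77a94a64 ∷ 0xaaa7889652a ∷
  0xa997676a964 ∷ []

graphs-11-16 : List Code
graphs-11-16 = classify primes 3 11 16 t3 ((3 , graphs-7-6 ∷ graphs-7-7 ∷ []) ∷ []) certs-11-16

certs-12-20 : List ℕ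
certs-12-20 =
  0 ∷ 0xbbbbbbbababb ∷ 0xbbbbbbbbbbba ∷ 0xbbbbbbbababa ∷ 0xbbabbbb9aabb ∷ 0xbbbbbbaba9bb ∷ 0xbbabbbb9aaba ∷
  0xbbbbbbaba9ba ∷ 0xbbbbbbabb8bb ∷ 0xbbbbbbabb8ba ∷ []

graphs-12-20 : List Code
graphs-12-20 = classify primes 3 12 20 t3 ((4 , graphs-7-6 ∷ []) ∷ []) certs-12-20

certs-12-21 : List ℕ
certs-12-21 =
  0 ∷ 0xbbbbbbbababb ∷ 0 ∷ 0xbbbbbbbbbbba ∷ 0xbbbbbbbababa ∷ 0xbbbbbbbbbbba ∷ 0xbba9bbb9aabb ∷ 0xbbaabbb9aabb ∷
  0xbbbabbaba9bb ∷ 0xbba9bbb9aaba ∷ 0xbbaabbb9aaba ∷ 0xbbbabbaba9ba ∷ 0xbbb9bbb99bbb ∷ 0xbbabbbb99bbb ∷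
  0xbbb9bbabb8bb ∷ 0xbbb9bbb99bba ∷ 0xbbabbbb99bba ∷ 0xbbb9bbabb8ba ∷ 0xbbabbbb988bb ∷ 0xbbb9bbb988bb ∷
  0xbbaabbab87bb ∷ 0xbbabbbb988ba ∷ 0xbbb9bbb988ba ∷ 0xbbaabbab87ba ∷ 0xbbb9bba989bb ∷ 0xbba9bbaa97bb ∷
  0xbbabbba989bb ∷ 0xbbb9bba989ba ∷ 0xbba9bbaa97ba ∷ 0xbbabbba989ba ∷ 0xbba8b8a769a3 ∷ 0xbabba876b583 ∷
  0xbab9b8b47b99 ∷ 0xbb9a98786b83 ∷ 0xbba8b88a68a3 ∷ 0xbabb99a5b574 ∷ []

graphs-12-21 : List Code
graphs-12-21 = classify primes 3 12 21 t3 ((4 , graphs-7-6 ∷ graphs-7-7 ∷ []) ∷ []) certs-12-21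

graphs-16-31 : List Code
graphs-16-31 = classify primes 4 16 31 t4 ((4 , graphs-11-15 ∷ []) ∷ []) []

graphs-17-38 : List Code
graphs-17-38 = classify primes 4 17 38 t4 ((4 , graphs-12-20 ∷ []) ∷ []) []

certs-16-32 : List ℕ
certs-16-32 =
  0 ∷ 0xfffffffffffefeff ∷ 0xfefdef9aeaf77f40 ∷ 0xfedfccfabae435a6 ∷ 0xfefdff9afaf77f40 ∷ 0xfedeccfabae435b6 ∷
  0xfeeffeaacddb7a40 ∷ 0xfedfceeeaee535f6 ∷ 0xffefffeefcf9becb ∷ 0xffefffeefcf9beda ∷ 0xfefecd9aeddb7a40 ∷
  0xffddcddd9dd43566 ∷ 0xfedeecfb7aa9ca5e ∷ 0xfedefcfb7aa9ba5e ∷ 0xffefffeeeddddd85 ∷ 0xffefffeeeddcdc85 ∷ 0 ∷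
  0xfffffffffffefeff ∷ 0 ∷ 0xfefcbeedaed436f6 ∷ 0xfffcecaea8fdccfe ∷ 0xfeddfafb7aa9ba3e ∷ 0xfffffffffffefeff ∷
  0xfefcbeeeaee436f6 ∷ 0xfffcecaea8edcdfe ∷ 0xfeddeafb7aa9ca3e ∷ 0xffdfdcfa9b75dc97 ∷ 0xffdfecfa9b75dd97 ∷
  0xfffeffeefcafeacb ∷ 0xfffeffeefcafeada ∷ 0xfefcccbfbe9435a6 ∷ 0xfeecccbfbe9435b6 ∷ 0xfeeedddac87a52dc ∷
  0xfeeeecbcfc7952f7 ∷ 0xfeefddfdea7f52da ∷ 0xfeeedcbadf7f4285 ∷ 0xfeeefeebbf7f52fe ∷ 0xfeeeecdc9c7d529b ∷ 0 ∷ 0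
  ∷ 0xffefeffdfceecdb8 ∷ 0xfefcca9fce7579d2 ∷ 0xffdebfe99685dc67 ∷ 0xfefedeeb9a676ed1 ∷ 0xfffcffba8b9c6ada ∷
  0xfffebaaaaffdccff ∷ 0xffecfdee9ee5f459 ∷ 0xfffdbaaaaffdccfe ∷ 0xffecfcee9ee5e459 ∷ 0xffdfbaaaaff988dd ∷
  0xfffcfebbcff5d455 ∷ 0xffdebaaaaff988dc ∷ 0xfffcfdbbcff5c455 ∷ 0xffdcebf99665ed8e ∷ 0xffdcfbf99665ee8e ∷
  0xffdecbf8e9e878d2 ∷ 0xffdfcbf8e9e878c2 ∷ 0xffdcebf99665ed7f ∷ 0xffdcfbf99665ee7f ∷ 0xffdecbf8e9f877d2 ∷
  0xffdfcbf8e9f877c2 ∷ 0xfffcdff9d665fecc ∷ 0xfffceff9d665ffcc ∷ 0xffdffbf8f9dcbce3 ∷ 0xffdefbf8f9dcbcf3 ∷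
  0xfffcdff9d665febd ∷ 0xfffceff9d665ffbd ∷ 0xffdffbf8f9ecbbe3 ∷ 0xffdefbf8f9ecbbf3 ∷ 0xffffbaaaaffdccff ∷
  0xffefbaaaaffdccfe ∷ 0xffffbaaaafedcdff ∷ 0xffefbaaaafedcdfe ∷ 0xffecfaf8f8ecbbf3 ∷ 0xffecfaf8f8dcbcf3 ∷
  0xfffcfaf8f8ecbbe3 ∷ 0xfffcfaf8f8dcbce3 ∷ 0xffdeffb89675bbdc ∷ 0xfeffecb8a675d9e8 ∷ 0xfedfdac8f8f7aea3 ∷
  0xfefffac8d8a9e873 ∷ 0xffdffeb8a675aca9 ∷ 0xfeffded89675a9f7 ∷ 0xfeeefac8d8f79fd3 ∷ 0xfefefae8b8d8f883 ∷
  0xffdfdaf8b8a8dc93 ∷ 0xffffeaf8f8eeeef3 ∷ 0xfedefcf88675eb9e ∷ 0xfffffff8f675ffdd ∷ 0xffdfeae8b8b9bac3 ∷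
  0xffeffaf8f8ecbbe3 ∷ 0xffefeff8d675feaa ∷ 0xfeefdcf88675ce8f ∷ 0xfefcefae79f67e12 ∷ 0xfefede9d965aa5f7 ∷
  0xffdcffbb8ddb7a12 ∷ 0xfffebbdefcf76fcb ∷ 0xffdcfebc8ccc6d12 ∷ 0xfeecfcab7af66f12 ∷ 0xfefeec9ba65ad5e8 ∷
  0xfffebccedbf76eab ∷ 0xfffebccdeddb4a84 ∷ 0xfffeff9ff75fe5dd ∷ 0xfefddc9f865eb58f ∷ 0xfffebbddfccc4d74 ∷
  0xfffdef9fd75ff5aa ∷ 0xfeecfc9f865ce59e ∷ 0xffecff9b975ba4dc ∷ 0xfffcfe9ba75c95a9 ∷ []

graphs-16-32 : List Code
graphs-16-32 = classify primes 4 16 32 t4 ((4 , graphs-11-15 ∷ graphs-11-16 ∷ []) ∷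
    (3 , graphs-12-20 ∷ []) ∷ []) certs-16-32

certs-16-33 : List ℕ
certs-16-33 =
  0 ∷ 0 ∷ 0xfffffffffffefeff ∷ 0xfffffffffffefeff ∷ 0xfeefef98eaf77f40 ∷ 0 ∷ 0xfeefef99ef9f6540 ∷
  0xfeefff98faf77f40 ∷ 0xfffffffffffefeff ∷ 0xfeefff99ff9f6540 ∷ 0xfefdfeaacddb7a40 ∷ 0xfefdfeaacdcb7b40 ∷
  0xffedffeefcf9beda ∷ 0xfffdffeefcf9becb ∷ 0xffefffeefcf9becb ∷ 0xfffdffeefcf9beda ∷ 0xffeeffeefcf9beda ∷ 0 ∷
  0xfffdffeefcf9beda ∷ 0xfffdffeefcf9becb ∷ 0xfffffffffffefeff ∷ 0xfeffcd99eddb7a40 ∷ 0xfeffcd99edcb7b40 ∷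
  0xffefffeefcafeada ∷ 0xffffffeefcafeacb ∷ 0xfedeebfb7aa9ca5e ∷ 0xffffffeefcafeada ∷ 0xfedefafb7aa9ba5e ∷
  0xffedffeeeddddd85 ∷ 0xffffffeefcafeada ∷ 0xffeeffeeeddddd85 ∷ 0xffedffeeeddddd85 ∷ 0xffedffeeeddcdc85 ∷
  0xffffffeefcafeacb ∷ 0xffeeffeeeddcdc85 ∷ 0xffedffeeeddcdc85 ∷ 0 ∷ 0 ∷ 0 ∷ 0 ∷ 0 ∷ 0 ∷ 0 ∷ 0xfffffffffffefeff
  ∷ 0xfffffffffffefeff ∷ 0xfffffffffffefeff ∷ 0xfffffffffffefeff ∷ 0xfffffffffffefeff ∷ 0xfffffffffffefeff ∷
  0xfffffffffffefeff ∷ 0 ∷ 0 ∷ 0xfffffffffffefeff ∷ 0xfefdfcaee85be6dd ∷ 0xfefdfcaed85be6dc ∷ 0 ∷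
  0xfffeba9eba65dd72 ∷ 0xfedcfedd9ca8f714 ∷ 0xfeefeb9af85ee5e8 ∷ 0 ∷ 0 ∷ 0xffffefeefcf9becb ∷ 0xfeffccaee85ea5dd
  ∷ 0xfedcecbf9f98b914 ∷ 0xffffffeefcafeacb ∷ 0xffefffeefcafeacb ∷ 0xfedcfede9ba8f714 ∷ 0xfeeffb9af85ed5e8 ∷
  0xfffffffffffefeff ∷ 0xfffffffffffefeff ∷ 0xffffefeefcf9beda ∷ 0xfeffccaed85ea5dc ∷ 0xfedcfcbf9f98a914 ∷
  0xffefffeefcafeada ∷ 0xffffffeefcafeada ∷ 0 ∷ 0 ∷ 0xfedeebd8a8dbaa83 ∷ 0xfeefcdedfdc53689 ∷ 0xffefefeefcf9becb
  ∷ 0xffefefeefcf9becb ∷ 0xffffefeefcf9beda ∷ 0xfedfceedaed536f6 ∷ 0 ∷ 0xfedfceedaed536f6 ∷ 0xfedfceedaed536f6 ∷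
  0xffefefeeeddddd85 ∷ 0xfeedfbee7cb9f85c ∷ 0xfeedfbee7cb9f85c ∷ 0xfedefbc8d9f89fd1 ∷ 0 ∷ 0 ∷ 0xffefefeefcf9becb
  ∷ 0xffefefeefcf9beda ∷ 0xfedeebd8a8dbaa82 ∷ 0xffefefeefcafeada ∷ 0xfeefddedfd7c6289 ∷ 0 ∷ 0 ∷
  0xffecfeaadfbf77bd ∷ 0xfeedfbcf7fa9a948 ∷ 0xfeedfbcf7fa9a948 ∷ 0xfeedfafb7aa9ba4e ∷ 0xfeedfafb7aa9ba4e ∷
  0xfffffffffffefeff ∷ 0xfffffffffffefeff ∷ 0xfeefcdeefdd53689 ∷ 0xfedeebd8a8cbab83 ∷ 0xffffefeefcf9becb ∷
  0xffefefeefcf9beda ∷ 0xffefefeefcf9beda ∷ 0xfedfceeeaee536f6 ∷ 0xfedfceeeaee536f6 ∷ 0xfedfceeeaee536f6 ∷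
  0xfffffffffffefeff ∷ 0xffdffa9cce75dd71 ∷ 0xfeedfbee7db9f85d ∷ 0xfeedfbee7db9f85d ∷ 0xffefefeefcf9becb ∷
  0xfedefbc8e9f89fc1 ∷ 0xfffffffffffefeff ∷ 0xfffffffffffefeff ∷ 0xffefefeefcf9beda ∷ 0xfedeebd8a8cbab82 ∷
  0xffefefeefcafeacb ∷ 0xfeefddeefd7d6289 ∷ 0xfffffffffffefeff ∷ 0xfffffffffffefeff ∷ 0xffecfeaadfbf77cc ∷
  0xfeedebcf7fa9b948 ∷ 0xfeedebcf7fa9b948 ∷ 0xfeedeafb7aa9ca4e ∷ 0xfeedeafb7aa9ca4e ∷ 0xffffefeefcf9beda ∷
  0xffefefeefcf9beda ∷ 0xffefefeefcf9beda ∷ 0xffefefeefcafeada ∷ 0xffefefeefcafeada ∷ 0xffffefeefcf9becb ∷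
  0xffefefeefcf9becb ∷ 0xffffefeefcf9becb ∷ 0xffefefeefcafeacb ∷ 0xffefefeefcafeacb ∷ 0xffececaadffd6cfe ∷
  0xffececaadfed6dfe ∷ 0xffefefeefcf9beda ∷ 0xfedefbc8e8f89fc4 ∷ 0xfeefccfabae43597 ∷ 0xfedefbc8d8f89fd4 ∷
  0xfeeeccfacae43597 ∷ 0xffefefeeeddddd85 ∷ 0xffefefeeeddddd85 ∷ 0xffefefeeeddddd85 ∷ 0xffefefeeeddcdc85 ∷
  0xffefefeeeddcdc85 ∷ 0xffefefeefcafeada ∷ 0xffefefeefcafeacb ∷ 0xffefbbfbd9986ad1 ∷ 0xfeefccbfbe953597 ∷
  0xffdffbf8f7ecbbe4 ∷ 0xfefdccdd9dd43589 ∷ 0xfedefbf8d8af86c4 ∷ 0xfeeeccbfce953597 ∷ 0xfefdccdc9dc43589 ∷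
  0xffdffbf8f7dcbce4 ∷ 0xfedefbf8c8af86d4 ∷ 0xffffffeefcf9becb ∷ 0xffffffeefcf9becb ∷ 0xffffffeefcf9becb ∷
  0xffffffeefcf9beda ∷ 0xffefffeefcf9beda ∷ 0xffffffeefcf9beda ∷ 0xffffefeefcf9beda ∷ 0xfedfccbfbe9435a6 ∷
  0xffffefeefcf9beda ∷ 0xfedfccfabae435a6 ∷ 0xfedfccfabae435a6 ∷ 0xffffefeefcf9becb ∷ 0xffffefeefcf9becb ∷
  0xfedeccbfbe9435b6 ∷ 0xfedeccfabae435b6 ∷ 0xfedeccfabae435b6 ∷ 0xffffffeefcafeacb ∷ 0xffffffeefcf9becb ∷
  0xffecda9ebe65ae92 ∷ 0xfeeffb9f985ed69e ∷ 0xffefffeefcafeacb ∷ 0xffefffeefcafeacb ∷ 0xffffffeefcafeacb ∷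
  0xffffffeefcafeacb ∷ 0xffefffeefcafeacb ∷ 0xffffffeefcafeacb ∷ 0xffffffeefcafeacb ∷ 0xffffffeefcafeada ∷
  0xffffffeefcf9beda ∷ 0xffecea9ebd65ae92 ∷ 0xfeefeb9f985ee69e ∷ 0xffefffeefcafeada ∷ 0xffefffeefcafeada ∷
  0xffefffeefcafeada ∷ 0xffffffeefcafeada ∷ 0xffffffeefcafeada ∷ 0xffffffeefcafeada ∷ 0xffefffeefcafeada ∷
  0xfedfccbfbe9435a6 ∷ 0xfedfccbfbe9535a6 ∷ 0xffefefeeeddddd85 ∷ 0xffefefeeeddddd85 ∷ 0xffefefeeeddcdc85 ∷
  0xfedfccfabae435a6 ∷ 0xffffefeefcafeada ∷ 0xfedeccbfbe9435b6 ∷ 0xfedeccbfbe9535b6 ∷ 0xffefefeeeddddd85 ∷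
  0xffefefeeeddcdc85 ∷ 0xffefefeeeddcdc85 ∷ 0xfedeccfabae435b6 ∷ 0xffffefeefcafeacb ∷ 0xffefffeeeddddd85 ∷
  0xffefffeeeddcdc85 ∷ 0xfedefcdd9d7d5289 ∷ 0xffffffeefcf9becb ∷ 0xffdffbf8f9dcbce1 ∷ 0xffefefeeeddcdc85 ∷
  0xffefefeeeddcdc85 ∷ 0xffefefeeeddcdc85 ∷ 0xfeddeffa9998b914 ∷ 0xfedefcdc9d7c5289 ∷ 0xffffffeefcf9beda ∷
  0xffdffbf8f9ecbbe1 ∷ 0xffefefeeeddddd85 ∷ 0xffefefeeeddddd85 ∷ 0xffefefeeeddddd85 ∷ 0xfeddfffa9998a914 ∷
  0xffefffeeeddddd85 ∷ 0xffddcddc9dc43666 ∷ 0xffddcddc9dc43666 ∷ 0xffddcddc9dc43666 ∷ 0xfefddadd7ba8785c ∷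
  0xfefddadd7ba8785c ∷ 0xfeeedcfaca7e5297 ∷ 0xfededcfaca7e5297 ∷ 0xffddcdcd9a976711 ∷ 0xffddddcd9a976713 ∷
  0xffddcddd9dd43666 ∷ 0xffddcddd9dd43666 ∷ 0xffefffeeeddcdc85 ∷ 0xffddcddd9dd43666 ∷ 0xfefddadd7ca8785d ∷
  0xfefddadd7ca8785d ∷ 0xffddddcc9b976713 ∷ 0xfeefdcfaba7e5297 ∷ 0xfedfdcfaba7e5297 ∷ 0xffddcdcc9b976711 ∷
  0xffefffeeeddddd85 ∷ 0xffffffeeeddddd85 ∷ 0xffefffeeeddcdc85 ∷ 0xffffffeeeddcdc85 ∷ 0xffefefeeeddcdc85 ∷
  0xffefffeeeddddd85 ∷ 0xffffbbdfe99c6abe ∷ 0xffeebbfde8af77da ∷ 0xffefbbecd98a5fdc ∷ 0xfffdbbddea787fa9 ∷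
  0xfffebbcec99f69bd ∷ 0xfffebbefa8eb6d8e ∷ 0xfffdbbedad7e6f8b ∷ 0xffefbbfdb8cf6d67 ∷ 0xffefbbdebe7b5f68 ∷
  0xffedbbcfc9aa6cd6 ∷ 0xffeebbefa8bc6966 ∷ 0xfffdbbccd9ef5a75 ∷ 0xfeeedddac87a52dc ∷ 0xfeeedddac87a52dc ∷
  0xfeeeecbcfc7952f7 ∷ 0xfedeecbcfc7952f7 ∷ 0 ∷ 0xffffffefcbf9afbd ∷ 0 ∷ 0 ∷ 0 ∷ 0xffeffffdfceecdb8 ∷
  0xffeffffdfceecdb8 ∷ 0xfeefddfdea7f52da ∷ 0xfeefddfdea7f52da ∷ 0xffffffeefcda8add ∷ 0xfffffffdfceecdb8 ∷
  0xfffffffdfceecdb8 ∷ 0xfededcbadf7f5285 ∷ 0xfededcbadf7f5285 ∷ 0xffffffeefcbcff68 ∷ 0xffefffeefcbcff68 ∷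
  0xfedfcfd9eff89730 ∷ 0xffddcfe9bcda7c30 ∷ 0xfeeefeebbf7f52fe ∷ 0xfedefeebbf7f52fe ∷ 0xfedeecdc9c7d529b ∷
  0xfedeecdc9c7d529b ∷ 0xffffffefebadc98f ∷ 0xffefffefebadc98f ∷ 0xffefffeefcbcff68 ∷ 0xffefffefebadc98f ∷
  0xffefffefebadc98f ∷ 0xffefffefcbf9afbd ∷ 0xffefffefcbf9afbd ∷ 0xffffffeefcda8add ∷ 0xffefffeefcda8add ∷
  0xfeddcfb9e9a8ab30 ∷ 0xfeddecdc9c6d429b ∷ 0xfeddecbcfc7942f7 ∷ 0 ∷ 0xfeddecbcfc7952f7 ∷ 0xfeedecbcfc7952f7 ∷
  0xfeddecbcfc7952f7 ∷ 0xfeddfeebbf7f52fe ∷ 0xfeddfeebbf7f52fe ∷ 0xfeddfeebbf7f52fe ∷ 0xfeedfeebbf7f52fe ∷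
  0xffffffefebadc98f ∷ 0xfeddfeebbf7f62dc ∷ 0xfeddecbcfa7f629b ∷ 0 ∷ 0xffffeffdfceecdb8 ∷ 0xfeeeecbcfa7f629b ∷
  0xfeeedcbad87a52fe ∷ 0xfeddeacc7aa8feab ∷ 0xffffdfeefcda8add ∷ 0 ∷ 0 ∷ 0 ∷ 0 ∷ 0 ∷ 0xffffefeefcbcff68 ∷
  0xffecfcda8adeb5b4 ∷ 0xffffdfeefcbcff68 ∷ 0xffffdfeefcbcff68 ∷ 0xfedddddac87a42dc ∷ 0xfedddddac87a52dc ∷
  0xfedddddac87a52dc ∷ 0xfeeddddac87a52dc ∷ 0xffffffefcbf9afbd ∷ 0xffddddfdea6f62da ∷ 0xfffeffefcbf9afbd ∷
  0xfffcedce898cb573 ∷ 0xffddddfdea7f62da ∷ 0xffddddfdea7f62da ∷ 0xfefdddfdea7f62da ∷ 0xffffeffdfceecdb8 ∷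
  0xffffeffdfceecdb8 ∷ 0xffffeffdfceecdb8 ∷ 0xffffeffdfceecdb8 ∷ 0xffdeedbc8b9be554 ∷ 0xffdffebc8bc865c3 ∷
  0xffffffefcbf9afbd ∷ 0xfffcff9fdf6cff12 ∷ 0xfeddccbcfa5f629b ∷ 0xffffdfefebadc98f ∷ 0xfeddecdc9c6d429b ∷
  0xfedddddacd6d4285 ∷ 0xfedddcbadf6f4285 ∷ 0xfeddecdc9c6d429b ∷ 0xfefccb9baf6ebd14 ∷ 0xffffdfefcbf9afbd ∷
  0xfedddacf7bb8ac7e ∷ 0xfffeffeefcda8add ∷ 0xfffeffeefcda8add ∷ 0xfffeffeefcda8add ∷ 0xfeedecdc9c7d529b ∷
  0xffffdfeefcbcff68 ∷ 0xfffeffeefcda8add ∷ 0xfeeddcbadf7f4285 ∷ 0xfedddcbadf7f4285 ∷ 0xfedddcbadf7f5285 ∷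
  0xffffefefebadc98f ∷ 0xffdfdccc8dddd5e4 ∷ 0xfffcdccc8dddd4e4 ∷ 0xffddddfdec6e42f7 ∷ 0 ∷ 0 ∷ 0xfeddfbc8acb636ff
  ∷ 0xfeefdac8f9f8aea4 ∷ 0xfeefddaafaf79e30 ∷ 0xfeeedcfaca7f5298 ∷ 0xfedffdc9aea636bd ∷ 0xffefffefdcf9afbd ∷
  0xffefffefdcf9afbd ∷ 0xfedeecdd9d7d5299 ∷ 0xfeffff9afddbaa30 ∷ 0xfefffaf8f9ecbbe4 ∷ 0xfffebbedbe679fb6 ∷
  0xffececada8fdccff ∷ 0xffecefafa8dbaa67 ∷ 0xffecffaf9af9bebd ∷ 0xfeddecdd9b6a52dc ∷ 0xffecffaf9af9becc ∷
  0xffdfefafd85ff6aa ∷ 0xfedefcaf975ce69e ∷ 0xffedbccfcf66dd66 ∷ 0xfedddcfaca6a42f7 ∷ 0xfededacf7a9ca95e ∷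
  0xfedccccbcfe435ab ∷ 0xfeecfa9fc88e695e ∷ 0xfeececdc7bac865d ∷ 0xffdfffafd65fe6aa ∷ 0 ∷ 0xfefebaaaafbeacbd ∷
  0xfedccccbcfe435ab ∷ 0xffdfbaa99fbeacbd ∷ 0xfeffdf9aeddbcc40 ∷ 0xfeffdf9aedccb940 ∷ 0xfefedfa8eddbcc40 ∷
  0xfefcca9fce7679d3 ∷ 0xfeedfafb799f7659 ∷ 0xfeeeeddbab7d5268 ∷ 0xfefeeaf8f9ddcae3 ∷ 0xfeedeacf7ac8aa5e ∷
  0xffdfff9ff8f46fdd ∷ 0xffdcefe99685dc67 ∷ 0xfeeedccf7a9ca95e ∷ 0xfeeedccf7a9ca95e ∷ 0xfeeddacf7a9ca95e ∷
  0xfeeddacf7a9ca95e ∷ 0xffdebfe89685dc67 ∷ 0xfeeddbcf7a9ca95e ∷ 0xfefefaf8f9dcbce4 ∷ 0xfedecdc9ba8ab730 ∷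
  0xfefdca9fce7679d4 ∷ 0xfeeefcaab89634ff ∷ 0xfffcbbb8a677fefe ∷ 0xfefcda9f9c65fe83 ∷ 0xfedccccbcfe434ab ∷
  0xfeeedcdacddddd20 ∷ 0xfffcfbdeda86f6dc ∷ 0xffecef9fd7f45fbd ∷ 0xfffebf9ff75ff5dd ∷ 0xffffbbcde99f69da ∷
  0xfeededbab87a52ff ∷ 0xffffbbedfbac66e2 ∷ 0xffdecbb9a676fffe ∷ 0xfefcee9bffe6368b ∷ 0xfefceaf8e9ac8ce4 ∷
  0xfeeedcdacddbaa20 ∷ 0xfedceadd7cb889aa ∷ 0xfedfbaa98fae97a9 ∷ 0xfedceadd7cb889aa ∷ 0xfeeedcdacddbaa30 ∷
  0xfeeedcdacddbaa30 ∷ 0xffececc9aeeee4ff ∷ 0xfedccccbcfe434ab ∷ 0xfedfca9fce7579d2 ∷ 0xfeffefafd85fe6bd ∷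
  0xfefeefaaeddbcc40 ∷ 0xfedfbaa98fae97a9 ∷ 0xfefdebaf975ee58e ∷ 0xfffcdcbd9ba5e5e7 ∷ 0xffffbbdef7ab863a ∷
  0xfeedebdc7bac865d ∷ 0xfeedebdc7bac865d ∷ 0xfeddcfbf898b9813 ∷ 0xffdffcbc97de9599 ∷ 0xfeeecddbabd63668 ∷
  0xfefeefaafddbcc40 ∷ 0xfefeefaafddbbd40 ∷ 0xfedfebf8e99f76d3 ∷ 0xfffcbffa78c45d7b ∷ 0xfffcccafdf58bd12 ∷ 0 ∷
  0xfeddfbf8b99b76e3 ∷ 0xfeddfcaabfe53575 ∷ 0xfeeefcaabfe53575 ∷ 0xfffdbbebebb6d4b6 ∷ 0xfefdfbf99676ee7f ∷
  0xffdfccfdd759e43d ∷ 0xfeffccfdd759e43d ∷ 0xffecbfe99665dc67 ∷ 0xfeddcfbf898b9814 ∷ 0xfeedcdbabfe63585 ∷ 0 ∷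
  0xffefbbdfa8da6c66 ∷ 0xfffcffb99b9c7ada ∷ 0xfeecccfabae435b6 ∷ 0xfefdddaafaf78f40 ∷ 0xfeddccfacae43597 ∷
  0xfefdff9afaf77f40 ∷ 0xfedeccfabae435b6 ∷ 0xfefefa9cce77dd59 ∷ 0xfeeefacc79f88f59 ∷ 0xfeeeeccf7fa9b958 ∷
  0xfefffa9bce77cd5b ∷ 0xfeeeface79f89f5b ∷ 0xfeeedccf7faaab58 ∷ 0xffedba9ceb67dd59 ∷ 0xffeeba9ceb75dd59 ∷
  0xfedeecfb7aa9ca5e ∷ 0xffeeba9beb67cd5b ∷ 0xffedba9beb75cd5b ∷ 0xfededcfb7aaabc5e ∷ 0xfeecccbfbe9535b6 ∷
  0xfeefdbacf75e9459 ∷ 0xffdfbbc8a665fefe ∷ 0xffdfbbc8a677fefe ∷ 0xfeecbcfabae434b6 ∷ 0xfedefbc8d9f89fd3 ∷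
  0xfffceed98caa9f48 ∷ 0xfedcfed8dc9a8f14 ∷ 0xfedffbc8f9f88fd3 ∷ 0xfeefdcaef75e945b ∷ 0xffddbbc8b665fcfe ∷
  0xffddbbc8b677fcfe ∷ 0xfedcbcfacae43497 ∷ 0xfedfebc8f9f88fd3 ∷ 0xfedcfed8cb9c7f14 ∷ 0xfedfdbc8d9f89fd3 ∷
  0xfffceec98bac8f48 ∷ 0xfffcffed99a5ff3b ∷ 0xfffcffde9995ff39 ∷ 0xffecfeaadcf87fcc ∷ 0xfeecbcfabae434b6 ∷
  0xffdfdccbc8ef4d59 ∷ 0xffdfeccbc7ef6d59 ∷ 0xffeceed98c9a865e ∷ 0xfedefbf8c9af86d4 ∷ 0xfedcccbfce943597 ∷
  0xfedfdbf8c9af86d4 ∷ 0xfffcdcc9cdebc45e ∷ 0xffddbfe8a688da68 ∷ 0xffeceec98b9c765e ∷ 0xffdfecccc8df4d5b ∷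
  0xffdfdcccc7df6d5b ∷ 0xfeecccbfbe9435b6 ∷ 0xfffcdcc9beeca45e ∷ 0xfedffbf8e9af76d4 ∷ 0xfedfebf8e9af76d4 ∷
  0xffdfbfe89678dc68 ∷ 0xffdfbfe99665dc68 ∷ 0xffddbfe9a675da68 ∷ 0xffffbaaaaffdccff ∷ 0xffffbaaaafedcdff ∷
  0xffecbaf8e8e878d1 ∷ 0xffefbaaaaffdccfe ∷ 0xffefbaaaafedcdfe ∷ 0xffecbaf8e8f877d1 ∷ 0xffefbaf8f8dcbcf1 ∷
  0xfffcbaa9afe989dd ∷ 0xfffcbaa9aff988dd ∷ 0xffefbaf8f8ecbbf1 ∷ 0xffecbaa9afe989dc ∷ 0xffecbaa9aff988dc ∷
  0xfeddfcb8cc99ff40 ∷ 0xfeddfcb8cc98fe40 ∷ 0xfeddfdd9aadcdc40 ∷ 0xfeddfcb8cc99ff40 ∷ 0xfeddfcb8cc98fe40 ∷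
  0xfeddedd9abdcdc40 ∷ 0xfeddfdd9aadddd40 ∷ 0xfeddecb8cd99ff40 ∷ 0xfeddecb8cd98fe40 ∷ 0xfeddedd9abdddd40 ∷
  0xfeddecb8cd99ff40 ∷ 0xfeddecb8cd98fe40 ∷ 0xfedeffccff7f52da ∷ 0xfedeffccff7f52cb ∷ 0xffeccaf8e9e878d1 ∷
  0xffdecaabbbafe9dd ∷ 0xfeffef9fd85fe6bd ∷ 0xfeffef9fd85fe6bd ∷ 0xfeffef9fd85fe6cc ∷ 0xffdfcaabbbafe9dc ∷
  0xfeffef9fd85fe6cc ∷ 0xfedeedbbbf7f5285 ∷ 0xffdfcaf8e9e878c3 ∷ 0xfedefcbbbf7f5285 ∷ 0xffdecaf8e9e878d3 ∷
  0xfedeffcbff7e52da ∷ 0xfedeffcbff7e52cb ∷ 0xffeccaf8e9f877d1 ∷ 0xffdecaabbbaff8dd ∷ 0xfeffdf9fd85ff6bd ∷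
  0xfeffdf9fd85ff6bd ∷ 0xfeffdf9fd85ff6cc ∷ 0xffdfcaabbbaff8dc ∷ 0xfeffdf9fd85ff6cc ∷ 0xfedeedbabf7e5285 ∷
  0xffdfcaf8e9f877c3 ∷ 0xfedefcbabf7e5285 ∷ 0xffdecaf8e9f877d3 ∷ 0xffecfaf8f9dcbcf1 ∷ 0xfeefddfffe7e52e7 ∷
  0xfeefddfffe7e52f6 ∷ 0xffdffaf8f9dcbce3 ∷ 0xfedeeddd9d7d5299 ∷ 0xffdefaf8f9dcbcf3 ∷ 0xfedefcdd9d7d5299 ∷
  0xfefdfb9f985ed67f ∷ 0xffdefaabbfefedff ∷ 0xfefdfb9f985ed67f ∷ 0xfefdfb9f985ed68e ∷ 0xfefdfb9f985ed68e ∷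
  0xffdffaabbfefedfe ∷ 0xffecfaf8f9ecbbf1 ∷ 0xfeefddfefe7d52e7 ∷ 0xfeefddfefe7d52f6 ∷ 0xffdffaf8f9ecbbe3 ∷
  0xfedeeddc9d7c5299 ∷ 0xffdefaf8f9ecbbf3 ∷ 0xfedefcdc9d7c5299 ∷ 0xfefdeb9f985ee67f ∷ 0xffdefaabbfeffcff ∷
  0xfefdeb9f985ee67f ∷ 0xfefdeb9f985ee68e ∷ 0xfefdeb9f985ee68e ∷ 0xffdffaabbfeffcfe ∷ 0xfefecaf8e9f877c4 ∷
  0xfefefaf8f9ecbbe4 ∷ 0xfefecaf8e9e878c4 ∷ 0xfefffaf8f9ecbbf4 ∷ 0xfeffcaf8e9f877d4 ∷ 0xfefefaf8f9dcbce4 ∷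
  0xfeffcaf8e9e878d4 ∷ 0xfefffaf8f9dcbcf4 ∷ 0xffefbbdce7aaff59 ∷ 0xfedfcfef9c99ff13 ∷ 0xfedfcfef9c98fe13 ∷
  0xfffccb9bb7f45eff ∷ 0xffdeff98a687bbdd ∷ 0xfffebaaaaffdccff ∷ 0xfffebaaaafedcdff ∷ 0xffffbaa9affdccff ∷
  0xffeccaf8e8e878d2 ∷ 0xfffccb9ba7f45efe ∷ 0xffdefe98b687bbdd ∷ 0xfffdbaaaaffdccfe ∷ 0xfffdbaaaafedcdfe ∷
  0xffefbaa9affdccfe ∷ 0xffeccaf8e8f877d2 ∷ 0xfeedeccc7daaff48 ∷ 0xfffebff8d665ffaa ∷ 0xfeedeccc7daaff48 ∷
  0xfeedeccc7da9fe48 ∷ 0xffecdff8d665febd ∷ 0xffeceff8d665ffbd ∷ 0xfeefcfaedafc7f40 ∷ 0xfedefe99d666ff85 ∷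
  0xfeefcfaedafc8e40 ∷ 0xfeefcfaedafc7f40 ∷ 0xfeefcfaedafc8e40 ∷ 0xfeeefe99d666fe85 ∷ 0xffefbbecf7aaff59 ∷
  0xfedfcfee9d99ff13 ∷ 0xfedfcfee9d98fe13 ∷ 0xffeccb9bb7f45fff ∷ 0xfffebaaaaffdccff ∷ 0xffdfff98a687bbdc ∷
  0xfffebaaaafedcdff ∷ 0xffffbaa9afedcdff ∷ 0xfffccaf8e8e878c2 ∷ 0xffeccb9ba7f45ffe ∷ 0xfffdbaaaaffdccfe ∷
  0xffdffe98b687bbdc ∷ 0xfffdbaaaafedcdfe ∷ 0xffefbaa9afedcdfe ∷ 0xfffccaf8e8f877c2 ∷ 0xffecdff8d665fecc ∷
  0xffeceff8d665ffcc ∷ 0xfeedfccc7caaff48 ∷ 0xfffebfe8d665ffab ∷ 0xfeedfccc7caaff48 ∷ 0xfeedfccc7ca9fe48 ∷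
  0xfedeff99c666ff85 ∷ 0xfeefcfafdafb7f40 ∷ 0xfeefcfafdafb8e40 ∷ 0xfeefcfafdafb7f40 ∷ 0xfeeeff99c666fe85 ∷
  0xfeefcfafdafb8e40 ∷ 0xffffbccde7dddd55 ∷ 0xfeedecdb7cdddd48 ∷ 0xfeedecdb7cdcdc48 ∷ 0xfffcff9ff7f46edd ∷
  0xfffcff9fe7f46edc ∷ 0xfeedecdb7cdddd48 ∷ 0xffdfbff89665dd66 ∷ 0xfefcebf89665ed7f ∷ 0xfefcfbf89665ee7f ∷
  0xffddcfcf9adddd13 ∷ 0xffddcfcf9adcdc13 ∷ 0xffecfaf8f8ecbbf3 ∷ 0xffecbaa99ff988dc ∷ 0xffeebed9ca7c8f82 ∷
  0xffecfe99b667dd99 ∷ 0xffdfdfed7675ffab ∷ 0xffecfaf8f8dcbcf3 ∷ 0xfffcbaa99ff988dd ∷ 0xffdfdffd7675ffaa ∷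
  0xffeebee9ca7b8f82 ∷ 0xfffcfe99b667dc99 ∷ 0xffdfbaaaaff988dd ∷ 0xfeecff98c687a7ff ∷ 0xffdfbaaaafe989dd ∷
  0xffdebaaaaff988dc ∷ 0xfeecfe98d687a7ff ∷ 0xffdebaaaafe989dc ∷ 0xfefcebf89665ed8e ∷ 0xfefcfbf89665ee8e ∷
  0xffffbbddf7dddd55 ∷ 0xffddcfce9bdddd13 ∷ 0xffddcfce9bdcdc13 ∷ 0xfeedfcdb7bdddd38 ∷ 0xfffcfaf8f8ecbbe3 ∷
  0xffecbaa99fe989dc ∷ 0xffecff99a667dd99 ∷ 0xffeebed9ca7c9e82 ∷ 0xffdfefed7675feab ∷ 0xfeedfcdb7bdcdc38 ∷
  0xfffcfaf8f8dcbce3 ∷ 0xfffcbaa99fe989dd ∷ 0xffdfeffd7675feaa ∷ 0xfffcff99a667dc99 ∷ 0xffeebee9ca7b9e82 ∷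
  0xffecff9ff7f46fdd ∷ 0xffecff9fe7f46fdc ∷ 0xfeedfcdb7bdddd48 ∷ 0xffdfbfe89665dd67 ∷ 0xffdfbaaaaff988dd ∷
  0xffdfbaaaafe989dd ∷ 0xfeedff98c687a7fe ∷ 0xffdebaaaaff988dc ∷ 0xffdebaaaafe989dc ∷ 0xfeedfe98d687a7fe ∷
  0xfeffcbaaf7e47de7 ∷ 0xfeffcbaaf7e47df6 ∷ 0xfefecbaaf7e47ee7 ∷ 0xfefecbaaf7e47ef6 ∷ 0xffdecbaba7f45ffe ∷
  0xfeddfcdc9d6c5299 ∷ 0xffdecbabb7f45fff ∷ 0xfeddeddc9d6c5299 ∷ 0xffdfcbaba7f45efe ∷ 0xfeddfcdd9d6d5299 ∷
  0xffdfcbabb7f45eff ∷ 0xfeddeddd9d6d5299 ∷ 0xfffcfabbbffdccff ∷ 0xfffcfabbbfedcdff ∷ 0xffdfffaff8f47edd ∷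
  0xffdfffafe8f47edc ∷ 0xffdecbf8e9e878d2 ∷ 0xffdecbf8e9e878d2 ∷ 0xffdfcbf8e9e878c2 ∷ 0xffdfcbf8e9e878c2 ∷
  0xfeffffaef8f47eda ∷ 0xfeffffaef8f47ecb ∷ 0xffecfabbaffdccfe ∷ 0xfeefccdd9dd53599 ∷ 0xfeeecddc9dc53699 ∷
  0xffdffbf8f9ecbbe4 ∷ 0xffdffbf8f9ecbbe4 ∷ 0xffeccabaafe989dc ∷ 0xfeededdc9d6c6299 ∷ 0xfffcebcdbb986e83 ∷
  0xfeededbbbf7f4285 ∷ 0xfeddedbbbf7f4285 ∷ 0xfeeecdbbbff63585 ∷ 0xffecfabbafedcdfe ∷ 0xfeeecddd9dd53699 ∷
  0xfeefccdc9dc53599 ∷ 0xffdffbf8f9dcbce4 ∷ 0xffdffbf8f9dcbce4 ∷ 0xfffccabaafe989dd ∷ 0xfeedfcbbbf7f4285 ∷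
  0xfeededdd9d6d6299 ∷ 0xfffcebcebc986e83 ∷ 0xfeddfcbbbf7f4285 ∷ 0xfeefccbbbff63485 ∷ 0xffdeffaff8f47fdd ∷
  0xffdeffafe8f47fdc ∷ 0xffdecbf8e9f877d2 ∷ 0xffdecbf8e9f877d2 ∷ 0xffdfcbf8e9f877c2 ∷ 0xffdfcbf8e9f877c2 ∷
  0xfefeffaef8f47fda ∷ 0xfefeffaef8f47fcb ∷ 0xffdefbf8f9ecbbf4 ∷ 0xffdefbf8f9ecbbf4 ∷ 0xffeccabaaff988dc ∷
  0xfffcebcdbb996f83 ∷ 0xfeedfcdc9d6c6299 ∷ 0xfeededbabf7e4285 ∷ 0xfeddedbabf7e4285 ∷ 0xfeeecdbabfe63585 ∷
  0xffdefbf8f9dcbcf4 ∷ 0xffdefbf8f9dcbcf4 ∷ 0xfffccabaaff988dd ∷ 0xfeedfcbabf7e4285 ∷ 0xfffcebcebc996f83 ∷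
  0xfeedfcdd9d6d6299 ∷ 0xfeddfcbabf7e4285 ∷ 0xfeefccbabfe63485 ∷ 0xfeeefacc79f77f49 ∷ 0xfefeecb8a676d9e8 ∷
  0xffecffb89675bbdc ∷ 0xfedfbac8c675fcff ∷ 0xfeeefabc7bf77f4a ∷ 0xffdedcc8e676c999 ∷ 0xfeefeabf79f78e4c ∷
  0xfefeded89676a9f7 ∷ 0xfffcfeb8a675aca9 ∷ 0xffddcac8b675dffe ∷ 0xfeefeabf7af78e4d ∷ 0xffdeebe8f676a98c ∷
  0xffefdfe8f676ffda ∷ 0xfefdfbcc7eec8b4f ∷ 0xffffbbf8d675aac7 ∷ 0xfeecfcf88675eb9e ∷ 0xfffefff8f676ffdd ∷
  0xfefddadc7cc7684a ∷ 0xffeecff8d676febd ∷ 0xfefdfbcd7ddd7e4e ∷ 0xffefbce8b675ac98 ∷ 0xfffdeff8d675feaa ∷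
  0xfefddcf88676ce8f ∷ 0xfeeddbdd7ca8694d ∷ 0xffefbec9d9f8afbd ∷ 0xffefbec9d99ff9bd ∷ 0xffdcebba9f5e42fe ∷
  0xfedefac8d8f79fd2 ∷ 0xfeeefaa9aaccffbd ∷ 0xfeddfbdc8c5942a9 ∷ 0xfedcfcd89db7b920 ∷ 0xfeffde9d975aa5f7 ∷
  0xfefcef9f9887fe20 ∷ 0xffdefc99ced7f730 ∷ 0xffdffeb8a665aca9 ∷ 0xfeeefaa9affa79bd ∷ 0xffddffbb8ddb7a12 ∷
  0xffdcffbb8ddb7a12 ∷ 0xfeffdaf8b8a8dc93 ∷ 0xffdcfc9fdc87da30 ∷ 0xfeffdc99bf97dc20 ∷ 0xfffebbdefcf76fcb ∷
  0xfeddecaf8ea8b913 ∷ 0xfefcdbd9cb5b52c7 ∷ 0xffefbde9e8bbaec7 ∷ 0xffefbde9e8bae9c7 ∷ 0xffddfebc8ccc6d12 ∷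
  0xffdcfebc8ccc6d12 ∷ 0xfeffeae8b8b9bac3 ∷ 0xffdcfd9ecc88bd30 ∷ 0xfeffed99bea8a920 ∷ 0xfedcfbcaac5b42ff ∷
  0xfeefdac8f8f7aea2 ∷ 0xffefbfb9f9f8beda ∷ 0xffefbfb9f99feada ∷ 0xfedfdaa9aacbfeda ∷ 0xfeddecdd8b5a42dc ∷
  0xfedcedd89dd8cc20 ∷ 0xfeffec9ba75ad5e8 ∷ 0xffdeffb89665bbdc ∷ 0xfeecfc9ca888ff20 ∷ 0xffdffc99dba8e830 ∷
  0xfedfdaa9afea7ada ∷ 0xffefbdd9c8adaf98 ∷ 0xffefbdd9c8d9f998 ∷ 0xfffebbcedbf76eab ∷ 0xffdddcaf8f97cc13 ∷
  0xfeecdcd9dd5d5298 ∷ 0xffeebcd9e8ffffff ∷ 0xffeebcd9e8fefeff ∷ 0xfffebef9c96affdc ∷ 0xfeefdd99faf69e20 ∷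
  0xfffebdbaed69ebe8 ∷ 0xffefef99eddddd30 ∷ 0xffdceec8abac7e20 ∷ 0xffffff9ff75fe5dd ∷ 0xffdfdaa9acef8d99 ∷
  0xffdfdaa9abefac99 ∷ 0xffddedca9c5e429e ∷ 0xffedbcb9e9abdd99 ∷ 0xffedbcb9e9b9dc99 ∷ 0xfedefcf88665eb9e ∷
  0xfefcfdcaae5a52bd ∷ 0xfedfefae89f67e13 ∷ 0xfefcefae89f67e13 ∷ 0xfedeff99caf68f30 ∷ 0xfffebedab969fea9 ∷
  0xfefefaa9aebe8f98 ∷ 0xffefeff8d665feaa ∷ 0xffdefae8b8d8f882 ∷ 0xfefefaa9abfdc998 ∷ 0xffddcbca9f5f42aa ∷
  0xfeefdc9f875eb58f ∷ 0xffdccfe89aa67a20 ∷ 0xfefcdbfd8a5e428c ∷ 0xfffebdb9dd6acef7 ∷ 0xffffff99fddbaa20 ∷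
  0xfffffaf8f8ecbbe3 ∷ 0xfffebbddfccc5d74 ∷ 0xfeddddcd8a975812 ∷ 0xfedefcab8af66f13 ∷ 0xfeecfcab8af66f13 ∷
  0xfefcfeea9f5952da ∷ 0xffeebcc9d8fdccfe ∷ 0xffeebcc9d8efcbfe ∷ 0xffdceee8ad9c6f20 ∷ 0xffefef9fd75ff5aa ∷
  0xffdfeaa9acce9b8c ∷ 0xfeefdcf88665ce8f ∷ 0xffddeeeaae5b428f ∷ 0xffdfeaa9acceaa8c ∷ 0xffeebcb9f9bbbb8c ∷
  0xffeebcb9f9baba8c ∷ 0xfefffaa9acbc9ec7 ∷ 0xffdffac8d8a9e872 ∷ 0xfefffaa9aceba9c7 ∷ 0xffdfcbbaaf5e42dd ∷
  0xfffffff8f665ffdd ∷ 0xfeececfc8a5f4299 ∷ 0xfedefc9f875ce59e ∷ 0xfffccff899d66d20 ∷ 0xffefeaf8f8eeeef3 ∷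
  0xfffebbcdeddb5a84 ∷ 0xffdddddc8dc65712 ∷ 0xfedfdcbc88f66f13 ∷ 0xfedfdcbc88f66f13 ∷ 0xfedfffaf88f67e13 ∷
  0xfedfffaf88f67e13 ∷ 0xfeffecb8a675d9e8 ∷ 0xffdeff9b975ba4dc ∷ 0xfedcfeb8dfe65830 ∷ 0xffdfccef89db7a12 ∷
  0xffdfccef89db7a12 ∷ 0xfedecfea88a8b913 ∷ 0xfedecfea88a8b913 ∷ 0xfeffded89665a9f7 ∷ 0xffdffe9ba75c95a9 ∷
  0xfedcdcb8dff75720 ∷ 0xffeffaa9afeffcfe ∷ 0xfedddcf9ca5a42f7 ∷ 0xffeffaa9afeedbfe ∷ 0xfeddcdcc8b975812 ∷
  0xfeddcdcc8b975812 ∷ 0xffffeaa9affddfff ∷ 0xfeddfbf9da5d42e8 ∷ 0xffffeaa9affdeeff ∷ 0xffddcddb8cc65712 ∷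
  0xffddcddb8cc65712 ∷ 0xffdfcdde89cc6d12 ∷ 0xffdfcdde89cc6d12 ∷ 0xffddcffa8897cc13 ∷ 0xffddcffa8897cc13 ∷
  0xfffcff9aa75ba4dd ∷ 0xffecff9a975ba4dc ∷ 0xffdebbbabfe435ff ∷ 0xffdecbbabf6e52ff ∷ 0xffdfbbbbbff435ff ∷
  0xffdfcbbbbf6f52ff ∷ 0xffefbbf8d675aad5 ∷ 0xffefefe8f675ffda ∷ 0xffffff9ff75fe4dd ∷ 0xffefff9fe75fe4dc ∷
  0xfeddeddc8d6c5299 ∷ 0xfeecbddc8dc43599 ∷ 0xfedeeddd8d6d5299 ∷ 0xfeedbddd8dd43599 ∷ 0xfefcefae79f68e12 ∷
  0xfefcffaf78f68e12 ∷ 0xffefbfd9fcf76fda ∷ 0xfedfde9d7af66f12 ∷ 0xfedfdf9c7af67f12 ∷ 0xffefbcbaeea95ad5 ∷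
  0xffffff9ff75fe5dd ∷ 0xffefff9fe75fe5dc ∷ 0xfffcff9aa75ba4dd ∷ 0xfffdbccdedd867d1 ∷ 0xffffbbfcea86f88b ∷
  0xfedcddcd8a985811 ∷ 0xffecff9a975ba4dc ∷ 0xfffdbccdecd866c1 ∷ 0xffffbbfcda86f78a ∷ 0xfedccdcc8b985811 ∷
  0xfefdcd99fff85730 ∷ 0xfffecf99edccb930 ∷ 0xfedfdcaf8f97cc13 ∷ 0xffeeef99edcbab30 ∷ 0xfedfcfe9889aaa13 ∷
  0xfedfeeea8d8d8f13 ∷ 0xffdcdd99ff9f7430 ∷ 0xfedfba9cc75df4ff ∷ 0xffffcf98edccb930 ∷ 0xffdfface77aa6c7a ∷
  0xfeffdace77bd696f ∷ 0xfeddfbafde6952c7 ∷ 0xfefcbbafde9435c7 ∷ 0xfedfcffa8897cc13 ∷ 0xfeefcd98fff85730 ∷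
  0xffefdf9ef75fe4da ∷ 0xfedecdcc8b975813 ∷ 0xfeffccedf96b528c ∷ 0xffddfa9f8f57dc13 ∷ 0xfedefcf88675eb9e ∷
  0xfffffff8f675ffdd ∷ 0xfededdcd8a975813 ∷ 0xfeecbcdc8dc43599 ∷ 0xfeddecdc8d6c5299 ∷ 0xffdcdcf9dae435b5 ∷
  0xfedcddddadd43556 ∷ 0xffdcdcf9dae435b5 ∷ 0xfedcddddadd43556 ∷ 0xfeefdbf9b86f5298 ∷ 0xffeebb9ecb58e813 ∷
  0xffdfdc9c7e8d8f13 ∷ 0xfedfbac8b666fcfe ∷ 0xffffbbeccdc5b76f ∷ 0xffffbbdefcf76fcb ∷ 0xfefffd9b8e9aaa11 ∷
  0xffdcdcaf7f97cc13 ∷ 0xffefbecd89f76ea9 ∷ 0xffffbccdeddb4a84 ∷ 0xffeeff9fd75fe5cc ∷ 0xfffeff9ff75fe5dd ∷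
  0xffefdf9fd75fe5cc ∷ 0xffdccffa7897cc12 ∷ 0xfedcff9ea75bd458 ∷ 0xffffbbdfda8cb782 ∷ 0xfedcddcd8a975811 ∷
  0xffefdff8d667ffbd ∷ 0xffefbdda8bdd4ef7 ∷ 0xfedccdcc7b975811 ∷ 0xfeecfc9f865ce59e ∷ 0xfedfbf9ea65bd558 ∷
  0xfffebbddebc966c1 ∷ 0xffefbbfcda86f77a ∷ []

graphs-16-33 : List Code
graphs-16-33 = classify primes 4 16 33 t4 ((4 , graphs-11-15 ∷ graphs-11-16 ∷ []) ∷
    (3 , graphs-12-20 ∷ graphs-12-21 ∷ []) ∷ []) certs-16-33

graphs-22-59 : List Code
graphs-22-59 = classify primes 5 22 59 t5 ((5 , graphs-16-32 ∷ []) ∷ []) []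

graphs-23-68 : List Code
graphs-23-68 = classify primes 5 23 68 t5 ((6 , graphs-16-32 ∷ []) ∷ []) []

graphs-23-69 : List Code
graphs-23-69 = classify primes 5 23 69 t5 ((6 , graphs-16-32 ∷ graphs-16-33 ∷ []) ∷ []) []

opaque
  unfolding classify
  -- The exhaustive searches are run here: `refl` evaluates the classification along with those it
  -- is built on. Elsewhere `classify` stays opaque and only these equations are used.
  graphs-16-31-none : graphs-16-31 ≡ []
  graphs-16-31-none = refl
  graphs-17-38-none : graphs-17-38 ≡ []
  graphs-17-38-none = refl
  graphs-22-59-none : graphs-22-59 ≡ []
  graphs-22-59-none = refl
  graphs-23-68-none : graphs-23-68 ≡ []
  graphs-23-68-none = refl
  graphs-23-69-none : graphs-23-69 ≡ []
  graphs-23-69-none = refl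

-- The cases where averaging is not sharp.
exempt₅ exempt₆ exempt₇ : ℕ → ℕ → Bool
exempt₅ n E = (n ≡ᵇ 16) ∧ (E ≡ᵇ 31) ∨ (n ≡ᵇ 17) ∧ (E ≡ᵇ 38)
exempt₆ n E = (n ≡ᵇ 22) ∧ (E ≡ᵇ 59) ∨ (n ≡ᵇ 23) ∧ (E ≡ᵇ 68) ∨ (n ≡ᵇ 23) ∧ (E ≡ᵇ 69)
exempt₇ n E = n ≡ᵇ 29

-- Upper bounds for the Ramsey numbers R(3, k + 1).
ramseyNumber : ℕ → ℕ
ramseyNumber 0 = 1
ramseyNumber 1 = 3
ramseyNumber 2 = 6
ramseyNumber 3 = 9
ramseyNumber 4 = 14
ramseyNumber 5 = 19
ramseyNumber 6 = 23
ramseyNumber 7 = 29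
ramseyNumber _ = 37

-- Minimal edge numbers and the Ramsey bounds

module Ramsey {V : Set} (_~_ : V → V → Bool)
  (~-sym : ∀ x y → (x ~ y) ≡ (y ~ x))
  (~-irrefl : ∀ x → (x ~ x) ≡ false)
  (~-triangle : ∀ x y z → (x ~ y) ≡ true → (y ~ z) ≡ true → (x ~ z) ≡ true → ⊥) where
  open TriangleFree _~_ ~-sym ~-irrefl ~-triangle
  open Bounds _~_ ~-sym ~-irrefl ~-triangle
  open Gluing _~_ ~-sym ~-irrefl ~-triangle
  open Classification _~_ ~-sym ~-irrefl ~-triangle

  class-0-0 : Class 0 0 0 graphs-0-0
  class-0-0 {[]} len α e = [] , perm-refl , here refl

  none : ∀ {k n E L} → L ≡ [] → Class k n E L → NoGraph k n E
  none refl c len α e with c len α e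
  ... | _ , _ , ()

  exempt-sound : ∀ {k n E} n₀ E₀ → NoGraph k n₀ E₀ → (n ≡ᵇ n₀) ∧ (E ≡ᵇ E₀) ≡ true → NoGraph k n E
  exempt-sound {k} {n} {E} n₀ E₀ absent h with ∧-sound {n ≡ᵇ n₀} h
  ... | e , e′ = subst₂ (NoGraph k) (sym (≡ᵇ⇒≡ n n₀ (Equivalence.from T-≡ e))) (sym (≡ᵇ⇒≡ E E₀
      (Equivalence.from T-≡ e′))) absent

  minEdges-0 : MinEdges 0 t0
  minEdges-0 {[]} α = z≤n
  minEdges-0 {x ∷ xs} α with () ← α (x ∷ []) xs perm-refl ([] ∷ [])

  minEdges-1 : MinEdges 1 t1
  minEdges-1 = minEdges-step t0 3 minima-1 (λ _ _ → false) minEdges-0 (λ _ _ ()) refl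

  minEdges-2 : MinEdges 2 t2
  minEdges-2 = minEdges-step t1 6 minima-2 (λ _ _ → false) minEdges-1 (λ _ _ ()) refl

  minEdges-3 : MinEdges 3 t3
  minEdges-3 = minEdges-step t2 9 minima-3 (λ _ _ → false) minEdges-2 (λ _ _ ()) refl

  minEdges-4 : MinEdges 4 t4
  minEdges-4 = minEdges-step t3 14 minima-4 (λ _ _ → false) minEdges-3 (λ _ _ ()) refl

  class-2-1 : Class 1 2 1 graphs-2-1
  class-2-1 = classify-complete primes 0 2 1 t0 ((1 , graphs-0-0 ∷ []) ∷ []) [] 0 1 minEdges-0
      ((class-0-0 ∷ []) ∷ []) refl

  class-1-0 : Class 1 1 0 graphs-1-0
  class-1-0 = classify-complete primes 0 1 0 t0 ((0 , graphs-0-0 ∷ []) ∷ []) [] 0 1 minEdges-0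
      ((class-0-0 ∷ []) ∷ []) refl

  class-4-2 : Class 2 4 2 graphs-4-2
  class-4-2 = classify-complete primes 1 4 2 t1 ((1 , graphs-2-1 ∷ []) ∷ []) [] 0 1 minEdges-1
      ((class-2-1 ∷ []) ∷ []) refl

  class-4-3 : Class 2 4 3 graphs-4-3
  class-4-3 = classify-complete primes 1 4 3 t1 ((2 , graphs-1-0 ∷ []) ∷ []) [] 1 1 minEdges-1
      ((class-1-0 ∷ []) ∷ []) refl

  class-7-6 : Class 3 7 6 graphs-7-6
  class-7-6 = classify-complete primes 2 7 6 t2 ((2 , graphs-4-2 ∷ []) ∷ []) certs-7-6 1 1 minEdges-2
      ((class-4-2 ∷ []) ∷ []) refl

  class-7-7 : Class 3 7 7 graphs-7-7
  class-7-7 = classify-complete primes 2 7 7 t2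
      ((2 , graphs-4-2 ∷ graphs-4-3 ∷ []) ∷ []) certs-7-7 1 1 minEdges-2 ((class-4-2 ∷ class-4-3 ∷ []) ∷ []) refl

  class-11-15 : Class 4 11 15 graphs-11-15
  class-11-15 = classify-complete primes 3 11 15 t3 ((3 , graphs-7-6 ∷ []) ∷ []) certs-11-15 2 1 minEdges-3
      ((class-7-6 ∷ []) ∷ []) refl

  -- The chord has width 2: with two base classes listed at degree 3, d² + ψ(d) is 14, 17, 19 for d
  -- = 2, 3, 4, and the middle value lies above the chord through the outer ones. The same happens
  -- at degree 4 in `class-16-32`.
  class-11-16 : Class 4 11 16 graphs-11-16
  class-11-16 = classify-complete primes 3 11 16 t3
      ((3 , graphs-7-6 ∷ graphs-7-7 ∷ []) ∷ []) certs-11-16 2 2 minEdges-3 ((class-7-6 ∷ class-7-7 ∷ []) ∷ []) refl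

  class-12-20 : Class 4 12 20 graphs-12-20
  class-12-20 = classify-complete primes 3 12 20 t3 ((4 , graphs-7-6 ∷ []) ∷ []) certs-12-20 3 1 minEdges-3
      ((class-7-6 ∷ []) ∷ []) refl

  class-12-21 : Class 4 12 21 graphs-12-21
  class-12-21 = classify-complete primes 3 12 21 t3
      ((4 , graphs-7-6 ∷ graphs-7-7 ∷ []) ∷ []) certs-12-21 3 1 minEdges-3 ((class-7-6 ∷ class-7-7 ∷ []) ∷ []) refl

  class-16-31 : Class 5 16 31 graphs-16-31
  class-16-31 = classify-complete primes 4 16 31 t4 ((4 , graphs-11-15 ∷ []) ∷ []) [] 3 1 minEdges-4
      ((class-11-15 ∷ []) ∷ []) refl

  class-17-38 : Class 5 17 38 graphs-17-38
  class-17-38 = classify-complete primes 4 17 38 t4 ((4 , graphs-12-20 ∷ []) ∷ []) [] 4 1 minEdges-4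
      ((class-12-20 ∷ []) ∷ []) refl

  class-16-32 : Class 5 16 32 graphs-16-32
  class-16-32 = classify-complete primes 4 16 32 t4 ((4 , graphs-11-15 ∷ graphs-11-16 ∷ []) ∷
      (3 , graphs-12-20 ∷ []) ∷ []) certs-16-32 3 2 minEdges-4 ((class-11-15 ∷ class-11-16 ∷ []) ∷
          (class-12-20 ∷ []) ∷ []) refl

  class-16-33 : Class 5 16 33 graphs-16-33
  class-16-33 = classify-complete primes 4 16 33 t4 ((4 , graphs-11-15 ∷ graphs-11-16 ∷ []) ∷
      (3 , graphs-12-20 ∷ graphs-12-21 ∷ []) ∷ []) certs-16-33 3 1 minEdges-4
          ((class-11-15 ∷ class-11-16 ∷ []) ∷ (class-12-20 ∷ class-12-21 ∷ []) ∷ []) refl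

  minEdges-5 : MinEdges 5 t5
  minEdges-5 = minEdges-step t4 19 minima-5 exempt₅ minEdges-4 sound refl
    where
    sound : ∀ n E → exempt₅ n E ≡ true → NoGraph 5 n E
    sound n E h with ∨-sound {(n ≡ᵇ 16) ∧ (E ≡ᵇ 31)} h
    ... | inj₁ h′ = exempt-sound 16 31 (none graphs-16-31-none class-16-31) h′
    ... | inj₂ h′ = exempt-sound 17 38 (none graphs-17-38-none class-17-38) h′

  class-22-59 : Class 6 22 59 graphs-22-59
  class-22-59 = classify-complete primes 5 22 59 t5 ((5 , graphs-16-32 ∷ []) ∷ []) [] 4 1 minEdges-5
      ((class-16-32 ∷ []) ∷ []) refl

  class-23-68 : Class 6 23 68 graphs-23-68
  class-23-68 = classify-complete primes 5 23 68 t5 ((6 , graphs-16-32 ∷ []) ∷ []) [] 5 1 minEdges-5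
      ((class-16-32 ∷ []) ∷ []) refl

  class-23-69 : Class 6 23 69 graphs-23-69
  class-23-69 = classify-complete primes 5 23 69 t5
      ((6 , graphs-16-32 ∷ graphs-16-33 ∷ []) ∷ []) [] 5 1 minEdges-5 ((class-16-32 ∷ class-16-33 ∷ []) ∷ []) refl

  minEdges-6 : MinEdges 6 t6
  minEdges-6 = minEdges-step t5 23 minima-6 exempt₆ minEdges-5 sound refl
    where
    sound : ∀ n E → exempt₆ n E ≡ true → NoGraph 6 n E
    sound n E h with ∨-sound {(n ≡ᵇ 22) ∧ (E ≡ᵇ 59)} h
    ... | inj₁ h′ = exempt-sound 22 59 (none graphs-22-59-none class-22-59) h′
    ... | inj₂ h″ with ∨-sound {(n ≡ᵇ 23) ∧ (E ≡ᵇ 68)} h″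
    ...   | inj₁ h′ = exempt-sound 23 68 (none graphs-23-68-none class-23-68) h′
    ...   | inj₂ h′ = exempt-sound 23 69 (none graphs-23-69-none class-23-69) h′

  ramsey-7-23 : ∀ {xs} → 23 ≤ length xs → IndepBound xs 6 → ⊥
  ramsey-7-23 = noGraph-beyond {6} {t6} {23} {minima-6} minEdges-6 (λ _ → refl) (≤ᵇ⇒≤ (suc (23 * 6)) 800 _)

  -- Let A be the set of the vertices of degree 6; the other degrees are 7.  If a vertex x of A has j
  -- neighbours in A, then its nonneighbours span edges xs − (42 − j) ≥ 60 edges, whence 2j > |A|.  As A is
  -- nonempty by parity, it contains two adjacent vertices, which must have a common neighbour.
  ramsey-8-29 : ∀ {xs} → length xs ≡ 29 → IndepBound xs 7 → ⊥
  ramsey-8-29 {xs} len α = contradiction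
    where
    lowᵇ : V → Bool
    lowᵇ v = degree xs v ≡ᵇ 6
    A : List V
    A = keep lowᵇ xs

    far-few : ∀ {v} → v ∈ xs → 28 ∸ degree xs v < 23
    far-few {v} i with rest , p ← ∈-front i = ≰⇒> (λ le →
      ramsey-7-23 (subst (23 ≤_) (sym (length-far p len)) le) (indepBound-far p α))

    -- With five neighbours or fewer there would be at least 23 nonneighbours, too many for
    -- independence number 6.
    degree-67 : ∀ {v} → v ∈ xs → degree xs v ≡ 6 ⊎ degree xs v ≡ 7
    degree-67 {v} i = split (degree xs v) (far-few i) (degree-≤ v α)
      where
      split : ∀ d → 28 ∸ d < 23 → d ≤ 7 → d ≡ 6 ⊎ d ≡ 7
      split 6 _ _ = inj₁ refl
      split 7 _ _ = inj₂ refl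
      split 0 lt _ = ⊥-elim (<⇒≱ lt (≤ᵇ⇒≤ 23 28 _))
      split 1 lt _ = ⊥-elim (<⇒≱ lt (≤ᵇ⇒≤ 23 27 _))
      split 2 lt _ = ⊥-elim (<⇒≱ lt (≤ᵇ⇒≤ 23 26 _))
      split 3 lt _ = ⊥-elim (<⇒≱ lt (≤ᵇ⇒≤ 23 25 _))
      split 4 lt _ = ⊥-elim (<⇒≱ lt (≤ᵇ⇒≤ 23 24 _))
      split 5 lt _ = ⊥-elim (<⇒≱ lt (≤ᵇ⇒≤ 23 23 _))
      split (suc (suc (suc (suc (suc (suc (suc (suc d)))))))) _ le = ⊥-elim (<⇒≱ le (m≤m+n 7 d))

    seven : ∀ {v} → v ∈ xs → degree xs v + ⟦ lowᵇ v ⟧ ≡ 7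
    seven i with degree-67 i
    ... | inj₁ e rewrite e = refl
    ... | inj₂ e rewrite e = refl

    ∑-seven : ∀ ys → (∀ {v} → v ∈ ys → v ∈ xs) → ∑ (degree xs) ys + ∑ (λ v → ⟦ lowᵇ v ⟧) ys ≡ length ys * 7
    ∑-seven ys sub = trans (sym (∑-+ (degree xs) _ ys)) (trans (∑-cong ys (seven ∘ sub)) (∑-const 7 ys))

    edges-A : 2 * edges xs + length A ≡ 203
    edges-A = trans (cong₂ _+_ (sym (handshake xs)) (sym (∑-length-keep lowᵇ xs)))
      (subst (λ n → ∑ (degree xs) xs + ∑ (λ v → ⟦ lowᵇ v ⟧) xs ≡ n * 7) len (∑-seven xs (λ i → i)))

    degree-A : ∀ {x} → x ∈ A → suc (length A) ≤ 2 * degree A x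
    degree-A {x} i with j , low ← keep-⊆ lowᵇ xs i with rest , p ← ∈-front j = +-cancelˡ-≤ (2 * edges xs) _ _ (begin
      2 * edges xs + suc (length A)                 ≡⟨ trans (+-suc (2 * edges xs) (length A)) (cong suc edges-A) ⟩
      2 * (60 + 42)                                 ≤⟨ *-monoʳ-≤ 2 (+-monoˡ-≤ 42 sixty) ⟩
      2 * (edges (far xs x) + 42)                   ≡⟨ cong (λ z → 2 * (edges (far xs x) + z)) forty-two ⟨
      2 * (edges (far xs x) + (∑ (degree xs) (near xs x) + degree A x))
                                                    ≡⟨ shuffle (edges (far xs x)) _ (degree A x) ⟩
      2 * (edges (far xs x) + ∑ (degree xs) (near xs x)) + 2 * degree A x
                                                    ≡⟨ cong (λ e → 2 * e + 2 * degree A x) (edges-split xs x) ⟨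
      2 * edges xs + 2 * degree A x                 ∎)
      where
      open ≤-Reasoning
      shuffle : ∀ e z a → 2 * (e + (z + a)) ≡ 2 * (e + z) + 2 * a
      shuffle = solve-∀
      six : degree xs x ≡ 6
      six = ≡ᵇ⇒≡ _ 6 (Equivalence.from T-≡ low)
      sixty : 60 ≤ edges (far xs x)
      sixty = subst (_≤ edges (far xs x)) (cong₂ (λ n d → t6 (n ∸ suc d)) len six) (edges-far-min {6} {t6} minEdges-6 α j)
      lows : ∑ (λ v → ⟦ lowᵇ v ⟧) (near xs x) ≡ degree A x
      lows = begin-equality
        ∑ (λ v → ⟦ lowᵇ v ⟧) (near xs x)            ≡⟨ ∑-keep (x ~_) _ xs ⟨
        ∑ (λ v → ⟦ x ~ v ⟧ * ⟦ lowᵇ v ⟧) xs         ≡⟨ ∑-cong xs (λ {v} _ → *-comm ⟦ x ~ v ⟧ ⟦ lowᵇ v ⟧) ⟩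
        ∑ (λ v → ⟦ lowᵇ v ⟧ * ⟦ x ~ v ⟧) xs         ≡⟨ ∑-keep lowᵇ _ xs ⟩
        degree A x                                  ∎
      forty-two : ∑ (degree xs) (near xs x) + degree A x ≡ 42
      forty-two = trans (cong (∑ (degree xs) (near xs x) +_) (sym lows))
        (subst (λ n → ∑ (degree xs) (near xs x) + ∑ (λ v → ⟦ lowᵇ v ⟧) (near xs x) ≡ n * 7)
          (trans (sym (degree-near xs x)) six) (∑-seven (near xs x) (λ k → proj₁ (keep-⊆ (x ~_) xs k))))

    adjacent-A : ∀ {x y} → (x ~ y) ≡ true → degree A x + degree A y ≤ length A
    adjacent-A {x} {y} xy = begin
      degree A x + degree A y                       ≡⟨ ∑-+ _ _ A ⟨
      ∑ (λ u → ⟦ x ~ u ⟧ + ⟦ y ~ u ⟧) A             ≤⟨ ∑-mono A (λ {u} _ → exclusive u) ⟩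
      ∑ (λ _ → 1) A                                 ≡⟨ trans (∑-const 1 A) (*-identityʳ _) ⟩
      length A                                      ∎
      where
      open ≤-Reasoning
      exclusive : ∀ u → ⟦ x ~ u ⟧ + ⟦ y ~ u ⟧ ≤ 1
      exclusive u with x ~ u in xu | y ~ u in yu
      ... | true | true = ⊥-elim (~-triangle x y u xy yu xu)
      ... | true | false = ≤-refl
      ... | false | true = ≤-refl
      ... | false | false = z≤n

    contradiction : ⊥
    contradiction with A in eqA
    ... | [] = even≢odd (edges xs) 101 (trans (sym (+-identityʳ _)) (subst (λ l
        → 2 * edges xs + length l ≡ 203) eqA edges-A))
    ... | x ∷ _ with near A x in eqN
    ...   | [] = <⇒≱ (degree-A x∈A) (subst (λ n → 2 * n ≤ length A) (sym (trans (degree-near A x) (cong length eqN))) z≤n)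
      where
      x∈A : x ∈ A
      x∈A = subst (x ∈_) (sym eqA) (here refl)
    ...   | y ∷ _ with y∈A , xy ← keep-⊆ (x ~_) A (subst (y ∈_) (sym eqN) (here refl)) =
      <⇒≱ (begin-strict
        2 * length A                                ≡⟨ cong (length A +_) (+-identityʳ _) ⟩
        length A + length A                         <⟨ +-mono-< (degree-A x∈A) (degree-A y∈A) ⟩
        2 * degree A x + 2 * degree A y             ≡⟨ *-distribˡ-+ 2 (degree A x) _ ⟨
        2 * (degree A x + degree A y)               ∎)
        (*-monoʳ-≤ 2 (adjacent-A xy))
      where
      open ≤-Reasoning
      x∈A : x ∈ A
      x∈A = subst (x ∈_) (sym eqA) (here refl)

  minEdges-7 : MinEdges 7 t7
  minEdges-7 = minEdges-step t6 29 minima-7 exempt₇ minEdges-6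
    (λ n E h len α _ → ramsey-8-29 (trans len (≡ᵇ⇒≡ n 29 (Equivalence.from T-≡ h))) α) refl

  minEdges-8 : MinEdges 8 t8
  minEdges-8 = minEdges-step t7 37 minima-8 (λ _ _ → false) minEdges-7 (λ _ _ ()) refl

  ramsey : ∀ k r ys {t} → MinEdges k t → (∀ n → t n ≡ table r ys n) → r * k < 800 →
    ∀ {xs} → r ≤ length xs → ¬ IndepBound xs k
  ramsey k r ys T eq lt = noGraph-beyond {k} {_} {r} {ys} T eq lt

  ramsey-bound : ∀ k → k ≤ 8 → ∀ {xs} → ramseyNumber k ≤ length xs → ¬ IndepBound xs k
  ramsey-bound 0 _ = ramsey 0 1 minima-0 minEdges-0 (λ _ → refl) (≤ᵇ⇒≤ _ _ _)
  ramsey-bound 1 _ = ramsey 1 3 minima-1 minEdges-1 (λ _ → refl) (≤ᵇ⇒≤ _ _ _)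
  ramsey-bound 2 _ = ramsey 2 6 minima-2 minEdges-2 (λ _ → refl) (≤ᵇ⇒≤ _ _ _)
  ramsey-bound 3 _ = ramsey 3 9 minima-3 minEdges-3 (λ _ → refl) (≤ᵇ⇒≤ _ _ _)
  ramsey-bound 4 _ = ramsey 4 14 minima-4 minEdges-4 (λ _ → refl) (≤ᵇ⇒≤ _ _ _)
  ramsey-bound 5 _ = ramsey 5 19 minima-5 minEdges-5 (λ _ → refl) (≤ᵇ⇒≤ _ _ _)
  ramsey-bound 6 _ = ramsey 6 23 minima-6 minEdges-6 (λ _ → refl) (≤ᵇ⇒≤ _ _ _)
  ramsey-bound 7 _ = ramsey 7 29 minima-7 minEdges-7 (λ _ → refl) (≤ᵇ⇒≤ _ _ _)
  ramsey-bound 8 _ = ramsey 8 37 minima-8 minEdges-8 (λ _ → refl) (≤ᵇ⇒≤ _ _ _)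
  ramsey-bound (suc (suc (suc (suc (suc (suc (suc (suc (suc k))))))))) le = ⊥-elim (<⇒≱ le (m≤m+n 8 k))

-- Matchings

¬¬-em : ∀ {P : Set} → ¬ ¬ (P ⊎ ¬ P)
¬¬-em k = k (inj₂ (λ p → k (inj₁ p)))

¬¬-max : ∀ {A : Set} (μ : A → ℕ) b → (∀ x → μ x ≤ b) → A → ¬ ¬ (∃ λ x → ∀ y → μ y ≤ μ x)
¬¬-max {A} μ b bounded x₀ k = climb b x₀ (m∸n≤m b (μ x₀))
  where
  climb : ∀ fuel x → b ∸ μ x ≤ fuel → ⊥
  climb fuel x le = k (x , λ y → ≮⇒≥ (λ lt → higher fuel le y lt))
    where
    higher : ∀ fuel → b ∸ μ x ≤ fuel → ∀ y → μ x < μ y → ⊥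
    higher zero le y lt = <⇒≱ lt (≤-trans (bounded y) (m∸n≡0⇒m≤n (n≤0⇒n≡0 le)))
    higher (suc fuel) le y lt = climb fuel y (s≤s⁻¹ (≤-trans (∸-monoʳ-< lt (bounded y)) le))

¬¬-partition : ∀ {A : Set} (P : A → Set) xs →
  ¬ ¬ (∃₂ λ ys zs → xs ↭ ys ++ zs × All P ys × All (¬_ ∘ P) zs)
¬¬-partition P [] k = k ([] , [] , perm-refl , [] , [])
¬¬-partition P (x ∷ xs) k = ¬¬-partition P xs λ { (ys , zs , p , py , nz) → ¬¬-em λ
  { (inj₁ px) → k (x ∷ ys , zs , prep x p , px ∷ py , nz)
  ; (inj₂ ¬px) → k (ys , x ∷ zs , perm-trans (prep x p) (↭-sym (shift x ys zs)) , py , ¬px ∷ nz) } }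

unique-↭ : ∀ {A : Set} {xs ys : List A} → xs ↭ ys → Unique xs → Unique ys
unique-↭ = AllPairs-↭ (λ ne → ne ∘ sym)

unique-++ : ∀ {A : Set} (xs : List A) {ys x y} → Unique (xs ++ ys) → x ∈ xs → y ∈ ys → x ≢ y
unique-++ (z ∷ xs) (ne ∷ u) (here refl) j = All.lookup ne (∈-++⁺ʳ xs j)
unique-++ (z ∷ xs) (ne ∷ u) (there i) j = unique-++ xs u i j

unique-++ˡ : ∀ {A : Set} (xs : List A) {ys} → Unique (xs ++ ys) → Unique xs
unique-++ˡ [] u = []
unique-++ˡ (x ∷ xs) (ne ∷ u) = All.++⁻ˡ xs ne ∷ unique-++ˡ xs u

unique-++ʳ : ∀ {A : Set} (xs : List A) {ys} → Unique (xs ++ ys) → Unique ys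
unique-++ʳ [] u = u
unique-++ʳ (x ∷ xs) (ne ∷ u) = unique-++ʳ xs u

unique-length : ∀ {A : Set} (xs : List A) {ys} → Unique xs → (∀ {x} → x ∈ xs → x ∈ ys) → length xs ≤ length ys
unique-length [] u sub = z≤n
unique-length (x ∷ xs) (ne ∷ u) sub with rest , p ← ∈-front (sub (here refl)) =
  subst (suc (length xs) ≤_) (sym (↭-length p)) (s≤s (unique-length xs u
    (λ {y} i → case ∈-resp-↭ p (sub (there i)) of λ
      { (here refl) → ⊥-elim (All.lookup ne i refl)
      ; (there j) → j })))

module Matchings {V : Set} (_≟_ : DecidableEquality V) (_~_ : V → V → Bool)
  (~-sym : ∀ x y → (x ~ y) ≡ (y ~ x)) (~-irrefl : ∀ x → (x ~ x) ≡ false) where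
  open DecMembership _≟_ using (_∈?_)

  flat : List (V × V) → List V
  flat [] = []
  flat ((a , b) ∷ ps) = a ∷ b ∷ flat ps

  flat-++ : ∀ ps qs → flat (ps ++ qs) ≡ flat ps ++ flat qs
  flat-++ [] qs = refl
  flat-++ (p ∷ ps) qs = cong (λ xs → _ ∷ _ ∷ xs) (flat-++ ps qs)

  length-flat : ∀ ps → length (flat ps) ≡ 2 * length ps
  length-flat [] = refl
  length-flat (p ∷ ps) rewrite length-flat ps = sym (*-suc 2 (length ps))

  Edge : V × V → Set
  Edge (a , b) = (a ~ b) ≡ true

  edge-≢ : ∀ {a b} → (a ~ b) ≡ true → a ≢ b
  edge-≢ {a} e refl with () ← trans (sym e) (~-irrefl a)

  record Matching (xs : List V) : Set where
    field
      pairs : List (V × V)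
      exposed : List V
      perm : xs ↭ flat pairs ++ exposed
      edge : All Edge pairs
  open Matching public

  order : ∀ {xs} → Matching xs → ℕ
  order M = length (pairs M)

  length-matching : ∀ {xs} (M : Matching xs) → length xs ≡ 2 * order M + length (exposed M)
  length-matching M = trans (↭-length (perm M)) (trans (length-++ (flat (pairs M))) (cong (_+ length
      (exposed M)) (length-flat (pairs M))))

  order-≤ : ∀ {xs} (M : Matching xs) → order M ≤ length xs
  order-≤ M = subst (order M ≤_) (sym (length-matching M)) (≤-trans (m≤m+n _ _) (m≤m+n (2 * order M) _))

  empty : ∀ xs → Matching xs
  empty xs = record { pairs = [] ; exposed = xs ; perm = perm-refl ; edge = [] }

  augment : ∀ {xs} (M : Matching xs) {a b} → a ∈ exposed M → b ∈ exposed M → (a ~ b) ≡ true →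
            ∃ λ (M′ : Matching xs) → order M′ ≡ suc (order M)
  augment M {a} {b} i j e with us , p ← ∈-front i with ∈-resp-↭ p j
  ... | here refl = ⊥-elim (edge-≢ e refl)
  ... | there k with vs , q ← ∈-front k = record
    { pairs = (a , b) ∷ pairs M ; exposed = vs
    ; perm = perm-trans (perm M) (perm-trans (++⁺ˡ (flat (pairs M)) (perm-trans p (prep a q)))
               (perm-trans (shift a (flat (pairs M)) (b ∷ vs)) (prep a (shift b (flat (pairs M)) vs))))
    ; edge = e ∷ edge M } , refl

  data Partner (x y : V) : List (V × V) → Set where
    left : ∀ {ps} → Partner x y ((x , y) ∷ ps)
    right : ∀ {ps} → Partner x y ((y , x) ∷ ps)
    skip : ∀ {p ps} → Partner x y ps → Partner x y (p ∷ ps)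

  partner? : ∀ x y ps → Dec (Partner x y ps)
  partner? x y [] = no λ ()
  partner? x y ((a , b) ∷ ps) with x ≟ a | y ≟ b | x ≟ b | y ≟ a | partner? x y ps
  ... | yes refl | yes refl | _ | _ | _ = yes left
  ... | _ | _ | yes refl | yes refl | _ = yes right
  ... | _ | _ | _ | _ | yes p = yes (skip p)
  ... | no x≢a | _ | no x≢b | _ | no ¬p = no λ { left → x≢a refl ; right → x≢b refl ; (skip p) → ¬p p }
  ... | no x≢a | _ | yes _ | no y≢a | no ¬p = no λ { left → x≢a refl ; right → y≢a refl ; (skip p) → ¬p p }
  ... | yes _ | no y≢b | no x≢b | _ | no ¬p = no λ { left → y≢b refl ; right → x≢b refl ; (skip p) → ¬p p }
  ... | yes _ | no y≢b | yes _ | no y≢a | no ¬p = no λ { left → y≢b refl ; right → y≢a refl ; (skip p) → ¬p p }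

  partner-sym : ∀ {x y ps} → Partner x y ps → Partner y x ps
  partner-sym left = right
  partner-sym right = left
  partner-sym (skip p) = skip (partner-sym p)

  partner-∈ : ∀ {x y ps} → Partner x y ps → x ∈ flat ps
  partner-∈ left = here refl
  partner-∈ right = there (here refl)
  partner-∈ (skip p) = there (there (partner-∈ p))

  partner : ∀ {x} ps → x ∈ flat ps → ∃ λ y → Partner x y ps
  partner ((a , b) ∷ ps) (here refl) = b , left
  partner ((a , b) ∷ ps) (there (here refl)) = a , right
  partner ((a , b) ∷ ps) (there (there i)) with y , p ← partner ps i = y , skip p

  partner-unique : ∀ {x y z ps} → Unique (flat ps) → Partner x y ps → Partner x z ps → y ≡ z
  partner-unique u left left = refl
  partner-unique u right right = refl
  partner-unique ((ne ∷ _) ∷ _) left right = refl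
  partner-unique ((ne ∷ _) ∷ _) right left = refl
  partner-unique ((_ ∷ ne) ∷ _) left (skip q) = ⊥-elim (All.lookup ne (partner-∈ q) refl)
  partner-unique (_ ∷ ne ∷ _) right (skip q) = ⊥-elim (All.lookup ne (partner-∈ q) refl)
  partner-unique ((_ ∷ ne) ∷ _) (skip p) left = ⊥-elim (All.lookup ne (partner-∈ p) refl)
  partner-unique (_ ∷ ne ∷ _) (skip p) right = ⊥-elim (All.lookup ne (partner-∈ p) refl)
  partner-unique (_ ∷ _ ∷ u) (skip p) (skip q) = partner-unique u p q

  partner-edge : ∀ {x y ps} → All Edge ps → Partner x y ps → (x ~ y) ≡ true
  partner-edge (e ∷ _) left = e
  partner-edge {x} {y} (e ∷ _) right = trans (~-sym x y) e
  partner-edge (_ ∷ es) (skip p) = partner-edge es p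

  remove : ∀ {x y ps} → Partner x y ps → List (V × V)
  remove (left {ps}) = ps
  remove (right {ps}) = ps
  remove (skip {p} q) = p ∷ remove q

  remove-flat : ∀ {x y ps} (p : Partner x y ps) → flat ps ↭ x ∷ y ∷ flat (remove p)
  remove-flat left = perm-refl
  remove-flat right = swap _ _ perm-refl
  remove-flat (skip {a , b} p) = perm-trans (prep a (prep b (remove-flat p)))
    (perm-trans (↭-shift² a b) perm-refl)
    where
    ↭-shift² : ∀ a b {x y zs} → a ∷ b ∷ x ∷ y ∷ zs ↭ x ∷ y ∷ a ∷ b ∷ zs
    ↭-shift² a b {x} {y} {zs} = perm-trans (++⁺ʳ zs (++-comm (a ∷ b ∷ []) (x ∷ y ∷ []))) perm-refl

  remove-length : ∀ {x y ps} (p : Partner x y ps) → length ps ≡ suc (length (remove p))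
  remove-length left = refl
  remove-length right = refl
  remove-length (skip p) = cong suc (remove-length p)

  remove-edge : ∀ {x y ps} (p : Partner x y ps) → All Edge ps → All Edge (remove p)
  remove-edge left (_ ∷ es) = es
  remove-edge right (_ ∷ es) = es
  remove-edge (skip p) (e ∷ es) = e ∷ remove-edge p es

  remove-∑ : ∀ f → (∀ a b → f (a , b) ≡ f (b , a)) → ∀ {x y ps} (p : Partner x y ps) →
             ∑ f ps ≡ f (x , y) + ∑ f (remove p)
  remove-∑ f s left = refl
  remove-∑ f s {x} {y} (right {ps}) = cong (_+ ∑ f ps) (s y x)
  remove-∑ f s {x} {y} (skip {q} p) rewrite remove-∑ f s p = exchange (f q) (f (x , y)) _
    where
    exchange : ∀ a b c → a + (b + c) ≡ b + (a + c)
    exchange = solve-∀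

  module Gallai (xs : List V) (xs-unique : Unique xs) (ν : ℕ) (bound : ∀ (M : Matching xs) → order M ≤ ν) where

    Optimal : Matching xs → Set
    Optimal M = ν ≤ order M

    _≈_ : V → V → Set
    x ≈ y = ∀ M → Optimal M → x ∈ exposed M → y ∈ exposed M → x ≡ y

    -- A maximum matching that exposes both ends of an edge could be enlarged by it.
    adjacent-≈ : ∀ {x y} → (x ~ y) ≡ true → x ≈ y
    adjacent-≈ e M opt i j with M′ , len ← augment M i j e =
      ⊥-elim (<⇒≱ (subst (ν <_) (sym len) (s≤s opt)) (bound M′))

    parts-unique : ∀ M → Unique (flat (pairs M) ++ exposed M)
    parts-unique M = unique-↭ (perm M) xs-unique

    locate : ∀ M {x} → x ∈ xs → x ∈ flat (pairs M) ⊎ x ∈ exposed M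
    locate M i = ∈-++⁻ (flat (pairs M)) (∈-resp-↭ (perm M) i)

    exposed-⊆ : ∀ M {x} → x ∈ exposed M → x ∈ xs
    exposed-⊆ M i = ∈-resp-↭ (↭-sym (perm M)) (∈-++⁺ʳ (flat (pairs M)) i)

    exposed-length : ∀ M N → Optimal M → Optimal N → length (exposed M) ≡ length (exposed N)
    exposed-length M N oM oN = +-cancelˡ-≡ (2 * ν) _ _ (trans (count M oM) (sym (count N oN)))
      where
      count : ∀ M → Optimal M → 2 * ν + length (exposed M) ≡ length xs
      count M o = trans (cong (λ m → 2 * m + length (exposed M)) (≤-antisym o (bound M))) (sym (length-matching M))

    -- If M exposes u and v but neither exposes t, take N exposing t with the most edges in common with M.
    -- Some x ≠ t is exposed by N but not by M; its edge xy of M can replace the edge of N at y.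
    ≈-trans : ∀ {u t v} N → Optimal N → t ∈ exposed N → u ≈ t → t ≈ v → u ≈ v
    ≈-trans {u} {t} {v} N₀ oN₀ tN₀ ut tv M oM uM vM with u ≟ v
    ... | yes u≡v = u≡v
    ... | no u≢v = ⊥-elim (¬¬-max μ (length xs) μ-bounded (N₀ , oN₀ , tN₀) λ { (N , best) → improve N best })
      where
      tM : ¬ t ∈ exposed M
      tM i = u≢v (trans (ut M oM uM i) (tv M oM i vM))

      Candidate : Set
      Candidate = ∃ λ (N : Matching xs) → Optimal N × t ∈ exposed N

      inM : V × V → ℕ
      inM (a , b) = ⟦ does (partner? a b (pairs M)) ⟧

      inM-sym : ∀ a b → inM (a , b) ≡ inM (b , a)
      inM-sym a b with partner? a b (pairs M)
      ... | yes p rewrite dec-true (partner? b a (pairs M)) (partner-sym p) = refl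
      ... | no ¬p rewrite dec-false (partner? b a (pairs M)) (¬p ∘ partner-sym) = refl

      inM-≤ : ∀ p → inM p ≤ 1
      inM-≤ (a , b) with does (partner? a b (pairs M))
      ... | true = ≤-refl
      ... | false = z≤n

      μ : Candidate → ℕ
      μ (N , _) = ∑ inM (pairs N)

      μ-bounded : ∀ N → μ N ≤ length xs
      μ-bounded (N , _) = ≤-trans (∑-mono (pairs N) (λ {p} _ → inM-≤ p))
        (≤-trans (≤-reflexive (trans (∑-const 1 (pairs N)) (*-identityʳ _))) (order-≤ N))

      improve : ∀ N → (∀ N′ → μ N′ ≤ μ N) → ⊥
      improve (N , oN , tN) best = found (Any.any? (λ x → ¬? (x ∈? exposed M) ×-dec ¬? (x ≟ t)) (exposed N))
        where
        uN : ¬ u ∈ exposed N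
        uN i with refl ← ut N oN i tN = tM uM
        vN : ¬ v ∈ exposed N
        vN i with refl ← tv N oN tN i = tM vM

        found : Dec (Any.Any (λ x → ¬ x ∈ exposed M × x ≢ t) (exposed N)) → ⊥
        -- Without such an x, the vertices other than t exposed by N would be among those other than
        -- u and v exposed by M. Then N would expose fewer vertices than M, although both are
        -- maximum matchings.
        found (no none) with us , p ← ∈-front tN | vs , q ← ∈-front uM with ∈-resp-↭ q vM
        ... | here v≡u = u≢v (sym v≡u)
        ... | there vv with ws , r ← ∈-front vv = <⇒≱ fewer (≤-reflexive (exposed-length M N oM oN))
          where
          us-unique : All (t ≢_) us × Unique us
          us-unique with ne ∷ un ← unique-↭ p (unique-++ʳ (flat (pairs N)) (parts-unique N)) = ne , un
          sub : ∀ {x} → x ∈ us → x ∈ ws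
          sub {x} i with x ∈? exposed M
          ... | no x∉M = ⊥-elim (none (lose {P = λ x → ¬ x ∈ exposed M × x ≢ t} (∈-resp-↭ (↭-sym p) (there i))
                          (x∉M , λ x≡t → All.lookup (proj₁ us-unique) i (sym x≡t))))
          ... | yes x∈M with ∈-resp-↭ (perm-trans q (prep u r)) x∈M
          ...   | here refl = ⊥-elim (uN (∈-resp-↭ (↭-sym p) (there i)))
          ...   | there (here refl) = ⊥-elim (vN (∈-resp-↭ (↭-sym p) (there i)))
          ...   | there (there j) = j
          fewer : length (exposed N) < length (exposed M)
          fewer = subst₂ _<_ (sym (↭-length p)) (sym (↭-length (perm-trans q (prep u r))))
            (s≤s (s≤s (unique-length us (proj₂ us-unique) sub)))
        found (yes some) with x , xN , xM , x≢t ← find some with locate M (exposed-⊆ N xN)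
        ... | inj₂ i = xM i
        ... | inj₁ i with y , xy ← partner (pairs M) i
                     with locate N (∈-resp-↭ (↭-sym (perm M)) (∈-++⁺ˡ (partner-∈ (partner-sym xy))))
        ...   | inj₂ yN with M′ , len ← augment N xN yN (partner-edge (edge M) xy) =
          <⇒≱ (subst (ν <_) (sym len) (s≤s oN)) (bound M′)
        ...   | inj₁ j with z , yz ← partner (pairs N) j | us , p ← ∈-front xN =
          <⇒≱ more (best (N′ , subst (ν ≤_) (remove-length yz) oN , there t∈us))
          where
          N′ : Matching xs
          N′ = record
            { pairs = (x , y) ∷ remove yz ; exposed = z ∷ us
            ; perm = perm-trans (perm N) (perm-trans (++⁺ (remove-flat yz) p) (rearrange y z x (flat (remove yz)) us))
            ; edge = partner-edge (edge M) xy ∷ remove-edge yz (edge N) }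
            where
            rearrange : ∀ y z x as bs → (y ∷ z ∷ as) ++ x ∷ bs ↭ (x ∷ y ∷ as) ++ z ∷ bs
            rearrange y z x as bs = perm-trans (shift x (y ∷ z ∷ as) bs)
              (prep x (prep y (↭-sym (shift z as bs))))
          t∈us : t ∈ us
          t∈us with ∈-resp-↭ p tN
          ... | here t≡x = ⊥-elim (x≢t (sym t≡x))
          ... | there k = k
          -- The partner of y in M is x, and x ≠ z as N exposes x but covers z. So the exchange
          -- loses no edge of M and gains xy.
          yz∉M : ¬ Partner y z (pairs M)
          yz∉M q = unique-++ (flat (pairs N)) (parts-unique N) (partner-∈ (partner-sym yz)) xN
            (sym (partner-unique (unique-++ˡ (flat (pairs M)) (parts-unique M)) (partner-sym xy) q))
          more : μ (N , oN , tN) < ∑ inM ((x , y) ∷ remove yz)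
          more = subst₂ _<_ (sym (trans (remove-∑ inM inM-sym yz) (cong (λ b → ⟦ b ⟧ + ∑ inM (remove yz))
              (dec-false (partner? y z (pairs M)) yz∉M))))
            (cong (λ b → ⟦ b ⟧ + ∑ inM (remove yz)) (sym (dec-true (partner? x y (pairs M)) xy))) ≤-refl

-- The function `gap`, and matchings against independent sets in triangle-free graphs

-- The least possible value of n − χ for a graph with n vertices, chromatic number χ and clique number
-- χ − s; only s ≤ 11 matters.
gap : ℕ → ℕ
gap 0 = 0
gap 1 = 2
gap 2 = 4
gap 3 = 6
gap 4 = 8
gap 5 = 10
gap 6 = 12
gap 7 = 13
gap 8 = 15
gap 9 = 16
gap 10 = 17
gap _ = 19

-- `gap (12 + s)` reduces to 19, so that monotonicity and subadditivity become finite checks.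
data Capped : ℕ → Set where
  low : ∀ {s} → s < 12 → Capped s
  high : ∀ s → Capped (12 + s)

capped : ∀ s → Capped s
capped s with s <? 12
... | yes lt = low lt
... | no ge = subst Capped (m+[n∸m]≡n (≮⇒≥ ge)) (high (s ∸ 12))

gap-≤19 : ∀ s → gap s ≤ 19
gap-≤19 s with capped s
... | low lt = ≤ᵇ-sound (allBelow-sound (λ s → gap s ≤ᵇ 19) 12 refl lt)
... | high _ = ≤-refl

gap-suc : ∀ s → gap s ≤ gap (suc s)
gap-suc s with capped s
... | low lt = ≤ᵇ-sound (allBelow-sound (λ s → gap s ≤ᵇ gap (suc s)) 12 refl lt)
... | high _ = ≤-refl

gap-mono : ∀ {s t} → s ≤ t → gap s ≤ gap t
gap-mono {s} le = subst (λ t → gap s ≤ gap t) (m+[n∸m]≡n le) (grow (_ ∸ s))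
  where
  grow : ∀ d → gap s ≤ gap (s + d)
  grow zero = ≤-reflexive (cong gap (sym (+-identityʳ s)))
  grow (suc d) = ≤-trans (grow d) (subst (λ t → gap (s + d) ≤ gap t) (sym (+-suc s d)) (gap-suc (s + d)))

-- When the complement splits into two parts, both n - χ and χ - ω add up. The case of one summand
-- equal to 1 pays for an independent triple, as `gap 1` is 2.
gap-subadditive : ∀ s t → gap (s + t) ≤ gap s + gap t
gap-subadditive s t with capped s | capped t
... | high _ | _ = ≤-trans (gap-≤19 (s + t)) (m≤m+n 19 (gap t))
... | low _ | high _ = ≤-trans (gap-≤19 (s + t)) (m≤n+m 19 (gap s))
... | low ls | low lt = ≤ᵇ-sound (allBelow-sound (λ t → gap (s + t) ≤ᵇ gap s + gap t) 12
  (allBelow-sound (λ s → allBelow (λ t → gap (s + t) ≤ᵇ gap s + gap t) 12) 12 refl ls) lt)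

-- With 2ν ≤ n ≤ 2ν + 1 vertices there is an independent set of this size in a triangle-free graph.
guaranteed : ℕ → ℕ
guaranteed n =
  if n <ᵇ 1 then 0 else if n <ᵇ 3 then 1 else if n <ᵇ 6 then 2 else if n <ᵇ 9 then 3 else if n <ᵇ 14 then 4
  else if n <ᵇ 19 then 5 else if n <ᵇ 23 then 6 else if n <ᵇ 29 then 7 else if n <ᵇ 37 then 8 else 9

guaranteedᵇ : ℕ → Bool
guaranteedᵇ n = (guaranteed n ≡ᵇ 0) ∨ (ramseyNumber (guaranteed n ∸ 1) ≤ᵇ n) ∧ (guaranteed n ≤ᵇ 9)

-- With a matching of size ν in the complement, n - ν is a number of colours and `guaranteed n` the
-- size of a clique, so the test reads gap(χ - ω) ≤ n - χ. It is run for ν < 19 only, because `gap`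
-- never exceeds 19.
sufficientᵇ : ℕ → ℕ → Bool
sufficientᵇ n ν = guaranteedᵇ n ∧ (gap (n ∸ ν ∸ guaranteed n) ≤ᵇ ν)

sufficient : ∀ {ν} → ν < 19 → sufficientᵇ (2 * ν) ν ∧ sufficientᵇ (1 + 2 * ν) ν ≡ true
sufficient = allBelow-sound (λ ν → sufficientᵇ (2 * ν) ν ∧ sufficientᵇ (1 + 2 * ν) ν) 19 refl

∸-+-≤ : ∀ a b c d → (a + b) ∸ (c + d) ≤ (a ∸ c) + (b ∸ d)
∸-+-≤ a b c d = m≤n+o⇒m∸n≤o (a + b) (c + d) (begin
  a + b                         ≤⟨ +-mono-≤ (m≤n+m∸n a c) (m≤n+m∸n b d) ⟩
  c + (a ∸ c) + (d + (b ∸ d))   ≡⟨ interchange c (a ∸ c) d (b ∸ d) ⟩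
  c + d + (a ∸ c + (b ∸ d))     ∎)
  where
  open ≤-Reasoning
  interchange : ∀ a b c d → a + b + (c + d) ≡ a + c + (b + d)
  interchange = solve-∀

module Deficiency {V : Set} (_≟_ : DecidableEquality V) (_~_ : V → V → Bool)
  (~-sym : ∀ x y → (x ~ y) ≡ (y ~ x)) (~-irrefl : ∀ x → (x ~ x) ≡ false) where
  open Matchings _≟_ _~_ ~-sym ~-irrefl

  Indep : List V → Set
  Indep = AllPairs (λ x y → (x ~ y) ≡ false)

  NoTriangle : List V → Set
  NoTriangle xs = ∀ {x y z} → x ∈ xs → y ∈ xs → z ∈ xs → (x ~ y) ≡ true → (y ~ z) ≡ true → (x ~ z) ≡ true → ⊥

  IndepSet : List V → Set
  IndepSet xs = ∃₂ λ ys zs → xs ↭ ys ++ zs × Indep ys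

  order-indep : ∀ {xs} → IndepSet xs → ℕ
  order-indep (ys , _) = length ys

  -- The Ramsey bounds presuppose a relation without triangles on its whole type, but here triangles
  -- are excluded only within `xs`. They are therefore applied to the positions in `xs`.
  large-indep : ∀ k → k ≤ 8 → ∀ {xs} → NoTriangle xs → ramseyNumber k ≤ length xs →
    ¬ ¬ (∃ λ (I : IndepSet xs) → k < order-indep I)
  large-indep k k≤8 {xs} noTriangle le none =
    ramsey-bound k k≤8 {allFin (length xs)} (subst (ramseyNumber k ≤_) (sym (length-tabulate _)) le) bounded
    where
    v : Fin (length xs) → V
    v = lookup xs
    open TriangleFree (λ i j → v i ~ v j) (λ i j → ~-sym (v i) (v j)) (λ i → ~-irrefl (v i))
      (λ i j l → noTriangle (∈-lookup i) (∈-lookup j) (∈-lookup l)) using (IndepBound)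
    open Ramsey (λ i j → v i ~ v j) (λ i j → ~-sym (v i) (v j)) (λ i → ~-irrefl (v i))
      (λ i j l → noTriangle (∈-lookup i) (∈-lookup j) (∈-lookup l)) using (ramsey-bound)
    image : map v (allFin (length xs)) ≡ xs
    image = trans (map-tabulate _ v) (tabulate-lookup xs)
    bounded : IndepBound (allFin (length xs)) k
    bounded ys zs p ind = ≮⇒≥ λ lt → none
      ((map v ys , map v zs , perm-trans (↭-reflexive (sym image)) (perm-trans (map⁺ v p) (↭-reflexive
          (map-++ v ys zs))) , AllPairs.map⁺ ind)
      , subst (k <_) (sym (length-map v ys)) lt)

  -- This is gap(χ - ω) ≤ n - χ for the complementary graph, with the colouring by `n ∸ order M`
  -- classes that the matching defines and the clique I in place of optimal ones.
  Good : List V → Set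
  Good xs = ∃₂ λ (M : Matching xs) (I : IndepSet xs) → gap (length xs ∸ order M ∸ order-indep I) ≤ order M

  nearly-perfect : ∀ {xs} → NoTriangle xs → (M : Matching xs) → length (exposed M) ≤ 1 → ¬ ¬ Good xs
  nearly-perfect {xs} noTriangle M le none with order M <? 19
  ... | no ge = none (M , ([] , xs , perm-refl , []) , ≤-trans (gap-≤19 _) (≮⇒≥ ge))
  ... | yes lt with ∧-sound {sufficientᵇ (2 * order M) (order M)} (sufficient lt)
  ...   | even , odd = by-size (length (exposed M)) le (length-matching M)
    where
    conclude : ∀ n → length xs ≡ n → sufficientᵇ n (order M) ≡ true → ⊥
    conclude n refl h with ∧-sound {guaranteedᵇ n} h
    ... | h₁ , h₂ with ∨-sound {guaranteed n ≡ᵇ 0} h₁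
    ...   | inj₁ zero≡ = none (M , ([] , xs , perm-refl , []) ,
        subst (λ w → gap (n ∸ order M ∸ w) ≤ order M) (≡ᵇ⇒≡ (guaranteed n) 0 (Equivalence.from T-≡ zero≡))
            (≤ᵇ-sound {gap (n ∸ order M ∸ guaranteed n)} h₂))
    ...   | inj₂ h₃ with ∧-sound {ramseyNumber (guaranteed n ∸ 1) ≤ᵇ n} h₃
    ...     | r≤ , w≤ = large-indep (guaranteed n ∸ 1) (∸-monoˡ-≤ 1 (≤ᵇ-sound {guaranteed n} {9} w≤)) noTriangle
        (≤ᵇ-sound r≤)
        λ { (I , lt) → none (M , I , ≤-trans (gap-mono (∸-monoʳ-≤ (n ∸ order M) (≤-trans (m≤n+m∸n
            (guaranteed n) 1) lt))) (≤ᵇ-sound h₂)) }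
    by-size : ∀ e → e ≤ 1 → length xs ≡ 2 * order M + e → ⊥
    by-size 0 _ eq = conclude (2 * order M) (trans eq (+-identityʳ _)) even
    by-size 1 _ eq = conclude (1 + 2 * order M) (trans eq (+-comm _ 1)) odd
    by-size (suc (suc _)) (s≤s ()) _

  -- With no edges across, both the matchings and the independent sets of the parts can be united;
  -- subadditivity of `gap` does the rest.
  good-++ : ∀ {xs ys zs} → xs ↭ ys ++ zs → (∀ {y z} → y ∈ ys → z ∈ zs → (y ~ z) ≡ false) →
            Good ys → Good zs → Good xs
  good-++ {xs} {ys} {zs} p apart (M , (as , bs , q , i) , h) (N , (cs , ds , r , j) , h′) =
    MN , (as ++ cs , bs ++ ds , perm-trans p (perm-trans (++⁺ q r) (mix as bs cs ds)) ,
      AllPairs.++⁺ i j (All.tabulate λ a → All.tabulate λ c → apart (∈-resp-↭ (↭-sym q) (∈-++⁺ˡ a)) (∈-resp-↭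
          (↭-sym r) (∈-++⁺ˡ c)))) ,
    (begin
      gap (length xs ∸ length (pairs M ++ pairs N) ∸ length (as ++ cs))
        ≡⟨ cong gap (cong₂ _∸_ (cong₂ _∸_ (trans (↭-length p) (length-++ ys)) (length-++ (pairs M))) (length-++ as)) ⟩
      gap (length ys + length zs ∸ (order M + order N) ∸ (length as + length cs))
        ≤⟨ gap-mono (≤-trans (∸-monoˡ-≤ (length as + length cs) (∸-+-≤ (length ys) (length zs) (order M)
            (order N))) (∸-+-≤ (length ys ∸ order M) (length zs ∸ order N) (length as) (length cs))) ⟩
      gap ((length ys ∸ order M ∸ length as) + (length zs ∸ order N ∸ length cs))
        ≤⟨ gap-subadditive (length ys ∸ order M ∸ length as) _ ⟩
      gap (length ys ∸ order M ∸ length as) + gap (length zs ∸ order N ∸ length cs)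
        ≤⟨ +-mono-≤ h h′ ⟩
      order M + order N
        ≡⟨ length-++ (pairs M) ⟨
      length (pairs M ++ pairs N) ∎)
    where
    open ≤-Reasoning
    mix : ∀ (as bs cs ds : List V) → (as ++ bs) ++ cs ++ ds ↭ (as ++ cs) ++ bs ++ ds
    mix as bs cs ds = perm-trans (↭-reflexive (++-assoc as bs _)) (perm-trans
      (++⁺ˡ as (perm-trans (↭-reflexive (sym (++-assoc bs cs ds))) (perm-trans
        (++⁺ʳ ds (++-comm bs cs)) (↭-reflexive (++-assoc cs bs ds)))))
      (↭-reflexive (sym (++-assoc as cs _))))
    MN : Matching xs
    MN = record
      { pairs = pairs M ++ pairs N ; exposed = exposed M ++ exposed N
      ; perm = perm-trans p (perm-trans (++⁺ (perm M) (perm N)) (perm-trans (mix (flat (pairs M)) (exposed M)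
          (flat (pairs N)) (exposed N))
                 (↭-reflexive (cong (_++ exposed M ++ exposed N) (sym (flat-++ (pairs M) (pairs N)))))))
      ; edge = All.++⁺ (edge M) (edge N) }

  extend : ∀ {xs v rest} → xs ↭ v ∷ rest → Matching rest → Matching xs
  extend {v = v} p M = record
    { pairs = pairs M ; exposed = v ∷ exposed M ; edge = edge M
    ; perm = perm-trans p (perm-trans (prep v (perm M)) (↭-sym (shift v (flat (pairs M)) (exposed M)))) }

  -- Passing from `rest` to `xs` adds one vertex and at least one matching edge, so the number of
  -- colours does not grow, while the right-hand side of the inequality does.
  good-delete : ∀ {xs v rest} → xs ↭ v ∷ rest → (M : Matching xs) → (∀ (N : Matching rest) → order N < order M) →
                Good rest → Good xs
  good-delete {xs} {v} {rest} p M drops (N , (ys , zs , q , i) , h) =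
    M , (ys , v ∷ zs , perm-trans p (perm-trans (prep v q) (↭-sym (shift v ys zs))) , i) ,
    ≤-trans (gap-mono (∸-monoˡ-≤ (length ys) fewer)) (≤-trans h (<⇒≤ (drops N)))
    where
    fewer : length xs ∸ order M ≤ length rest ∸ order N
    fewer = subst (λ n → n ∸ order M ≤ length rest ∸ order N) (sym (↭-length p)) (∸-monoʳ-≤ (suc (length rest)) (drops N))

  good : ∀ fuel xs → length xs ≤ fuel → Unique xs → NoTriangle xs → ¬ ¬ Good xs
  good fuel xs le unique noTriangle none =
    ¬¬-max order (length xs) order-≤ (empty xs) λ { (M , maximal) →
    ¬¬-em {∃₂ λ v rest → xs ↭ v ∷ rest × ∀ (N : Matching rest) → order N < order M} λ
    { (inj₁ (v , rest , p , drops)) → delete fuel le M p drops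
    ; (inj₂ noEssential) → exposing fuel le M maximal (λ {v} {rest} p drops → noEssential (v , rest , p , drops)) } }
    where
    part : ∀ {ys zs} → xs ↭ ys ++ zs → (Unique ys × NoTriangle ys)
    part {ys} {zs} p = unique-++ˡ ys (unique-↭ p unique) ,
      λ i j k → noTriangle (back i) (back j) (back k)
      where
      back : ∀ {x} → x ∈ ys → x ∈ xs
      back i = ∈-resp-↭ (↭-sym p) (∈-++⁺ˡ i)

    swap-parts : ∀ ys zs → xs ↭ ys ++ zs → xs ↭ zs ++ ys
    swap-parts ys zs p = perm-trans p (++-comm ys zs)

    smaller : ∀ fuel {ys zs z} → length xs ≤ suc fuel → xs ↭ ys ++ zs → z ∈ zs → length ys ≤ fuel
    smaller fuel {ys} {zs} le p i with rest , q ← ∈-front i = s≤s⁻¹ (≤-trans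
      (subst₂ _≤_ (+-comm (length ys) 1) (sym (trans (↭-length p) (length-++ ys)))
        (+-monoʳ-≤ (length ys) (subst (1 ≤_) (sym (↭-length q)) (s≤s z≤n)))) le)

    delete : ∀ fuel → length xs ≤ fuel → (M : Matching xs) → ∀ {v rest} → xs ↭ v ∷ rest →
             (∀ (N : Matching rest) → order N < order M) → ⊥
    delete zero le M p drops with () ← subst (_≤ 0) (↭-length p) le
    delete (suc fuel) le M {v} {rest} p drops with u , nt ← part {rest} {v ∷ []} (perm-trans p (++-comm (v ∷ []) rest)) =
      good fuel rest (s≤s⁻¹ (subst (_≤ suc fuel) (↭-length p) le)) u nt (none ∘ good-delete p M drops)

    exposing : ∀ fuel → length xs ≤ fuel → (M : Matching xs) → (∀ N → order N ≤ order M) →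
               (∀ {v rest} → xs ↭ v ∷ rest → ¬ (∀ (N : Matching rest) → order N < order M)) → ⊥
    exposing fuel le M maximal noEssential with exposed M in eq
    ... | [] = nearly-perfect noTriangle M (subst (λ us → length us ≤ 1) (sym eq) z≤n) none
    ... | _ ∷ [] = nearly-perfect noTriangle M (subst (λ us → length us ≤ 1) (sym eq) ≤-refl) none
    ... | u ∷ v ∷ us = ¬¬-partition (u ≈_) xs λ { (ys , zs , p , u≈ys , u≉zs) → split fuel le p u≈ys u≉zs }
      where
      open Gallai xs unique (order M) maximal
      u∈M : u ∈ exposed M
      u∈M = subst (u ∈_) (sym eq) (here refl)
      v∈M : v ∈ exposed M
      v∈M = subst (v ∈_) (sym eq) (there (here refl))
      u≢v : u ≢ v
      u≢v with (ne ∷ _) ∷ _ ← subst Unique eq (unique-++ʳ (flat (pairs M)) (parts-unique M)) = ne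
      -- As no vertex is essential, some matching avoiding x is as large as M; regarded as a
      -- matching of `xs`, it exposes x.
      can-be-exposed : ∀ {x} → x ∈ xs → ¬ ¬ (∃ λ N → Optimal N × x ∈ exposed N)
      can-be-exposed i no-one with rest , p ← ∈-front i = noEssential p
        (λ N → ≰⇒> (λ le → no-one (extend p N , le , here refl)))
      split : ∀ fuel → length xs ≤ fuel → ∀ {ys zs} → xs ↭ ys ++ zs → All (u ≈_) ys → All (¬_ ∘ (u ≈_)) zs → ⊥
      split fuel le {ys} {zs} p u≈ys u≉zs with ∈-++⁻ ys (∈-resp-↭ p (exposed-⊆ M u∈M)) | ∈-++⁻ ys (∈-resp-↭ p
          (exposed-⊆ M v∈M))
      ... | inj₂ i | _ = All.lookup u≉zs i (λ _ _ _ _ → refl)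
      ... | inj₁ _ | inj₁ j = u≢v (All.lookup u≈ys j M ≤-refl u∈M v∈M)
      ... | inj₁ i | inj₂ j = halves fuel le
        where
        -- An edge yz would give y ≈ z, hence u ≈ z by transitivity through y, which needs a maximum
        -- matching exposing y.
        apart : ∀ {y z} → y ∈ ys → z ∈ zs → (y ~ z) ≡ false
        apart {y} {z} k l with y ~ z in e
        ... | false = refl
        ... | true = ⊥-elim (can-be-exposed (∈-resp-↭ (↭-sym p) (∈-++⁺ˡ k)) λ { (N , oN , yN) →
          All.lookup u≉zs l (≈-trans N oN yN (All.lookup u≈ys k) (adjacent-≈ e)) })
        halves : ∀ fuel → length xs ≤ fuel → ⊥
        halves zero le with () ← subst (_≤ 0) (↭-length (proj₂ (∈-front (exposed-⊆ M u∈M)))) le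
        halves (suc fuel) le with (u₁ , t₁) ← part {ys} {zs} p | (u₂ , t₂) ← part {zs} {ys} (swap-parts ys zs p) =
          good fuel ys (smaller fuel {ys} {zs} le p j) u₁ t₁ λ g₁ →
          good fuel zs (smaller fuel {zs} {ys} le (swap-parts ys zs p) i) u₂ t₂ λ g₂ → none (good-++ p apart g₁ g₂)

-- Lower bounds

AllPairs-lookup : ∀ {A : Set} {R : A → A → Set} → (∀ {x y} → R x y → R y x) → ∀ {xs} → AllPairs R xs →
  ∀ i j → i ≢ j → R (lookup xs i) (lookup xs j)
AllPairs-lookup s (a ∷ as) Fin.zero Fin.zero ne = ⊥-elim (ne refl)
AllPairs-lookup s (a ∷ as) Fin.zero (Fin.suc j) ne = All.lookup a (∈-lookup j)
AllPairs-lookup s (a ∷ as) (Fin.suc i) Fin.zero ne = s (All.lookup a (∈-lookup i))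
AllPairs-lookup s (a ∷ as) (Fin.suc i) (Fin.suc j) ne = AllPairs-lookup s as i j (λ e → ne (cong Fin.suc e))

AllPairs-∈ : ∀ {A : Set} {R : A → A → Set} → (∀ {x y} → R x y → R y x) → ∀ {xs} → AllPairs R xs →
  ∀ {x y} → x ∈ xs → y ∈ xs → x ≢ y → R x y
AllPairs-∈ s (a ∷ as) (here refl) (here refl) ne = ⊥-elim (ne refl)
AllPairs-∈ s (a ∷ as) (here refl) (there j) ne = All.lookup a j
AllPairs-∈ s (a ∷ as) (there i) (here refl) ne = s (All.lookup a i)
AllPairs-∈ s (a ∷ as) (there i) (there j) ne = AllPairs-∈ s as i j ne

module LowerBound {n : ℕ} (G : Graph n) where

  -- The complement of G. Its independent sets are the cliques of G, its edges the colour classes of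
  -- size two, its triangles the independent triples.
  _~_ : Fin n → Fin n → Bool
  x ~ y = not (does (x Fin.≟ y)) ∧ not (adj G x y)

  ~-sym : ∀ x y → (x ~ y) ≡ (y ~ x)
  ~-sym x y = cong₂ (λ a b → not a ∧ not b) does-sym (Graph.sym G x y)
    where
    does-sym : does (x Fin.≟ y) ≡ does (y Fin.≟ x)
    does-sym with x Fin.≟ y
    ... | yes refl = sym (dec-true (y Fin.≟ y) refl)
    ... | no x≢y = sym (dec-false (y Fin.≟ x) (x≢y ∘ sym))

  ~-irrefl : ∀ x → (x ~ x) ≡ false
  ~-irrefl x rewrite dec-true (x Fin.≟ x) refl = refl

  ~⇒nonadjacent : ∀ {x y} → (x ~ y) ≡ true → adj G x y ≡ false
  ~⇒nonadjacent {x} {y} e with x Fin.≟ y | adj G x y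
  ... | no _ | false = refl

  ≁⇒adjacent : ∀ {x y} → (x ~ y) ≡ false → x ≢ y → adj G x y ≡ true
  ≁⇒adjacent {x} {y} e ne with x Fin.≟ y | adj G x y
  ... | yes x≡y | _ = ⊥-elim (ne x≡y)
  ... | no _ | true = refl

  open Matchings Fin._≟_ _~_ ~-sym ~-irrefl
  open Deficiency Fin._≟_ _~_ ~-sym ~-irrefl

  Independent : List (Fin n) → Set
  Independent = AllPairs (λ x y → (x ~ y) ≡ true)

  record Colouring (xs : List (Fin n)) : Set where
    field
      classes : List (List (Fin n))
      covers : xs ↭ concat classes
      proper : All Independent classes
  open Colouring

  colours : ∀ {xs} → Colouring xs → ℕ
  colours c = length (classes c)

  -- The left-hand side grows with the number of colours and falls with the size of the clique. So
  -- the inequality for some colouring and some clique implies χ + gap(χ - ω) ≤ n, and neither χ nor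
  -- ω has to be determined.
  Tight : List (Fin n) → Set
  Tight xs = ∃₂ λ (c : Colouring xs) (I : IndepSet xs) → colours c + gap (colours c ∸ order-indep I) ≤ length xs

  Triple : List (Fin n) → Set
  Triple xs = ∃₂ λ x y → ∃₂ λ z rest → xs ↭ x ∷ y ∷ z ∷ rest × Independent (x ∷ y ∷ z ∷ [])

  noTriple⇒noTriangle : ∀ {xs} → ¬ Triple xs → NoTriangle xs
  noTriple⇒noTriangle {xs} none {x} {y} {z} i j k xy yz xz with as , p ← ∈-front i with ∈-resp-↭ p j
  ... | here refl = edge-≢ xy refl
  ... | there j′ with bs , q ← ∈-front j′ with ∈-resp-↭ (perm-trans p (prep x q)) k
  ...   | here refl = edge-≢ xz refl
  ...   | there (here refl) = edge-≢ yz refl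
  ...   | there (there k′) with cs , r ← ∈-front k′ =
    none (x , y , z , cs , perm-trans p (prep x (perm-trans q (prep y r))) , (xy ∷ xz ∷ []) ∷ (yz ∷ []) ∷ [] ∷ [])

  colouring-matching : ∀ {xs} (M : Matching xs) → ∃ λ (c : Colouring xs) → colours c ≡ length xs ∸ order M
  colouring-matching {xs} M = record
    { classes = map pair (pairs M) ++ map single (exposed M)
    ; covers = perm-trans (perm M) (↭-reflexive (trans (cong₂ _++_ (concat-pairs (pairs M)) (concat-singles (exposed M)))
                 (concat-++ (map pair (pairs M)) (map single (exposed M)))))
    ; proper = All.++⁺ (All.map⁺ (All.map (λ e → (e ∷ []) ∷ [] ∷ []) (edge M))) (All.map⁺ (All.universal (λ _
        → [] ∷ []) (exposed M))) } ,
    (begin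
      length (map pair (pairs M) ++ map single (exposed M))   ≡⟨ length-++ (map pair (pairs M)) ⟩
      length (map pair (pairs M)) + length (map single (exposed M))
        ≡⟨ cong₂ _+_ (length-map pair (pairs M)) (length-map single (exposed M)) ⟩
      order M + length (exposed M)                            ≡⟨ m+n∸m≡n (order M) _ ⟨
      order M + (order M + length (exposed M)) ∸ order M      ≡⟨ cong (_∸ order M) (regroup (order M) (length
          (exposed M))) ⟩
      2 * order M + length (exposed M) ∸ order M              ≡⟨ cong (_∸ order M) (length-matching M) ⟨
      length xs ∸ order M                                     ∎)
    where
    open ≡-Reasoning
    pair : Fin n × Fin n → List (Fin n)
    pair (a , b) = a ∷ b ∷ []
    single : Fin n → List (Fin n)
    single x = x ∷ []
    regroup : ∀ m e → m + (m + e) ≡ 2 * m + e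
    regroup = solve-∀
    concat-pairs : ∀ ps → flat ps ≡ concat (map pair ps)
    concat-pairs [] = refl
    concat-pairs ((a , b) ∷ ps) = cong (λ xs → a ∷ b ∷ xs) (concat-pairs ps)
    concat-singles : ∀ xs → xs ≡ concat (map single xs)
    concat-singles [] = refl
    concat-singles (x ∷ xs) = cong (x ∷_) (concat-singles xs)

  tight : ∀ fuel xs → length xs ≤ fuel → Unique xs → ¬ ¬ Tight xs
  tight fuel xs le unique none = ¬¬-em {Triple xs} λ
    { (inj₁ (x , y , z , rest , p , ind)) → remove-triple fuel le p ind
    ; (inj₂ noTriple) → good (length xs) xs ≤-refl unique (noTriple⇒noTriangle noTriple) λ { (M , I , h) →
        let c , e = colouring-matching M in none (c , I , subst (λ k → k + gap (k ∸ order-indep I) ≤ length xs) (sym e)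
          (≤-trans (+-monoʳ-≤ (length xs ∸ order M) h) (≤-reflexive (m∸n+n≡m (order-≤ M))))) } }
    where
    remove-triple : ∀ fuel → length xs ≤ fuel → ∀ {x y z rest} → xs ↭ x ∷ y ∷ z ∷ rest → Independent (x ∷ y ∷ z ∷ []) → ⊥
    remove-triple zero le p ind with () ← subst (_≤ 0) (↭-length p) le
    remove-triple (suc fuel) le {x} {y} {z} {rest} p ind with _ ∷ _ ∷ _ ∷ unique′ ← unique-↭ p unique =
      tight fuel rest (≤-trans (m≤n+m (length rest) 2) (s≤s⁻¹ (subst (_≤ suc fuel) (↭-length p) le))) unique′
        λ { (c , (ys , zs , q , i) , h) → none
          ( record { classes = (x ∷ y ∷ z ∷ []) ∷ classes c ; covers = perm-trans p (++⁺ˡ (x ∷ y ∷ z ∷ [])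
              (covers c)) ; proper = ind ∷ proper c }
          , (ys , zs ++ x ∷ y ∷ z ∷ [] , perm-trans p (perm-trans (++-comm (x ∷ y ∷ z ∷ []) rest)
              (perm-trans (++⁺ʳ (x ∷ y ∷ z ∷ []) q) (↭-reflexive (++-assoc ys zs _)))) , i)
          , (begin
              suc (colours c) + gap (suc (colours c) ∸ length ys)
                ≤⟨ +-monoʳ-≤ (suc (colours c)) (≤-trans (gap-mono (≤-trans (∸-+-≤ 1 (colours c) 0
                    (length ys)) ≤-refl)) (gap-subadditive 1 (colours c ∸ length ys))) ⟩
              suc (colours c) + (2 + gap (colours c ∸ length ys))
                ≡⟨ regroup (colours c) (gap (colours c ∸ length ys)) ⟩
              3 + (colours c + gap (colours c ∸ length ys))
                ≤⟨ +-monoʳ-≤ 3 h ⟩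
              3 + length rest
                ≡⟨ ↭-length p ⟨
              length xs ∎)) }
      where
      open ≤-Reasoning
      regroup : ∀ k g → suc k + (2 + g) ≡ 3 + (k + g)
      regroup = solve-∀

  no-clique⇒indep-< : ∀ {q} → ¬ HasClique G q → ∀ {xs} → Unique xs → (I : IndepSet xs) → order-indep I < q
  no-clique⇒indep-< {q} no-clique unique (ys , zs , p , ind) = ≰⇒> λ le → no-clique record
    { vert = λ i → lookup ys (Fin.inject≤ i le)
    ; injective = λ i j e → Fin.inject≤-injective le le i j (injective le e)
    ; adjacent = λ i j ne → ≁⇒adjacent
        (AllPairs-lookup (λ {x} {y} a → trans (~-sym y x) a) ind _ _ (ne ∘ Fin.inject≤-injective le le i j))
        (AllPairs-lookup (λ a → a ∘ sym) ys-unique _ _ (ne ∘ Fin.inject≤-injective le le i j))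
    ; inside = λ _ → _ }
    where
    ys-unique : Unique ys
    ys-unique = unique-++ˡ ys (unique-↭ p unique)
    injective : ∀ (le : q ≤ length ys) {i j} → lookup ys (Fin.inject≤ i le) ≡ lookup ys (Fin.inject≤ j le)
        → Fin.inject≤ i le ≡ Fin.inject≤ j le
    injective le {i} {j} e with Fin.inject≤ i le Fin.≟ Fin.inject≤ j le
    ... | yes eq = eq
    ... | no ne = ⊥-elim (AllPairs-lookup (λ a → a ∘ sym) ys-unique _ _ ne e)

  arrows⇒colours-> : ∀ {r} → VertexArrows G r (twos r) → (c : Colouring (allFin n)) → r < colours c
  arrows⇒colours-> {r} arrows c = ≰⇒> contra
    where
    class : ∀ v → ∃ λ xs → v ∈ xs × xs ∈ classes c
    class v = ∈-concat⁻′ (classes c) (∈-resp-↭ (covers c) (∈-allFin v))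
    index : ∀ v → Fin (colours c)
    index v = Any.index (proj₂ (proj₂ (class v)))
    contra : ¬ colours c ≤ r
    contra le with i , clique ← arrows (λ v → Fin.inject≤ (index v) le) =
      false≢true (trans (sym (~⇒nonadjacent apart)) (CliqueIn.adjacent clique Fin.zero (Fin.suc Fin.zero) λ ()))
      where
      false≢true : false ≢ true
      false≢true ()
      a b : Fin n
      a = CliqueIn.vert clique Fin.zero
      b = CliqueIn.vert clique (Fin.suc Fin.zero)
      a≢b : a ≢ b
      a≢b e with () ← CliqueIn.injective clique Fin.zero (Fin.suc Fin.zero) e
      same : index a ≡ index b
      same = Fin.inject≤-injective le le (index a) (index b)
        (trans (CliqueIn.inside clique Fin.zero) (sym (CliqueIn.inside clique (Fin.suc Fin.zero))))
      class-lookup : ∀ v → v ∈ lookup (classes c) (index v)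
      class-lookup v = subst (v ∈_) (Any.lookup-index (proj₂ (proj₂ (class v)))) (proj₁ (proj₂ (class v)))
      apart : (a ~ b) ≡ true
      apart = AllPairs-∈ (λ {x} {y} e → trans (~-sym y x) e) (All.lookup (proper c) (∈-lookup (index a)))
        (class-lookup a) (subst (λ i → b ∈ lookup (classes c) i) (sym same) (class-lookup b)) a≢b

  length-allFin : length (allFin n) ≡ n
  length-allFin = length-tabulate (λ i → i)

  -- From χ ≥ r + 1 and ω ≤ q - 1 it follows that χ - ω ≥ r + 2 - q, which is `s`.
  lower-bound : ∀ {r q} s → InHv G r (twos r) q → q + s ≡ 2 + r → suc r + gap s ≤ n
  lower-bound {r} {q} s (arrows , no-clique) eq = ≮⇒≥ λ lt →
    tight n (allFin n) (≤-reflexive length-allFin) (allFin⁺ n) λ { (c , I , h) → <⇒≱ lt (begin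
      suc r + gap s                                         ≤⟨ +-mono-≤ (arrows⇒colours-> arrows c) (gap-mono
          (enough (arrows⇒colours-> arrows c) (no-clique⇒indep-< no-clique (allFin⁺ n) I))) ⟩
      colours c + gap (colours c ∸ order-indep I)           ≤⟨ h ⟩
      length (allFin n)                                     ≡⟨ length-allFin ⟩
      n                                                     ∎) }
    where
    open ≤-Reasoning
    enough : ∀ {k w} → suc r ≤ k → w < q → s ≤ k ∸ w
    enough {k} {w} r<k w<q = m+n≤o⇒m≤o∸n s (s≤s⁻¹ (begin
      suc (s + w)           ≡⟨ +-suc s w ⟨
      s + suc w             ≤⟨ +-monoʳ-≤ s w<q ⟩
      s + q                 ≡⟨ +-comm s q ⟩
      q + s                 ≡⟨ eq ⟩
      suc (suc r)           ≤⟨ s≤s r<k ⟩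
      suc k                 ∎))

  -- If G has an independent triple, bound the graph without it; otherwise the Ramsey bound yields a clique.
  lower-bound′ : ∀ {r} q s → InHv G r (twos r) (suc q) → q + s ≡ r → q ≤ 8 → ramseyNumber q ≤ n → 3 + r + gap s ≤ n
  lower-bound′ {r} q s (arrows , no-clique) eq q≤8 ram = ≮⇒≥ λ lt → ¬¬-em {Triple (allFin n)} λ
    { (inj₂ noTriple) → large-indep q q≤8 (noTriple⇒noTriangle noTriple) (subst (ramseyNumber q ≤_)
        (sym length-allFin) ram)
        λ { (I , q<I) → <⇒≱ (no-clique⇒indep-< no-clique (allFin⁺ n) I) q<I }
    ; (inj₁ (x , y , z , rest , p , ind)) → triple lt p ind }
    where
    triple : ∀ {x y z rest} → n < 3 + r + gap s → allFin n ↭ x ∷ y ∷ z ∷ rest → Independent (x ∷ y ∷ z ∷ []) → ⊥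
    triple {x} {y} {z} {rest} lt p ind with _ ∷ _ ∷ _ ∷ unique ← unique-↭ p (allFin⁺ n) =
      tight (length rest) rest ≤-refl unique λ { (c , (ys , zs , q′ , i) , h) → <⇒≱ lt (begin
        3 + r + gap s                                       ≤⟨ +-mono-≤ (+-monoʳ-≤ 3 (many c)) (gap-mono (enough
            (many c) (few ys zs q′ i))) ⟩
        3 + (colours c + gap (colours c ∸ length ys))       ≤⟨ +-monoʳ-≤ 3 h ⟩
        3 + length rest                                     ≡⟨ ↭-length p ⟨
        length (allFin n)                                   ≡⟨ length-allFin ⟩
        n                                                   ∎) }
      where
      open ≤-Reasoning
      -- The triple as an additional class turns a colouring of the rest into one of G.
      many : (c : Colouring rest) → r ≤ colours c
      many c = s≤s⁻¹ (arrows⇒colours-> arrows record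
        { classes = (x ∷ y ∷ z ∷ []) ∷ classes c ; covers = perm-trans p (++⁺ˡ (x ∷ y ∷ z ∷ [])
            (covers c)) ; proper = ind ∷ proper c })
      few : ∀ ys zs → rest ↭ ys ++ zs → Indep ys → length ys ≤ q
      few ys zs q′ i = s≤s⁻¹ (no-clique⇒indep-< no-clique (allFin⁺ n)
        (ys , zs ++ x ∷ y ∷ z ∷ [] , perm-trans p (perm-trans (++-comm (x ∷ y ∷ z ∷ []) rest)
              (perm-trans (++⁺ʳ (x ∷ y ∷ z ∷ []) q′) (↭-reflexive (++-assoc ys zs _)))) , i))
      enough : ∀ {k w} → r ≤ k → w ≤ q → s ≤ k ∸ w
      enough {k} {w} r≤k w≤q = m+n≤o⇒m≤o∸n s (begin
        s + w           ≤⟨ +-monoʳ-≤ s w≤q ⟩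
        s + q           ≡⟨ +-comm s q ⟩
        q + s           ≡⟨ eq ⟩
        r               ≤⟨ r≤k ⟩
        k               ∎)

-- Constructions

length-allFin : ∀ n → length (allFin n) ≡ n
length-allFin n = length-tabulate {n = n} (λ i → i)

true≢false : true ≢ false
true≢false ()

extract-unique : ∀ {A : Set} (ys : List A) {xs} → Unique ys → (∀ {y} → y ∈ ys → y ∈ xs) → ∃ λ zs → xs ↭ ys ++ zs
extract-unique [] u sub = _ , perm-refl
extract-unique (y ∷ ys) (ne ∷ u) sub with rest , p ← ∈-front (sub (here refl))
  with zs , q ← extract-unique ys u (λ i → case ∈-resp-↭ p (sub (there i)) of λ
    { (here refl) → ⊥-elim (All.lookup ne i refl) ; (there j) → j }) = zs , perm-trans p (prep y q)

Monochromatic : ∀ {n} → Graph n → ℕ → Set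
Monochromatic {n} G r = ∀ (c : Fin n → Fin r) → ∃₂ λ u v → c u ≡ c v × adj G u v ≡ true

monochromatic⇒arrows : ∀ {n} {G : Graph n} {r} → Monochromatic G r → VertexArrows G r (twos r)
monochromatic⇒arrows {n} {G} {r} mono c with u , v , e , uv ← mono c = c u , record
  { vert = vert ; injective = injective ; adjacent = adjacent ; inside = inside }
  where
  vert : Fin 2 → Fin n
  vert Fin.zero = u
  vert (Fin.suc _) = v
  u≢v : u ≢ v
  u≢v refl = true≢false (trans (sym uv) (Graph.irrefl G u))
  injective : ∀ i j → vert i ≡ vert j → i ≡ j
  injective Fin.zero Fin.zero e = refl
  injective Fin.zero (Fin.suc Fin.zero) e = ⊥-elim (u≢v e)
  injective (Fin.suc Fin.zero) Fin.zero e = ⊥-elim (u≢v (sym e))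
  injective (Fin.suc Fin.zero) (Fin.suc Fin.zero) e = refl
  adjacent : ∀ i j → i ≢ j → adj G (vert i) (vert j) ≡ true
  adjacent Fin.zero Fin.zero ne = ⊥-elim (ne refl)
  adjacent Fin.zero (Fin.suc Fin.zero) ne = uv
  adjacent (Fin.suc Fin.zero) Fin.zero ne = trans (Graph.sym G v u) uv
  adjacent (Fin.suc Fin.zero) (Fin.suc Fin.zero) ne = ⊥-elim (ne refl)
  inside : ∀ i → c (vert i) ≡ c u
  inside Fin.zero = refl
  inside (Fin.suc _) = sym e

arrows⇒monochromatic : ∀ {n} {G : Graph n} {r} → VertexArrows G r (twos r) → Monochromatic G r
arrows⇒monochromatic arrows c with i , clique ← arrows c =
  vert Fin.zero , vert (Fin.suc Fin.zero) , trans (inside Fin.zero) (sym (inside (Fin.suc Fin.zero))) ,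
  adjacent Fin.zero (Fin.suc Fin.zero) (λ ())
  where open CliqueIn clique

Folkman : (r q n : ℕ) → Set
Folkman r q n = ∃ λ (G : Graph n) → InHv G r (twos r) q

cone-graph : ∀ {n} → Graph n → Graph (suc n)
cone-graph {n} G = record { adj = a ; sym = s ; irrefl = i }
  where
  a : Fin (suc n) → Fin (suc n) → Bool
  a Fin.zero Fin.zero = false
  a Fin.zero (Fin.suc _) = true
  a (Fin.suc _) Fin.zero = true
  a (Fin.suc u) (Fin.suc v) = adj G u v
  s : ∀ u v → a u v ≡ a v u
  s Fin.zero Fin.zero = refl
  s Fin.zero (Fin.suc _) = refl
  s (Fin.suc _) Fin.zero = refl
  s (Fin.suc u) (Fin.suc v) = Graph.sym G u v
  i : ∀ v → a v v ≡ false
  i Fin.zero = refl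
  i (Fin.suc v) = Graph.irrefl G v

folkman-suc : ∀ {r q n} → Folkman r q n → Folkman (suc r) (suc q) (suc n)
folkman-suc {r} {q} {n} (G , arrows , no-clique) =
  cone-graph G , monochromatic⇒arrows mono , clique-free
  where
  mono : Monochromatic (cone-graph G) (suc r)
  mono c with Fin.any? (λ v → c (Fin.suc v) Fin.≟ c Fin.zero)
  ... | yes (v , e) = Fin.suc v , Fin.zero , e , refl
  ... | no new with u , v , e , uv ← arrows⇒monochromatic arrows (λ v → Fin.punchOut {i = c Fin.zero} (λ e → new
      (v , sym e))) =
    Fin.suc u , Fin.suc v , Fin.punchOut-injective (λ e → new (u , sym e)) (λ e → new (v , sym e)) e , uv

  clique-free : ¬ HasClique (cone-graph G) (suc q)
  clique-free K = no-clique record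
    { vert = below ; injective = λ i j e → Fin.punchIn-injective i₀ i j (injective _ _ (trans (sym
        (suc-below i)) (trans (cong Fin.suc e) (suc-below j))))
    ; adjacent = λ i j ne → subst₂ (λ x y → adj (cone-graph G) x y ≡ true) (sym (suc-below i)) (sym (suc-below j))
        (adjacent _ _ (ne ∘ Fin.punchIn-injective i₀ i j))
    ; inside = λ _ → _ }
    where
    open CliqueIn K
    apex : ∃ λ i₀ → ∀ i → vert (Fin.punchIn i₀ i) ≢ Fin.zero
    apex with Fin.any? (λ i → vert i Fin.≟ Fin.zero)
    ... | yes (i₀ , e) = i₀ , λ i e′ → Fin.punchInᵢ≢i i₀ i (injective _ _ (trans e′ (sym e)))
    -- If the clique avoids the apex, any vertex may be dropped, here the first one.
    ... | no none = Fin.zero , λ i e → none (_ , e)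
    i₀ = proj₁ apex
    below : Fin q → Fin n
    below i = Fin.punchOut {i = Fin.zero} (λ e → proj₂ apex i (sym e))
    suc-below : ∀ i → Fin.suc (below i) ≡ vert (Fin.punchIn i₀ i)
    suc-below i = Fin.punchIn-punchOut {i = Fin.zero} (λ e → proj₂ apex i (sym e))

folkman-+ : ∀ {r q n} t → Folkman r q n → Folkman (t + r) (t + q) (t + n)
folkman-+ zero F = F
folkman-+ (suc t) F = folkman-suc (folkman-+ t F)

setminus : Mask → Mask → Mask
setminus (true ∷ m) (false ∷ r) = true ∷ setminus m r
setminus (true ∷ m) (true ∷ r) = false ∷ setminus m r
setminus (false ∷ m) (_ ∷ r) = false ∷ setminus m r
setminus m _ = m

-- Branch and bound: the first allowed vertex is either taken, which removes its neighbours from the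
-- mask, or left out. Rows list only later vertices, enough when vertices are taken in order. If
-- fewer than `k` others remain, `suc k` cannot be reached.
indepFree : ℕ → Code → Mask → Bool
indepFree zero C m = false
indepFree (suc k) [] m = true
indepFree (suc k) (r ∷ C) [] = true
indepFree (suc k) (r ∷ C) (false ∷ m) = indepFree (suc k) C m
indepFree (suc k) (r ∷ C) (true ∷ m) =
  if size m <ᵇ k then true else indepFree k C (setminus m r) ∧ indepFree (suc k) C m

module ComplementOf {n : ℕ} (_~_ : Fin n → Fin n → Bool)
  (~-sym : ∀ x y → (x ~ y) ≡ (y ~ x)) (~-irrefl : ∀ x → (x ~ x) ≡ false)
  (~-triangle : ∀ x y z → (x ~ y) ≡ true → (y ~ z) ≡ true → (x ~ z) ≡ true → ⊥) where
  open TriangleFree _~_ ~-sym ~-irrefl ~-triangle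
  open Gluing _~_ ~-sym ~-irrefl ~-triangle

  select-setminus : ∀ x xs m → select (setminus m (row xs x)) xs ≡ keep (not ∘ (x ~_)) (select m xs)
  select-setminus x [] [] = refl
  select-setminus x [] (true ∷ m) = refl
  select-setminus x [] (false ∷ m) = refl
  select-setminus x (y ∷ xs) [] = refl
  select-setminus x (y ∷ xs) (true ∷ m) with x ~ y
  ... | true = select-setminus x xs m
  ... | false = cong (y ∷_) (select-setminus x xs m)
  select-setminus x (y ∷ xs) (false ∷ m) = select-setminus x xs m

  select-size : ∀ m xs → length (select m xs) ≤ size m
  select-size [] xs = z≤n
  select-size (true ∷ m) [] = z≤n
  select-size (true ∷ m) (x ∷ xs) = s≤s (select-size m xs)
  select-size (false ∷ m) [] = z≤n
  select-size (false ∷ m) (x ∷ xs) = select-size m xs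

  select-[] : ∀ m → select m [] ≡ []
  select-[] [] = refl
  select-[] (true ∷ m) = refl
  select-[] (false ∷ m) = refl

  indepFree-sound : ∀ k xs m → indepFree k (code xs) m ≡ true →
    ∀ ys zs → select m xs ↭ ys ++ zs → Indep ys → length ys < k
  indepFree-sound (suc k) [] m h [] zs p ind = z<s
  indepFree-sound (suc k) [] m h (y ∷ ys) zs p ind with () ← ↭-length (perm-trans (↭-reflexive (sym (select-[] m))) p)
  indepFree-sound (suc k) (x ∷ xs) [] h [] zs p ind = z<s
  indepFree-sound (suc k) (x ∷ xs) [] h (y ∷ ys) zs p ind with () ← ↭-length p
  indepFree-sound (suc k) (x ∷ xs) (false ∷ m) h ys zs p ind = indepFree-sound (suc k) xs m h ys zs p ind
  indepFree-sound (suc k) (x ∷ xs) (true ∷ m) h ys zs p ind with size m <ᵇ k in small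
  ... | true = s≤s (≤-trans (≤-trans (m≤m+n (length ys) (length zs)) (≤-reflexive (trans (sym (length-++ ys))
      (sym (↭-length p)))))
                 (≤-trans (s≤s (select-size m xs)) (<ᵇ-sound small)))
  ... | false with ∧-sound {indepFree k (code xs) (setminus m (row xs x))} h | ∈-++⁻ ys (∈-resp-↭ p (here refl))
  ...   | h₁ , _ | inj₁ i with us , q ← ∈-front i with apart ∷ ind′ ← AllPairs-↭ apart-sym q ind =
    subst (_< suc k) (sym (↭-length q)) (s≤s (indepFree-sound k xs (setminus m (row xs x)) h₁ us (keep (not ∘ (x ~_)) zs)
      (perm-trans (↭-reflexive (select-setminus x xs m)) (perm-trans (keep-↭ _ (drop-head p q)) (↭-reflexive
          (keep-++ us zs apart)))) ind′))
    where
    drop-head : ∀ {us} → x ∷ select m xs ↭ ys ++ zs → ys ↭ x ∷ us → select m xs ↭ us ++ zs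
    drop-head p q = drop-∷ (perm-trans p (++⁺ʳ zs q))
    keep-++ : ∀ us zs → All (Apart x) us → keep (not ∘ (x ~_)) (us ++ zs) ≡ us ++ keep (not ∘ (x ~_)) zs
    keep-++ [] zs [] = refl
    keep-++ (u ∷ us) zs (a ∷ as) rewrite a = cong (u ∷_) (keep-++ us zs as)
  ...   | _ , h₂ | inj₂ i with us , q ← ∈-front i =
    indepFree-sound (suc k) xs m h₂ ys us (drop-∷ (perm-trans p (perm-trans (++⁺ˡ ys q) (shift x ys us)))) ind

  complement : Graph n
  complement = record
    { adj = λ x y → not (does (x Fin.≟ y)) ∧ not (x ~ y)
    ; sym = λ x y → cong₂ (λ a b → not a ∧ not b) (does-sym x y) (~-sym x y)
    ; irrefl = λ x → cong (λ b → not b ∧ not (x ~ x)) (dec-true (x Fin.≟ x) refl) }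
    where
    does-sym : ∀ x y → does (x Fin.≟ y) ≡ does (y Fin.≟ x)
    does-sym x y with x Fin.≟ y
    ... | yes refl = sym (dec-true (y Fin.≟ y) refl)
    ... | no x≢y = sym (dec-false (y Fin.≟ x) (x≢y ∘ sym))

  adjacent⇒apart : ∀ {x y} → adj complement x y ≡ true → Apart x y
  adjacent⇒apart {x} {y} e with x Fin.≟ y | x ~ y
  ... | no _ | false = refl

  nonadjacent⇒~ : ∀ {x y} → adj complement x y ≢ true → x ≢ y → (x ~ y) ≡ true
  nonadjacent⇒~ {x} {y} ¬e ne with x Fin.≟ y | x ~ y
  ... | yes x≡y | _ = ⊥-elim (ne x≡y)
  ... | no _ | true = refl
  ... | no _ | false = ⊥-elim (¬e refl)

  -- In a proper colouring three vertices of one colour would form a triangle of `_~_`. Counting the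
  -- vertices by colour then gives n ≤ 2r.
  monochromatic : ∀ {r} → 2 * r < n → Monochromatic complement r
  monochromatic {r} lt c with Fin.any? (λ u → Fin.any? (λ v → (c u Fin.≟ c v) ×-dec (adj complement u v Bool.≟ true)))
  ... | yes (u , v , e) = u , v , e
  ... | no proper = ⊥-elim (<⇒≱ lt (begin
      n                                                                 ≡⟨ trans (∑-const 1 (allFin n)) (trans
          (*-identityʳ _) (length-allFin n)) ⟨
      ∑ (λ v → 1) (allFin n)                                            ≡⟨ ∑-cong (allFin n) (λ {v} _ → once (c v)) ⟨
      ∑ (λ v → ∑ (λ i → ⟦ does (c v Fin.≟ i) ⟧) (allFin r)) (allFin n)  ≡⟨ ∑-swap _ (allFin n) (allFin r) ⟩
      ∑ (λ i → ∑ (λ v → ⟦ does (c v Fin.≟ i) ⟧) (allFin n)) (allFin r)  ≤⟨ ∑-mono (allFin r) (λ {i} _ → subst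
          (_≤ 2) (sym (∑-length-keep _ (allFin n))) (class-≤ i _ refl)) ⟩
      ∑ (λ i → 2) (allFin r)                                            ≡⟨ trans (∑-const 2 (allFin r)) (trans
          (cong (λ l → l * 2) (length-allFin r)) (*-comm r 2)) ⟩
      2 * r                                                             ∎))
    where
    open ≤-Reasoning
    once : ∀ {r} (i : Fin r) → ∑ (λ j → ⟦ does (i Fin.≟ j) ⟧) (allFin r) ≡ 1
    once {r} i with rest , p ← ∈-front (∈-allFin i) = trans (∑-↭ _ p)
      (cong₂ _+_ (cong ⟦_⟧ (dec-true (i Fin.≟ i) refl)) (trans (∑-cong rest (λ {j} k → cong ⟦_⟧ (dec-false
          (i Fin.≟ j) (other k))))
        (trans (∑-const 0 rest) (*-zeroʳ (length rest)))))
      where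
      other : ∀ {j} → j ∈ rest → i ≢ j
      other k with ne ∷ _ ← unique-↭ p (allFin⁺ r) = All.lookup ne k
    class-≤ : ∀ i xs → keep (λ v → does (c v Fin.≟ i)) (allFin n) ≡ xs → length xs ≤ 2
    class-≤ i [] _ = z≤n
    class-≤ i (_ ∷ []) _ = s≤s z≤n
    class-≤ i (_ ∷ _ ∷ []) _ = ≤-refl
    class-≤ i (x ∷ y ∷ z ∷ _) eq
      with (x≢y ∷ x≢z ∷ _) ∷ (y≢z ∷ _) ∷ _ ← subst Unique eq (keep-AllPairs (λ v → does (c v Fin.≟ i)) (allFin⁺ n)) =
      ⊥-elim (~-triangle x y z (joined (here refl) (there (here refl)) x≢y) (joined (there (here refl)) (there
          (there (here refl))) y≢z)
        (joined (here refl) (there (there (here refl))) x≢z))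
      where
      colour : ∀ {v} → v ∈ x ∷ y ∷ z ∷ _ → c v ≡ i
      colour {v} k with c v Fin.≟ i | proj₂ (keep-⊆ (λ v → does (c v Fin.≟ i)) (allFin n) (subst (v ∈_) (sym eq) k))
      ... | yes e | _ = e
      joined : ∀ {u v} → u ∈ x ∷ y ∷ z ∷ _ → v ∈ x ∷ y ∷ z ∷ _ → u ≢ v → (u ~ v) ≡ true
      joined {u} {v} k l ne = nonadjacent⇒~ (λ e → proper (u , v , trans (colour k) (sym (colour l)) , e)) ne

  folkman : ∀ {r w} → 2 * r < n → indepFree (suc w) (code (allFin n)) (replicate n true) ≡ true → Folkman r (suc w) n
  folkman {r} {w} lt h = complement , monochromatic⇒arrows (monochromatic lt) , clique-free
    where
    select-all : ∀ xs → select (replicate (length xs) true) xs ≡ xs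
    select-all [] = refl
    select-all (x ∷ xs) = cong (x ∷_) (select-all xs)
    clique-free : ¬ HasClique complement (suc w)
    clique-free K = <-irrefl (length-tabulate vert) (indepFree-sound (suc w) (allFin n) (replicate n true) h ys
        (proj₁ others)
        (perm-trans (↭-reflexive (trans (cong (λ l → select (replicate l true) (allFin n)) (sym
            (length-allFin n))) (select-all (allFin n)))) (proj₂ others))
        ys-indep)
      where
      open CliqueIn K
      ys : List (Fin n)
      ys = tabulate vert
      ys-unique : Unique ys
      ys-unique = AllPairs.tabulate⁺ (λ {i} {j} ne e → ne (injective i j e))
      ys-indep : Indep ys
      ys-indep = AllPairs.tabulate⁺ (λ {i} {j} ne → adjacent⇒apart (adjacent i j ne))
      others = extract-unique ys ys-unique (λ {y} _ → ∈-allFin y)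

-- Explicit triangle-free graphs

bits : ℕ → ℕ → Mask
bits zero c = []
bits (suc n) c = (c % 2 ≡ᵇ 1) ∷ bits n (c / 2)

-- Adjacency matrices, one binary number for each row.  The graphs on 27 and 39 vertices were found by simulated
-- annealing; the one on 35 vertices is the circulant graph on ℤ/35 with differences ±1, ±7, ±11, ±16, and its
-- first 31 and 33 vertices induce the other two.
rows-27 : List ℕ
rows-27 =
  0x45d04 ∷ 0x8ae08 ∷ 0x910059 ∷ 0x6200a6 ∷ 0x68a24 ∷ 0x94518 ∷ 0x603304 ∷ 0x903308 ∷ 0x50080e1 ∷ 0x60040d2 ∷
  0xd20023 ∷ 0xe10013 ∷ 0xb80c1 ∷ 0x740c2 ∷ 0x90a221 ∷ 0x605112 ∷ 0x6003824 ∷ 0x5003418 ∷ 0x6a02011 ∷ 0x5501022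
  ∷ 0x2284484 ∷ 0x1148848 ∷ 0x2088c48 ∷ 0x1044c84 ∷ 0x2aa0100 ∷ 0x1550200 ∷ 0xf0300 ∷ []

rows-35 : List ℕ
rows-35 =
  0x411090882 ∷ 0x22121105 ∷ 0x4424220a ∷ 0x88484414 ∷ 0x110908828 ∷ 0x221211050 ∷ 0x4424220a0 ∷ 0x84844141 ∷
  0x109088282 ∷ 0x212110504 ∷ 0x424220a08 ∷ 0x48441411 ∷ 0x90882822 ∷ 0x121105044 ∷ 0x24220a088 ∷ 0x484414110 ∷
  0x108828221 ∷ 0x211050442 ∷ 0x4220a0884 ∷ 0x44141109 ∷ 0x88282212 ∷ 0x110504424 ∷ 0x220a08848 ∷ 0x441411090 ∷
  0x82822121 ∷ 0x105044242 ∷ 0x20a088484 ∷ 0x414110908 ∷ 0x28221211 ∷ 0x50442422 ∷ 0xa0884844 ∷ 0x141109088 ∷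
  0x282212110 ∷ 0x504424220 ∷ 0x208848441 ∷ []

rows-39 : List ℕ
rows-39 =
  0x18080c8a00 ∷ 0x34880480c0 ∷ 0x2404502610 ∷ 0x420300ec00 ∷ 0x4003088164 ∷ 0x2280206c10 ∷ 0xb00211812 ∷
  0x840380e02 ∷ 0x2254402210 ∷ 0x80815185 ∷ 0x1100610ac ∷ 0x4240200e9 ∷ 0x5026002640 ∷ 0x80881112c ∷
  0x182c000228 ∷ 0x6032001b ∷ 0x20500e2240 ∷ 0x4a08818c00 ∷ 0x4224810403 ∷ 0x304410091 ∷ 0x5298008084 ∷
  0x5c080e0 ∷ 0x50a2280104 ∷ 0x1112262200 ∷ 0x34a8200018 ∷ 0x2048c01018 ∷ 0x802c5904 ∷ 0x103126003 ∷ 0xc00910500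
  ∷ 0x10144d800 ∷ 0x1582018180 ∷ 0x845500222 ∷ 0x6068880440 ∷ 0x4001e0168 ∷ 0x4251000806 ∷ 0x20900260c1 ∷
  0x41d05003 ∷ 0x903010126 ∷ 0x500561018 ∷ []

matrix : ℕ → List ℕ → Code
matrix n cs = map (bits n) cs

bit : Mask → ℕ → Bool
bit [] v = false
bit (b ∷ m) zero = b
bit (b ∷ m) (suc v) = bit m v

rowAt : Code → ℕ → Mask
rowAt [] u = []
rowAt (r ∷ C) zero = r
rowAt (r ∷ C) (suc u) = rowAt C u

entry : Code → ℕ → ℕ → Bool
entry C u v = bit (rowAt C u) v

bit-disjoint : ∀ m m′ w → disjoint m m′ ≡ true → bit m w ≡ true → bit m′ w ≡ true → ⊥
bit-disjoint (true ∷ m) (false ∷ m′) (suc w) h e e′ = bit-disjoint m m′ w h e e′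
bit-disjoint (false ∷ m) (b ∷ m′) (suc w) h e e′ = bit-disjoint m m′ w h e e′

sameᵇ : Bool → Bool → Bool
sameᵇ true b = b
sameᵇ false b = not b

sameᵇ-sound : ∀ a b → sameᵇ a b ≡ true → a ≡ b
sameᵇ-sound true true e = refl
sameᵇ-sound false false e = refl

symmetricᵇ irreflexiveᵇ triangleFreeᵇ : ℕ → Code → Bool
symmetricᵇ n C = allBelow (λ u → allBelow (λ v → sameᵇ (entry C u v) (entry C v u)) n) n
irreflexiveᵇ n C = allBelow (λ v → not (entry C v v)) n
triangleFreeᵇ n C = allBelow (λ u → allBelow (λ v → not (entry C u v) ∨ disjoint (rowAt C u) (rowAt C v)) n) n

module FromMatrix (n : ℕ) (C : Code) (symmetric : symmetricᵇ n C ≡ true)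
  (irreflexive : irreflexiveᵇ n C ≡ true) (triangleFree : triangleFreeᵇ n C ≡ true) where

  _~_ : Fin n → Fin n → Bool
  u ~ v = entry C (toℕ u) (toℕ v)

  ~-sym : ∀ u v → (u ~ v) ≡ (v ~ u)
  ~-sym u v = sameᵇ-sound _ _ (allBelow-sound _ n (allBelow-sound _ n symmetric (Fin.toℕ<n u)) (Fin.toℕ<n v))

  ~-irrefl : ∀ v → (v ~ v) ≡ false
  ~-irrefl v with v ~ v | allBelow-sound (λ v → not (entry C v v)) n irreflexive (Fin.toℕ<n v)
  ... | false | _ = refl

  ~-triangle : ∀ u v w → (u ~ v) ≡ true → (v ~ w) ≡ true → (u ~ w) ≡ true → ⊥
  ~-triangle u v w uv vw uw = bit-disjoint (rowAt C (toℕ u)) (rowAt C (toℕ v)) (toℕ w) disj uw vw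
    where
    disj : disjoint (rowAt C (toℕ u)) (rowAt C (toℕ v)) ≡ true
    disj = subst (λ b → not b ∨ disjoint (rowAt C (toℕ u)) (rowAt C (toℕ v)) ≡ true) uv
      (allBelow-sound (λ v → not (entry C (toℕ u) v) ∨ disjoint (rowAt C (toℕ u)) (rowAt C v)) n
        (allBelow-sound (λ u → allBelow (λ v → not (entry C u v) ∨ disjoint (rowAt C u)
            (rowAt C v)) n) n triangleFree (Fin.toℕ<n u)) (Fin.toℕ<n v))

  open Gluing _~_ ~-sym ~-irrefl ~-triangle public using (code)
  open ComplementOf _~_ ~-sym ~-irrefl ~-triangle public using (folkman)

folkman-27 : Folkman 13 8 27
folkman-27 = folkman (≤ᵇ⇒≤ 27 27 _) refl
  where open FromMatrix 27 (matrix 27 rows-27) refl refl refl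

folkman-31 : Folkman 15 9 31
folkman-31 = folkman (≤ᵇ⇒≤ 31 31 _) refl
  -- Rows are cut to 31 bits and only the first 31 rows are looked up, which gives the induced
  -- subgraph.
  where open FromMatrix 31 (matrix 31 rows-35) refl refl refl

folkman-33 : Folkman 16 9 33
folkman-33 = folkman (≤ᵇ⇒≤ 33 33 _) refl
  where open FromMatrix 33 (matrix 33 rows-35) refl refl refl

folkman-35 : Folkman 17 9 35
folkman-35 = folkman (≤ᵇ⇒≤ 35 35 _) refl
  where open FromMatrix 35 (matrix 35 rows-35) refl refl refl

folkman-39 : Folkman 19 10 39
folkman-39 = folkman (≤ᵇ⇒≤ 39 39 _) refl
  where open FromMatrix 39 (matrix 39 rows-39) refl refl refl

-- The bounds in terms of r, for q = r - k

fvGe : ∀ {r q} s → q + s ≡ 2 + r → FvGe r (twos r) q (r + suc (gap s))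
fvGe {r} s eq n G h = subst (_≤ n) (sym (+-suc r (gap s))) (LowerBound.lower-bound G s h eq)

fvGe-∸ : ∀ {r} k s → k ≤ r → s ≡ 2 + k → FvGe r (twos r) (r ∸ k) (r + suc (gap s))
fvGe-∸ {r} k s k≤r refl = fvGe (2 + k) (trans (regroup (r ∸ k) k) (cong (2 +_) (m∸n+n≡m k≤r)))
  where
  regroup : ∀ a b → a + (2 + b) ≡ 2 + (a + b)
  regroup = solve-∀

-- The values r = b + d with d < c are excluded one by one. There r + m reaches the Ramsey bound for
-- triangle-free graphs with independence number at most r - k - 1, so by `lower-bound′` the graph
-- has at least r + 3 + gap(k + 1) vertices, which is more than r + m.
fvEq⇒≥ : ∀ {r} k m b c → suc k ≤ b → m < 3 + gap (suc k) →
  allBelow (λ d → (b + d ∸ suc k ≤ᵇ 8) ∧ (ramseyNumber (b + d ∸ suc k) ≤ᵇ b + d + m)) c ≡ true →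
  b ≤ r → FvEq r (twos r) (r ∸ k) (r + m) → b + c ≤ r
fvEq⇒≥ {r} k m b c k<b m< check b≤r (_ , G , h) = ≮⇒≥ λ lt →
  below (r ∸ b) (sym (m+[n∸m]≡n b≤r)) (+-cancelˡ-< b _ _ (subst (_< b + c) (sym (m+[n∸m]≡n b≤r)) lt))
  where
  k<r : suc k ≤ r
  k<r = ≤-trans k<b b≤r
  below : ∀ d → r ≡ b + d → d < c → ⊥
  below d refl d<c with ∧-sound {b + d ∸ suc k ≤ᵇ 8} (allBelow-sound _ c check d<c)
  ... | q≤8 , ram = <⇒≱ (+-monoʳ-< r m<) (subst (_≤ r + m) (regroup r (gap (suc k)))
    (LowerBound.lower-bound′ G (r ∸ suc k) (suc k) (subst (InHv G r (twos r)) (+-∸-assoc 1 k<r) h)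
      (m∸n+n≡m k<r) (≤ᵇ-sound q≤8) (≤ᵇ-sound ram)))
    where
    regroup : ∀ r g → 3 + r + g ≡ r + (3 + g)
    regroup = solve-∀

folkman⇒fvEq : ∀ {r₀ r} k m → k ≤ r₀ → Folkman r₀ (r₀ ∸ k) (r₀ + m) → r₀ ≤ r →
  FvGe r (twos r) (r ∸ k) (r + m) → FvEq r (twos r) (r ∸ k) (r + m)
folkman⇒fvEq {r₀} {r} k m k≤r₀ F r₀≤r ge = ge , subst (λ r → Folkman r (r ∸ k) (r + m)) (m∸n+n≡m r₀≤r)
  (subst₂ (Folkman (r ∸ r₀ + r₀)) (sym (+-∸-assoc (r ∸ r₀) k≤r₀)) (sym (+-assoc (r ∸ r₀) r₀ m)) (folkman-+ (r ∸ r₀) F))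

theorem1p2 : (r : ℕ) → 8 ≤ r →
    ( FvGe r (twos r) (r ∸ 5) (r + 14)
    × (FvEq r (twos r) (r ∸ 5) (r + 14) → 13 ≤ r)
    × (13 ≤ r → FvEq r (twos r) (r ∸ 5) (r + 14)) )
    × ( (9 ≤ r → FvGe r (twos r) (r ∸ 6) (r + 16))
    × (15 ≤ r → FvEq r (twos r) (r ∸ 6) (r + 16)) )
    × ( (10 ≤ r → FvGe r (twos r) (r ∸ 7) (r + 17))
    × (10 ≤ r → FvEq r (twos r) (r ∸ 7) (r + 17) → 16 ≤ r)
    × (16 ≤ r → FvEq r (twos r) (r ∸ 7) (r + 17)) )
    × ( (11 ≤ r → FvGe r (twos r) (r ∸ 8) (r + 18))
    × (11 ≤ r → FvEq r (twos r) (r ∸ 8) (r + 18) → 17 ≤ r)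
    × (17 ≤ r → FvEq r (twos r) (r ∸ 8) (r + 18)) )
    × ( (12 ≤ r → FvGe r (twos r) (r ∸ 9) (r + 20))
    × (19 ≤ r → FvEq r (twos r) (r ∸ 9) (r + 20)) )
theorem1p2 r 8≤r =
  ( ge₅ , fvEq⇒≥ 5 14 8 5 (fact 6 8) (fact 15 15) refl 8≤r
  , λ le → folkman⇒fvEq 5 14 (fact 5 13) folkman-27 le ge₅ ) ,
  ( (λ _ → ge₆) , λ le → folkman⇒fvEq 6 16 (fact 6 15) folkman-31 le ge₆ ) ,
  ( (λ _ → ge₇) , fvEq⇒≥ 7 17 10 6 (fact 8 10) (fact 18 18) refl
  , λ le → folkman⇒fvEq 7 17 (fact 7 16) folkman-33 le ge₇ ) ,
  ( (λ _ → ge₈) , fvEq⇒≥ 8 18 11 6 (fact 9 11) (fact 19 19) refl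
  , λ le → folkman⇒fvEq 8 18 (fact 8 17) folkman-35 le ge₈ ) ,
  ( (λ le → fvGe-∸ 9 11 (≤-trans (fact 9 12) le) refl)
  , λ le → folkman⇒fvEq 9 20 (fact 9 19) folkman-39 le (fvGe-∸ 9 11 (≤-trans (fact 9 19) le) refl) )
  where
  fact : ∀ m n {_ : T (m ≤ᵇ n)} → m ≤ n
  fact m n {t} = ≤ᵇ⇒≤ m n t
  ge₅ = fvGe-∸ {r} 5 7 (≤-trans (fact 5 8) 8≤r) refl
  ge₆ = fvGe-∸ {r} 6 8 (≤-trans (fact 6 8) 8≤r) refl
  ge₇ = fvGe-∸ {r} 7 9 (≤-trans (fact 7 8) 8≤r) refl
  ge₈ = fvGe-∸ {r} 8 10 (≤-trans (fact 8 8) 8≤r) refl
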